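{- Let $F$ be a graph with $\chi(F)=r+1\ge3$. For every real $p>1$ and every $\varepsilon>0$ there exist $\delta>0$ and $n_0$ such that if $G$ is a graph on $n\ge n_0$ vertices containing no subgraph isomorphic to $F$ and $\lambda^{(p)}(G)\ge\left(1-\frac1r-\delta\right)n^{2-2/p}$, then the edit distance satisfies $d(G,T_r(n))\le\varepsilon n^2$.
   Context: For a graph $G$ on vertex set $\{1,\dots,n\}$ and real $p\ge1$, the $p$-spectral radius is $\lambda^{(p)}(G)=\max\{2\sum_{\{i,j\}\in E(G)}x_ix_j:\ x\in\mathbb R^n,\ |x_1|^p+\dots+|x_n|^p=1\}$. $T_r(n)$ is the complete $r$-partite graph on $n$ vertices with part sizes as equal as possible. For two graphs $G_1,G_2$ on the same $n$-vertex set (up to identification of vertex sets), the edit distance $d(G_1,G_2)$ is the minimum number of edge additions and deletions needed to turn $G_1$ into a graph isomorphic to $G_2$. -}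

module Defs where

open import Algebra.Bundles using (CommutativeRing; Semiring)
import Algebra.Definitions.RawSemiring as RawSemiringDefs
open import Axiom.ExcludedMiddle using (ExcludedMiddle)
open import Data.Bool using (if_then_else_; _xor_)
open import Data.Fin as Fin using (Fin; toℕ)
open import Data.Fin.Permutation using (Permutation′; _⟨$⟩ʳ_)
open import Data.List using (List; allFin; cartesianProduct; filter; filterᵇ; foldr; length)
open import Data.Nat as ℕ using (ℕ; NonZero)
open import Data.Nat.DivMod using (_%_)
open import Data.Product using (Σ; ∃; ∃-syntax; _×_; _,_; proj₁; proj₂)
open import Data.Sum using (_⊎_; inj₁; inj₂)
open import Function using (_⇔_)
open import Function.Definitions using (Injective)
open import Level using (0ℓ)
open import Relation.Binary using (Rel; Decidable; Symmetric; Irreflexive; IsStrictTotalOrder)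
import Relation.Binary.Construct.StrictToNonStrict as ToNonStrict
open import Relation.Binary.PropositionalEquality as ≡ using (_≡_; _≢_; ≢-sym)
open import Relation.Nullary using (Dec; ¬_; yes; no; does; ¬?; contradiction)
open import Relation.Unary using (Pred; Satisfiable)

------------------------------------------------------------------------
-- Real numbers

-- The real numbers, given axiomatically as a complete ordered field (unique up
-- to isomorphism).  The field operation _⁻¹ and sup are total functions with
-- unspecified values at 0# and on empty or unbounded sets respectively.
record CompleteOrderedField : Set₁ where
  field
    commutativeRing : CommutativeRing 0ℓ 0ℓ

  open CommutativeRing commutativeRing public

  infix  4 _<_
  infix  8 _⁻¹
  field
    _<_                : Rel Carrier 0ℓ
    isStrictTotalOrder : IsStrictTotalOrder _≈_ _<_
    0<1                : 0# < 1#
    +-monoˡ-<          : ∀ z {x y} → x < y → x + z < y + z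
    *-pos              : ∀ {x y} → 0# < x → 0# < y → 0# < x * y
    _⁻¹                : Carrier → Carrier
    ⁻¹-inverseʳ        : ∀ {x} → ¬ x ≈ 0# → x * x ⁻¹ ≈ 1#

  open IsStrictTotalOrder isStrictTotalOrder public using (compare; _<?_)
  open ToNonStrict _≈_ _<_ public using (_≤_)

  UpperBound : Pred Carrier 0ℓ → Carrier → Set
  UpperBound S b = ∀ {x} → S x → x ≤ b

  -- An upper bound s such that no y < s is an upper bound, the latter in the
  -- positive form "some x ∈ S exceeds y".  In classical mathematics this is the
  -- least upper bound; in Agda it makes the reals classical (excludedMiddle).
  IsSup : Pred Carrier 0ℓ → Carrier → Set
  IsSup S s = UpperBound S s × (∀ {y} → y < s → ∃[ x ] S x × y < x)

  IsMax : Pred Carrier 0ℓ → Carrier → Set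
  IsMax S m = S m × UpperBound S m

  field
    sup       : Pred Carrier 0ℓ → Carrier
    sup-isSup : ∀ S → Satisfiable S → ∃ (UpperBound S) → IsSup S (sup S)

  open RawSemiringDefs (Semiring.rawSemiring semiring) public using (_^_; sum)

  fromℕ : ℕ → Carrier
  fromℕ n = RawSemiringDefs._×_ (Semiring.rawSemiring semiring) n 1#

  ∣_∣ : Carrier → Carrier
  ∣ x ∣ = if does (x <? 0#) then - x else x

  -- For x ≥ 1 and p ≥ 0, the supremum of x^(a/b) over the rationals 0 ≤ a/b ≤ p,
  -- where t ≤ x^(a/b) is written t^b ≤ x^a.
  powFrom1 : Carrier → Carrier → Carrier
  powFrom1 x p = sup λ t → ∃[ a ] ∃[ b ] 0 ℕ.< b × fromℕ a ≤ p * fromℕ b × 0# ≤ t × t ^ b ≤ x ^ a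

  -- x ^ℝ p is the real power x^p for x ≥ 0 and p > 0 (the only case used):
  -- x^p = ((1/x)^p)⁻¹ for 0 < x < 1, and 0^p = 0.
  infixr 8 _^ℝ_
  _^ℝ_ : Carrier → Carrier → Carrier
  x ^ℝ p =
    if does (x <? 1#)
    then (if does (0# <? x) then (powFrom1 (x ⁻¹) p) ⁻¹ else 0#)
    else powFrom1 x p

module _ (ℝ : CompleteOrderedField) where
  open CompleteOrderedField ℝ
  private module < = IsStrictTotalOrder isStrictTotalOrder

  excludedMiddle : ExcludedMiddle 0ℓ
  excludedMiddle {P} = decide (0# <? sup S)
    where
    S : Pred Carrier 0ℓ
    S x = x ≈ 0# ⊎ (x ≈ 1# × P)

    bound : UpperBound S 1#
    bound (inj₁ x≈0)       = inj₁ (<.<-respˡ-≈ (sym x≈0) 0<1)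
    bound (inj₂ (x≈1 , _)) = inj₂ x≈1

    isSup : IsSup S (sup S)
    isSup = sup-isSup S (0# , inj₁ refl) (1# , bound)

    positive : ∀ {s} → 1# ≤ s → 0# < s
    positive (inj₁ 1<s) = <.trans 0<1 1<s
    positive (inj₂ 1≈s) = <.<-respʳ-≈ 1≈s 0<1

    witness : ∃[ x ] S x × 0# < x → P
    witness (_ , inj₁ x≈0 , 0<x)   = contradiction 0<x (<.irrefl (sym x≈0))
    witness (_ , inj₂ (_ , p) , _) = p

    decide : Dec (0# < sup S) → Dec P
    decide (yes 0<s) = yes (witness (proj₂ isSup 0<s))
    decide (no  0≮s) = no λ p → 0≮s (positive (proj₁ isSup (inj₂ (refl , p))))

------------------------------------------------------------------------
-- Finite simple graphs

record Graph (n : ℕ) : Set₁ where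
  field
    Adj         : Rel (Fin n) 0ℓ
    adj?        : Decidable Adj
    symmetric   : Symmetric Adj
    irreflexive : Irreflexive _≡_ Adj

open Graph

pairs : ∀ n → List (Fin n × Fin n)
pairs n = filter (λ (i , j) → i Fin.<? j) (cartesianProduct (allFin n) (allFin n))

edges : ∀ {n} → Graph n → List (Fin n × Fin n)
edges {n} G = filter (λ (i , j) → adj? G i j) (pairs n)

Colourable : ∀ {n} → Graph n → ℕ → Set
Colourable {n} G k = Σ (Fin n → Fin k) λ c → ∀ {i j} → Adj G i j → c i ≢ c j

HasChromaticNumber : ∀ {n} → Graph n → ℕ → Set
HasChromaticNumber G k = Colourable G k × (∀ m → Colourable G m → k ℕ.≤ m)

-- Some subgraph of G, not necessarily induced, is isomorphic to F.
Contains : ∀ {m n} → Graph n → Graph m → Set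
Contains {m} {n} G F =
  Σ (Fin m → Fin n) λ f → Injective _≡_ _≡_ f × (∀ {i j} → Adj F i j → Adj G (f i) (f j))

infix 4 _≅_
_≅_ : ∀ {n} → Graph n → Graph n → Set
_≅_ {n} G H = Σ (Permutation′ n) λ π → ∀ i j → Adj G i j ⇔ Adj H (π ⟨$⟩ʳ i) (π ⟨$⟩ʳ j)

-- T_r(n): the parts are the residue classes modulo r, whose sizes within
-- {0,…,n-1} differ by at most one.
turán : ∀ r .{{_ : NonZero r}} n → Graph n
turán r n = record
  { Adj         = λ i j → toℕ i % r ≢ toℕ j % r
  ; adj?        = λ i j → ¬? (toℕ i % r ℕ.≟ toℕ j % r)
  ; symmetric   = ≢-sym
  ; irreflexive = λ { ≡.refl i≢i → i≢i ≡.refl }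
  }

-- The number of edges to add or delete in order to turn G into H, the vertices
-- being fixed.
edits : ∀ {n} → Graph n → Graph n → ℕ
edits {n} G H = length (filterᵇ (λ (i , j) → does (adj? G i j) xor does (adj? H i j)) (pairs n))

-- d is the least number of edits turning G₁ into a graph isomorphic to G₂.
IsEditDistance : ∀ {n} → Graph n → Graph n → ℕ → Set₁
IsEditDistance {n} G₁ G₂ d =
  (∃[ H ] H ≅ G₂ × edits G₁ H ≡ d) × (∀ H → H ≅ G₂ → d ℕ.≤ edits G₁ H)

------------------------------------------------------------------------
-- The p-spectral radius

module _ (ℝ : CompleteOrderedField) where
  open CompleteOrderedField ℝ

  edgeSum : ∀ {n} → Graph n → (Fin n → Carrier) → Carrier
  edgeSum G x = foldr (λ (i , j) s → x i * x j + s) 0# (edges G)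

  IsSpectralRadius : ∀ {n} → Carrier → Graph n → Carrier → Set
  IsSpectralRadius {n} p G = IsMax λ v →
    Σ (Fin n → Carrier) λ x → sum (λ i → ∣ x i ∣ ^ℝ p) ≈ 1# × v ≈ fromℕ 2 * edgeSum G x

{-# OPTIONS --safe #-}

-- By Erdős's theorem on complete multipartite hypergraphs, an F-free graph has
-- only o(n^(r+1)) cliques K_(r+1), and then the Moon–Moser inequalities bound the
-- form ∑_{i~j} uᵢuⱼ by (1 - 1/r + o(1)) (∑ uᵢ)² for bounded nonnegative weights u.
-- Scale an extremal vector so that ∑ uᵢᵖ = n.  Large weights contribute little,
-- because p > 1, and ∑ uᵢ ≤ n by convexity, so a form of (1 - 1/r - o(1)) n² forces
-- ∑ uᵢ ≥ (1 - o(1)) n.  By strict convexity most uᵢ are then close to 1, whence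
-- G has (1 - 1/r - o(1)) n²/2 edges.
--
-- The defect in the Moon–Moser inequality, averaged over the r-cliques K, yields
-- one to which almost every vertex has r - 1 neighbours and whose (r-1)-subsets
-- have few edges in their common neighbourhoods.  Colouring a vertex by its
-- non-neighbour in K leaves few monochromatic edges; as G has many edges, the
-- classes are almost balanced.  Matching them with the classes of T_r(n) so that
-- the fewest vertices are misplaced costs o(n²) edits.

module Submission where

open import Defs
open import Algebra.Bundles using (CommutativeMonoid)
import Algebra.Properties.CommutativeSemigroup
import Algebra.Properties.CommutativeSemiring.Exp
import Algebra.Properties.Ring
import Algebra.Properties.Semiring.Mult
import Algebra.Properties.Semiring.Sum
import Algebra.Solver.Ring
open import Algebra.Solver.Ring.AlmostCommutativeRing
  using (fromCommutativeRing; _-Raw-AlmostCommutative⟶_; Induced-equivalence)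
open import Data.Bool as Bool using (Bool; true; false; if_then_else_; not; _∧_; _xor_)
open import Data.Bool.Properties using (∧-commutativeMonoid; ∧-conicalˡ; ∧-conicalʳ)
open import Data.Empty using (⊥-elim)
open import Data.Fin as Fin using (Fin; zero; suc; toℕ; _↑ˡ_; _↑ʳ_)
open import Data.Fin.Permutation as Perm using (Permutation′; _⟨$⟩ʳ_)
import Data.Fin.Properties as Fin
open import Data.Integer as ℤ using (ℤ; +_; -[1+_])
import Data.Integer.Properties as ℤ
open import Data.List as List using (List; allFin; cartesianProduct; filterᵇ; foldr; length)
open import Data.Maybe using (just; nothing)
open import Data.Nat as ℕ using (ℕ; zero; suc; NonZero; z≤n; s≤s)
open import Data.Nat.DivMod using (_%_; _/_; _mod_; m%n<n; m≡m%n+[m/n]*n; [m+n]%n≡m%n; m<n⇒m%n≡m)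
import Data.Nat.Properties as ℕ
open import Data.Product using (Σ; ∃; ∃-syntax; _×_; _,_; proj₁; proj₂)
open import Data.Sum using (_⊎_; inj₁; inj₂)
open import Data.Vec as Vec using (Vec; []; _∷_; insertAt; removeAt)
import Data.Vec.Functional as Vector
import Data.Vec.Properties as Vec
open import Function using (_∘_; id; mk⇔)
open import Function.Construct.Identity using (⇔-id)
open import Function.Definitions using (Injective)
open import Level using (0ℓ)
open import Relation.Binary using (StrictTotalOrder; IsStrictTotalOrder)
import Relation.Binary.Construct.StrictToNonStrict as ToNonStrict
open import Relation.Binary.Definitions using (WeaklyDecidable; tri<; tri≈; tri>)
open import Relation.Binary.PropositionalEquality as ≡ using (_≡_; _≢_)
import Relation.Binary.Reasoning.Setoid
import Relation.Binary.Reasoning.StrictPartialOrder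
open import Relation.Nullary using (Dec; ¬_; ¬?; yes; no; does; contradiction; _×-dec_)
open import Relation.Nullary.Decidable using (dec-true; dec-false; does-⇔)
import Relation.Unary as Unary
open Algebra.Properties.CommutativeSemigroup (CommutativeMonoid.commutativeSemigroup ∧-commutativeMonoid)
  using (x∙yz≈y∙xz) renaming (interchange to ∧-interchange)

-- No law of exponents is proved for `_^ℝ_`; it is only compared with rational powers. A natural k
-- with (k+1)/k ≤ p is fixed, and the weights are written u = v^k with ∑ v^(k+1) ≤ n. This weaker
-- normalisation keeps the convexity that p > 1 provides and leaves only natural powers. For each n,
-- p is approximated from above by a fraction so close that the rescaling costs only a factor 1 + τ.
-- Truncation is forced: the weighted number of (r+1)-cliques is controlled by the unweighted one
-- only for bounded weights. Cliques are ordered tuples, so that insertion of a coordinate replaces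
-- binomial coefficients, and degree sums count each edge twice. Every o(1) is an explicit constant,
-- and a free θ in inequalities such as 2ab ≤ a²/θ + θb² takes the place of square roots. The
-- constants are chosen from the end backwards: balancing, stability, concentration, clique density,
-- and δ last.

-- Ordered-field arithmetic, the ring solver, and classical choices of constants.

module OrderedField (ℝ : CompleteOrderedField) where

  open CompleteOrderedField ℝ hiding (zero)
  open Algebra.Properties.Ring ring
  open Algebra.Properties.Semiring.Mult semiring
    using (×1-homo-*; ×-homo-+)

  private
    ℤ-ring = ℤ.+-*-rawRing
    R = fromCommutativeRing commutativeRing

  module < = IsStrictTotalOrder isStrictTotalOrder

  -- Solver constants have to unfold to the forms that occur in goals: `0#`, `1#`, and `fromℕ n` for
  -- n ≥ 2. As `fromℕ 1` is `1# + 0#`, the first two cases are separate.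
  ⟦_⟧ℕ : ℕ → Carrier
  ⟦ 0 ⟧ℕ  = 0#
  ⟦ 1 ⟧ℕ  = 1#
  ⟦ suc (suc n) ⟧ℕ = fromℕ (suc (suc n))

  ⟦_⟧ℕ≈ : ∀ n → ⟦ n ⟧ℕ ≈ fromℕ n
  ⟦ 0 ⟧ℕ≈  = refl
  ⟦ 1 ⟧ℕ≈  = sym (+-identityʳ 1#)
  ⟦ suc (suc n) ⟧ℕ≈ = refl

  ⟦_⟧ℤ : ℤ → Carrier
  ⟦ + n ⟧ℤ  = ⟦ n ⟧ℕ
  ⟦ -[1+ n ] ⟧ℤ = - ⟦ suc n ⟧ℕ

  module ≈ where
    open Relation.Binary.Reasoning.Setoid setoid public

  ⟦⟧ℤ-⊖ : ∀ m n → ⟦ m ℤ.⊖ n ⟧ℤ ≈ fromℕ m - fromℕ n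
  ⟦⟧ℤ-⊖ m zero = begin
    ⟦ m ⟧ℕ  ≈⟨ ⟦ m ⟧ℕ≈ ⟩
    fromℕ m  ≈⟨ +-identityʳ _ ⟨
    fromℕ m + 0#  ≈⟨ +-congˡ -0#≈0# ⟨
    fromℕ m - 0#  ∎
    where open ≈
  ⟦⟧ℤ-⊖ zero (suc n) = begin
    - ⟦ suc n ⟧ℕ  ≈⟨ -‿cong ⟦ suc n ⟧ℕ≈ ⟩
    - fromℕ (suc n)  ≈⟨ +-identityˡ _ ⟨
    0# - fromℕ (suc n)  ∎
    where open ≈
  ⟦⟧ℤ-⊖ (suc m) (suc n) = begin
    ⟦ suc m ℤ.⊖ suc n ⟧ℤ  ≡⟨ ≡.cong ⟦_⟧ℤ (ℤ.[1+m]⊖[1+n]≡m⊖n m n) ⟩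
    ⟦ m ℤ.⊖ n ⟧ℤ  ≈⟨ ⟦⟧ℤ-⊖ m n ⟩
    fromℕ m - fromℕ n  ≈⟨ +-congʳ (+-identityʳ _) ⟨
    fromℕ m + 0# - fromℕ n  ≈⟨ +-congʳ (+-congˡ (-‿inverseʳ 1#)) ⟨
    fromℕ m + (1# - 1#) - fromℕ n  ≈⟨ +-congʳ (+-assoc _ _ _) ⟨
    fromℕ m + 1# - 1# - fromℕ n  ≈⟨ +-assoc _ _ _ ⟩
    fromℕ m + 1# + (- 1# - fromℕ n)  ≈⟨ +-cong (+-comm _ _) (-‿+-comm _ _) ⟩
    1# + fromℕ m - (1# + fromℕ n)  ∎
    where open ≈

  ⟦⟧ℤ-neg : ∀ i → ⟦ ℤ.- i ⟧ℤ ≈ - ⟦ i ⟧ℤ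
  ⟦⟧ℤ-neg (+ 0)  = sym -0#≈0#
  ⟦⟧ℤ-neg (+ suc n)  = refl
  ⟦⟧ℤ-neg -[1+ n ]  = sym (-‿involutive _)

  ⟦⟧ℤ-+ : ∀ i j → ⟦ i ℤ.+ j ⟧ℤ ≈ ⟦ i ⟧ℤ + ⟦ j ⟧ℤ
  ⟦⟧ℤ-+ (+ m) (+ n) = trans ⟦ m ℕ.+ n ⟧ℕ≈
    (trans (×-homo-+ 1# m n) (sym (+-cong ⟦ m ⟧ℕ≈ ⟦ n ⟧ℕ≈)))
  ⟦⟧ℤ-+ (+ m) -[1+ n ] = trans (⟦⟧ℤ-⊖ m (suc n)) (sym (+-cong ⟦ m ⟧ℕ≈ (-‿cong ⟦ suc n ⟧ℕ≈)))
  ⟦⟧ℤ-+ -[1+ m ] (+ n) = trans (⟦⟧ℤ-⊖ n (suc m))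
    (trans (+-comm _ _) (sym (+-cong (-‿cong ⟦ suc m ⟧ℕ≈) ⟦ n ⟧ℕ≈)))
  ⟦⟧ℤ-+ -[1+ m ] -[1+ n ] = begin
    - ⟦ suc (suc (m ℕ.+ n)) ⟧ℕ  ≡⟨ ≡.cong (λ k → - ⟦ k ⟧ℕ) (ℕ.+-suc (suc m) n) ⟨
    - ⟦ suc m ℕ.+ suc n ⟧ℕ  ≈⟨ -‿cong ⟦ suc m ℕ.+ suc n ⟧ℕ≈ ⟩
    - fromℕ (suc m ℕ.+ suc n)  ≈⟨ -‿cong (×-homo-+ 1# (suc m) (suc n)) ⟩
    - (fromℕ (suc m) + fromℕ (suc n))  ≈⟨ -‿+-comm _ _ ⟨
    - fromℕ (suc m) - fromℕ (suc n)  ≈⟨ +-cong (-‿cong ⟦ suc m ⟧ℕ≈) (-‿cong ⟦ suc n ⟧ℕ≈) ⟨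
    - ⟦ suc m ⟧ℕ - ⟦ suc n ⟧ℕ  ∎
    where open ≈

  ⟦⟧ℤ-+*+ : ∀ m n → ⟦ + m ℤ.* + n ⟧ℤ ≈ ⟦ m ⟧ℕ * ⟦ n ⟧ℕ
  ⟦⟧ℤ-+*+ m n = begin
    ⟦ + m ℤ.* + n ⟧ℤ  ≡⟨ ≡.cong ⟦_⟧ℤ (ℤ.pos-* m n) ⟨
    ⟦ m ℕ.* n ⟧ℕ  ≈⟨ ⟦ m ℕ.* n ⟧ℕ≈ ⟩
    fromℕ (m ℕ.* n)  ≈⟨ ×1-homo-* m n ⟩
    fromℕ m * fromℕ n  ≈⟨ *-cong ⟦ m ⟧ℕ≈ ⟦ n ⟧ℕ≈ ⟨
    ⟦ m ⟧ℕ * ⟦ n ⟧ℕ  ∎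
    where open ≈

  ⟦⟧ℤ-+* : ∀ m j → ⟦ + m ℤ.* j ⟧ℤ ≈ ⟦ m ⟧ℕ * ⟦ j ⟧ℤ
  ⟦⟧ℤ-+* m (+ n)  = ⟦⟧ℤ-+*+ m n
  ⟦⟧ℤ-+* m -[1+ n ] = begin
    ⟦ + m ℤ.* -[1+ n ] ⟧ℤ  ≡⟨ ≡.cong ⟦_⟧ℤ (ℤ.neg-distribʳ-* (+ m) (+ suc n)) ⟨
    ⟦ ℤ.- (+ m ℤ.* + suc n) ⟧ℤ  ≈⟨ ⟦⟧ℤ-neg (+ m ℤ.* + suc n) ⟩
    - ⟦ + m ℤ.* + suc n ⟧ℤ  ≈⟨ -‿cong (⟦⟧ℤ-+*+ m (suc n)) ⟩
    - (⟦ m ⟧ℕ * ⟦ suc n ⟧ℕ)  ≈⟨ -‿distribʳ-* _ _ ⟩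
    ⟦ m ⟧ℕ * - ⟦ suc n ⟧ℕ  ∎
    where open ≈

  ⟦⟧ℤ-* : ∀ i j → ⟦ i ℤ.* j ⟧ℤ ≈ ⟦ i ⟧ℤ * ⟦ j ⟧ℤ
  ⟦⟧ℤ-* (+ m) j  = ⟦⟧ℤ-+* m j
  ⟦⟧ℤ-* -[1+ m ] j = begin
    ⟦ -[1+ m ] ℤ.* j ⟧ℤ  ≡⟨ ≡.cong ⟦_⟧ℤ (ℤ.neg-distribˡ-* (+ suc m) j) ⟨
    ⟦ ℤ.- (+ suc m ℤ.* j) ⟧ℤ  ≈⟨ ⟦⟧ℤ-neg (+ suc m ℤ.* j) ⟩
    - ⟦ + suc m ℤ.* j ⟧ℤ  ≈⟨ -‿cong (⟦⟧ℤ-+* (suc m) j) ⟩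
    - (⟦ suc m ⟧ℕ * ⟦ j ⟧ℤ)  ≈⟨ -‿distribˡ-* _ _ ⟩
    - ⟦ suc m ⟧ℕ * ⟦ j ⟧ℤ  ∎
    where open ≈

  private
    ℤ⟶R : ℤ-ring -Raw-AlmostCommutative⟶ R
    ℤ⟶R = record
      { ⟦_⟧  = ⟦_⟧ℤ
      ; +-homo = ⟦⟧ℤ-+
      ; *-homo = ⟦⟧ℤ-*
      ; -‿homo = ⟦⟧ℤ-neg
      ; 0-homo = refl
      ; 1-homo = refl
      }

    coeff≟ : WeaklyDecidable (Induced-equivalence ℤ⟶R)
    coeff≟ i j with i ℤ.≟ j
    ... | yes ≡.refl = just refl
    ... | no  _  = nothing

  open Algebra.Solver.Ring ℤ-ring R ℤ⟶R coeff≟ public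
    using (Polynomial; solve; con; _:+_; _:*_; _:-_; :-_; _:^_; _:=_)

  :0 :1 :2 : ∀ {n} → Polynomial n
  :0 = con (+ 0)
  :1 = con (+ 1)
  :2 = con (+ 2)

  em : {P : Set} → Dec P
  em = excludedMiddle ℝ

  strictTotalOrder : StrictTotalOrder 0ℓ 0ℓ 0ℓ
  strictTotalOrder = record { isStrictTotalOrder = isStrictTotalOrder }

  module ≤-Reasoning = Relation.Binary.Reasoning.StrictPartialOrder
    (StrictTotalOrder.strictPartialOrder strictTotalOrder)

  ≤-refl : ∀ {x} → x ≤ x
  ≤-refl = inj₂ refl

  ≤-reflexive : ∀ {x y} → x ≈ y → x ≤ y
  ≤-reflexive = inj₂

  ≤-trans : ∀ {x y z} → x ≤ y → y ≤ z → x ≤ z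
  ≤-trans = ToNonStrict.trans _≈_ _<_ isEquivalence <.<-resp-≈ <.trans

  <-≤-trans : ∀ {x y z} → x < y → y ≤ z → x < z
  <-≤-trans = ToNonStrict.<-≤-trans _≈_ _<_ <.trans <.<-respʳ-≈

  ≤-<-trans : ∀ {x y z} → x ≤ y → y < z → x < z
  ≤-<-trans = ToNonStrict.≤-<-trans _≈_ _<_ sym <.trans <.<-respˡ-≈

  <⇒≤ : ∀ {x y} → x < y → x ≤ y
  <⇒≤ = inj₁

  ≮⇒≥ : ∀ {x y} → ¬ x < y → y ≤ x
  ≮⇒≥ {x} {y} x≮y with compare x y
  ... | tri< x<y _ _ = contradiction x<y x≮y
  ... | tri≈ _ x≈y _ = inj₂ (sym x≈y)
  ... | tri> _ _ y<x = inj₁ y<x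

  ≤⇒≯ : ∀ {x y} → x ≤ y → ¬ y < x
  ≤⇒≯ x≤y y<x = <.irrefl refl (≤-<-trans x≤y y<x)

  ≰⇒> : ∀ {x y} → ¬ x ≤ y → y < x
  ≰⇒> {x} {y} x≰y with compare x y
  ... | tri< x<y _ _ = contradiction (inj₁ x<y) x≰y
  ... | tri≈ _ x≈y _ = contradiction (inj₂ x≈y) x≰y
  ... | tri> _ _ y<x = y<x

  ≤-total : ∀ x y → x ≤ y ⊎ y ≤ x
  ≤-total = ToNonStrict.total _≈_ _<_ compare

  <-or-≥ : ∀ x y → x < y ⊎ y ≤ x
  <-or-≥ x y with x <? y
  ... | yes x<y = inj₁ x<y
  ... | no  x≮y = inj₂ (≮⇒≥ x≮y)

  -- Inequalities are proved from a certificate: the ring solver writes the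
  -- right-hand side as the left-hand side plus a manifestly nonnegative term.
  ≤-cert : ∀ {x y c} → y ≈ x + c → 0# ≤ c → x ≤ y
  ≤-cert {x} {y} {c} y≈x+c (inj₁ 0<c) = inj₁ (begin-strict
    x  ≈⟨ +-identityˡ x ⟨
    0# + x  <⟨ +-monoˡ-< x 0<c ⟩
    c + x  ≈⟨ +-comm c x ⟩
    x + c  ≈⟨ y≈x+c ⟨
    y  ∎)
    where open ≤-Reasoning
  ≤-cert y≈x+c (inj₂ 0≈c) = inj₂ (sym (trans y≈x+c (trans (+-congˡ (sym 0≈c)) (+-identityʳ _))))

  <-cert : ∀ {x y c} → y ≈ x + c → 0# < c → x < y
  <-cert y≈x+c 0<c with ≤-cert y≈x+c (inj₁ 0<c)
  ... | inj₁ x<y = x<y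
  ... | inj₂ x≈y = contradiction 0<c (<.irrefl (sym (begin
    _  ≈⟨ solve 2 (λ x c → c := x :+ c :- x) refl _ _ ⟩
    _ + _ - _  ≈⟨ +-congʳ y≈x+c ⟨
    _ - _  ≈⟨ +-congʳ x≈y ⟨
    _ - _  ≈⟨ -‿inverseʳ _ ⟩
    0#  ∎)))
    where open ≈

  <⇒0<- : ∀ {x y} → x < y → 0# < y - x
  <⇒0<- {x} {y} x<y = begin-strict
    0#  ≈⟨ -‿inverseʳ x ⟨
    x - x  <⟨ +-monoˡ-< (- x) x<y ⟩
    y - x  ∎
    where open ≤-Reasoning

  ≤⇒0≤- : ∀ {x y} → x ≤ y → 0# ≤ y - x
  ≤⇒0≤- (inj₁ x<y)  = inj₁ (<⇒0<- x<y)
  ≤⇒0≤- {x} (inj₂ x≈y) = inj₂ (trans (sym (-‿inverseʳ x)) (+-congʳ x≈y))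

  +-monoˡ-≤ : ∀ z {x y} → x ≤ y → x + z ≤ y + z
  +-monoˡ-≤ z (inj₁ x<y) = inj₁ (+-monoˡ-< z x<y)
  +-monoˡ-≤ z (inj₂ x≈y) = inj₂ (+-congʳ x≈y)

  +-monoʳ-≤ : ∀ z {x y} → x ≤ y → z + x ≤ z + y
  +-monoʳ-≤ z x≤y = ≤-trans (≤-reflexive (+-comm _ _))
    (≤-trans (+-monoˡ-≤ z x≤y) (≤-reflexive (+-comm _ _)))

  +-mono-≤ : ∀ {x y u v} → x ≤ y → u ≤ v → x + u ≤ y + v
  +-mono-≤ x≤y u≤v = ≤-trans (+-monoˡ-≤ _ x≤y) (+-monoʳ-≤ _ u≤v)

  +-mono-<-≤ : ∀ {x y u v} → x < y → u ≤ v → x + u < y + v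
  +-mono-<-≤ x<y u≤v = <-≤-trans (+-monoˡ-< _ x<y) (+-monoʳ-≤ _ u≤v)

  +-mono-≤-< : ∀ {x y u v} → x ≤ y → u < v → x + u < y + v
  +-mono-≤-< x≤y u<v = ≤-<-trans (≤-reflexive (+-comm _ _)) (<-≤-trans (+-mono-<-≤ u<v x≤y) (≤-reflexive (+-comm _ _)))

  +-nonneg : ∀ {x y} → 0# ≤ x → 0# ≤ y → 0# ≤ x + y
  +-nonneg 0≤x 0≤y = ≤-trans (≤-reflexive (sym (+-identityˡ 0#))) (+-mono-≤ 0≤x 0≤y)

  +-pos-nonneg : ∀ {x y} → 0# < x → 0# ≤ y → 0# < x + y
  +-pos-nonneg 0<x 0≤y = ≤-<-trans (≤-reflexive (sym (+-identityˡ 0#))) (+-mono-<-≤ 0<x 0≤y)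

  *-nonneg : ∀ {x y} → 0# ≤ x → 0# ≤ y → 0# ≤ x * y
  *-nonneg (inj₁ 0<x) (inj₁ 0<y) = inj₁ (*-pos 0<x 0<y)
  *-nonneg (inj₁ 0<x) (inj₂ 0≈y) = inj₂ (trans (sym (zeroʳ _)) (*-congˡ 0≈y))
  *-nonneg (inj₂ 0≈x) 0≤y  = inj₂ (trans (sym (zeroˡ _)) (*-congʳ 0≈x))

  0≤1 : 0# ≤ 1#
  0≤1 = inj₁ 0<1

  *-monoˡ-≤ : ∀ {z x y} → 0# ≤ z → x ≤ y → z * x ≤ z * y
  *-monoˡ-≤ {z} {x} {y} 0≤z x≤y = ≤-cert
    (solve 3 (λ z x y → z :* y := z :* x :+ z :* (y :- x)) refl z x y)
    (*-nonneg 0≤z (≤⇒0≤- x≤y))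

  *-monoʳ-≤ : ∀ {z x y} → 0# ≤ z → x ≤ y → x * z ≤ y * z
  *-monoʳ-≤ 0≤z x≤y = ≤-trans (≤-reflexive (*-comm _ _))
    (≤-trans (*-monoˡ-≤ 0≤z x≤y) (≤-reflexive (*-comm _ _)))

  *-mono-≤ : ∀ {x y u v} → 0# ≤ x → x ≤ y → 0# ≤ u → u ≤ v → x * u ≤ y * v
  *-mono-≤ 0≤x x≤y 0≤u u≤v = ≤-trans (*-monoˡ-≤ 0≤x u≤v) (*-monoʳ-≤ (≤-trans 0≤u u≤v) x≤y)

  *-monoˡ-< : ∀ {z x y} → 0# < z → x < y → z * x < z * y
  *-monoˡ-< {z} {x} {y} 0<z x<y = <-cert
    (solve 3 (λ z x y → z :* y := z :* x :+ z :* (y :- x)) refl z x y)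
    (*-pos 0<z (<⇒0<- x<y))

  *-cancelˡ-≤ : ∀ {z x y} → 0# < z → z * x ≤ z * y → x ≤ y
  *-cancelˡ-≤ 0<z zx≤zy = ≮⇒≥ λ y<x → ≤⇒≯ zx≤zy (*-monoˡ-< 0<z y<x)

  *-cancelˡ-< : ∀ {z x y} → 0# ≤ z → z * x < z * y → x < y
  *-cancelˡ-< 0≤z zx<zy = ≰⇒> λ y≤x → ≤⇒≯ (*-monoˡ-≤ 0≤z y≤x) zx<zy

  square-nonneg : ∀ x → 0# ≤ x * x
  square-nonneg x with ≤-total 0# x
  ... | inj₁ 0≤x = *-nonneg 0≤x 0≤x
  ... | inj₂ x≤0 = ≤-trans (*-nonneg (≤⇒0≤- x≤0) (≤⇒0≤- x≤0))
    (≤-reflexive (solve 1 (λ x → (:0 :- x) :* (:0 :- x) := x :* x) refl x))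

  ⁻¹-inverseˡ : ∀ {x} → ¬ x ≈ 0# → x ⁻¹ * x ≈ 1#
  ⁻¹-inverseˡ x≉0 = trans (*-comm _ _) (⁻¹-inverseʳ x≉0)

  pos⇒≉0 : ∀ {x} → 0# < x → ¬ x ≈ 0#
  pos⇒≉0 0<x x≈0 = <.irrefl (sym x≈0) 0<x

  *-⁻¹ : ∀ {x} → 0# < x → x * x ⁻¹ ≈ 1#
  *-⁻¹ 0<x = ⁻¹-inverseʳ (pos⇒≉0 0<x)

  ⁻¹-pos : ∀ {x} → 0# < x → 0# < x ⁻¹
  ⁻¹-pos {x} 0<x = *-cancelˡ-< (<⇒≤ 0<x) (begin-strict
    x * 0#  ≈⟨ zeroʳ x ⟩
    0#  <⟨ 0<1 ⟩
    1#  ≈⟨ *-⁻¹ 0<x ⟨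
    x * x ⁻¹  ∎)
    where open ≤-Reasoning

  fromℕ-nonneg : ∀ n → 0# ≤ fromℕ n
  fromℕ-nonneg zero  = ≤-refl
  fromℕ-nonneg (suc n) = +-nonneg 0≤1 (fromℕ-nonneg n)

  fromℕ-pos : ∀ n → 0# < fromℕ (suc n)
  fromℕ-pos n = +-pos-nonneg 0<1 (fromℕ-nonneg n)

  fromℕ-mono-≤ : ∀ {m n} → m ℕ.≤ n → fromℕ m ≤ fromℕ n
  fromℕ-mono-≤ {n = n} z≤n  = fromℕ-nonneg n
  fromℕ-mono-≤ (s≤s m≤n) = +-monoʳ-≤ 1# (fromℕ-mono-≤ m≤n)

  fromℕ-cancel-≤ : ∀ {m n} → fromℕ m ≤ fromℕ n → m ℕ.≤ n
  fromℕ-cancel-≤ {zero}  _  = z≤n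
  fromℕ-cancel-≤ {suc m} {zero}  m≤n  = contradiction (fromℕ-pos m) (≤⇒≯ m≤n)
  fromℕ-cancel-≤ {suc m} {suc n} 1+m≤1+n = s≤s (fromℕ-cancel-≤ (≤-cert
    (solve 2 (λ m n → n := m :+ (:1 :+ n :- (:1 :+ m))) refl (fromℕ m) (fromℕ n))
    (≤⇒0≤- 1+m≤1+n)))

  fromℕ-+ : ∀ m n → fromℕ (m ℕ.+ n) ≈ fromℕ m + fromℕ n
  fromℕ-+ = ×-homo-+ 1#

  fromℕ-* : ∀ m n → fromℕ (m ℕ.* n) ≈ fromℕ m * fromℕ n
  fromℕ-* = ×1-homo-*

  -- Otherwise the naturals have a supremum s; some natural exceeds s - 1, and its successor exceeds
  -- s.
  archimedean : ∀ x → ∃[ n ] x < fromℕ n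
  archimedean x with em {∃[ n ] x < fromℕ n}
  ... | yes found = found
  ... | no  none  = ⊥-elim (≤⇒≯ (proj₁ isSup (suc (proj₁ m) , refl)) s<1+m)
    where
    S : Carrier → Set
    S y = ∃[ n ] fromℕ n ≈ y

    isSup : IsSup S (sup S)
    isSup = sup-isSup S (0# , 0 , refl) (x , λ { (n , n≈y) → ≮⇒≥ λ x<y → none (n , <.<-respʳ-≈ (sym n≈y) x<y) })

    s-1<s : sup S - 1# < sup S
    s-1<s = <-cert (solve 1 (λ s → s := s :- :1 :+ :1) refl (sup S)) 0<1

    m : ∃[ m ] sup S - 1# < fromℕ m
    m with proj₂ isSup s-1<s
    ... | _ , (n , n≈y) , s-1<y = n , <.<-respʳ-≈ (sym n≈y) s-1<y

    s<1+m : sup S < fromℕ (suc (proj₁ m))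
    s<1+m = <-cert (solve 2 (λ s m → :1 :+ m := s :+ (m :- (s :- :1))) refl (sup S) (fromℕ (proj₁ m)))
      (<⇒0<- (proj₂ m))

  archimedean-< : ∀ x {c} → 0# < c → ∃[ n₀ ] (∀ {n} → n₀ ℕ.≤ n → x < c * fromℕ n)
  archimedean-< x {c} 0<c =
    let n₀ , x/c<n₀ = archimedean (c ⁻¹ * x)
    in n₀ , λ {n} n₀≤n → begin-strict
      x  ≈⟨ *-identityˡ x ⟨
      1# * x  ≈⟨ *-congʳ (*-⁻¹ 0<c) ⟨
      c * c ⁻¹ * x  ≈⟨ *-assoc _ _ _ ⟩
      c * (c ⁻¹ * x)  <⟨ *-monoˡ-< 0<c (<-≤-trans x/c<n₀ (fromℕ-mono-≤ n₀≤n)) ⟩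
      c * fromℕ n  ∎
    where open ≤-Reasoning

  half : ∀ {x} → 0# < x → ∃[ h ] 0# < h × h + h ≈ x
  half {x} 0<x = fromℕ 2 ⁻¹ * x , *-pos (⁻¹-pos (fromℕ-pos 1)) 0<x ,
    trans (solve 2 (λ i x → i :* x :+ i :* x := :2 :* i :* x) refl (fromℕ 2 ⁻¹) x)
      (trans (*-congʳ (*-⁻¹ (fromℕ-pos 1))) (*-identityˡ x))

  min-pos : ∀ {x y} → 0# < x → 0# < y → ∃[ z ] 0# < z × z ≤ x × z ≤ y
  min-pos {x} {y} 0<x 0<y with ≤-total x y
  ... | inj₁ x≤y = x , 0<x , ≤-refl , x≤y
  ... | inj₂ y≤x = y , 0<y , y≤x , ≤-refl

  -- The choice h = g/(c + 1 + g) satisfies both bounds at once and never divides by c, which may be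
  -- 0.
  small : ∀ {c g} → 0# ≤ c → 0# < g → ∃[ h ] 0# < h × h ≤ 1# × c * h < g
  small {c} {g} 0≤c 0<g = g * d ⁻¹ , 0<h , ≤-trans h≤ (≤-reflexive (*-⁻¹ 0<d)) ,
    <-≤-trans (<-cert (solve 3 (λ c g i → (c :+ :1 :+ g) :* (g :* i) := c :* (g :* i) :+ ((:1 :+ g) :* (g :* i)))
      refl c g (d ⁻¹)) (*-pos (+-pos-nonneg 0<1 (<⇒≤ 0<g)) 0<h))
      (≤-reflexive (trans (solve 3 (λ d g i → d :* (g :* i) := d :* i :* g) refl d g (d ⁻¹))
        (trans (*-congʳ (*-⁻¹ 0<d)) (*-identityˡ g))))
    where
    d = c + 1# + g
    0<d : 0# < d
    0<d = +-pos-nonneg (≤-<-trans 0≤c (<-cert refl 0<1)) (<⇒≤ 0<g)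
    0<h : 0# < g * d ⁻¹
    0<h = *-pos 0<g (⁻¹-pos 0<d)
    h≤ : g * d ⁻¹ ≤ d * d ⁻¹
    h≤ = *-monoʳ-≤ (<⇒≤ (⁻¹-pos 0<d)) (≤-cert (+-comm _ _) (+-nonneg 0≤c 0≤1))

  small₂ : ∀ {c₁ g₁ c₂ g₂} → 0# ≤ c₁ → 0# < g₁ → 0# ≤ c₂ → 0# < g₂ → ∃[ h ] 0# < h × c₁ * h < g₁ × c₂ * h < g₂
  small₂ 0≤c₁ 0<g₁ 0≤c₂ 0<g₂ =
    let h₁ , 0<h₁ , _ , c₁h₁<g₁ = small 0≤c₁ 0<g₁
        h₂ , 0<h₂ , _ , c₂h₂<g₂ = small 0≤c₂ 0<g₂
        h , 0<h , h≤h₁ , h≤h₂ = min-pos 0<h₁ 0<h₂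
    in h , 0<h , ≤-<-trans (*-monoˡ-≤ 0≤c₁ h≤h₁) c₁h₁<g₁ , ≤-<-trans (*-monoˡ-≤ 0≤c₂ h≤h₂) c₂h₂<g₂

  -- Well-ordering for an arbitrary predicate, hence by excluded middle. It supplies the numerator
  -- of the fraction near p, the best permutation, and the edit distance.
  least : ∀ (P : ℕ → Set) {n} → P n → ∃[ m ] P m × (∀ {k} → P k → m ℕ.≤ k)
  least P {n} = go P n
    where
    go : ∀ (P : ℕ → Set) n → P n → ∃[ m ] P m × (∀ {k} → P k → m ℕ.≤ k)
    go P zero  p0 = 0 , p0 , λ _ → z≤n
    go P (suc n) p with em {P 0}
    ... | yes p0 = 0 , p0 , λ _ → z≤n
    ... | no ¬p0 with go (P ∘ suc) n p
    ...  | m , pm , m≤ = suc m , pm , λ { {zero} p0 → contradiction p0 ¬p0 ; {suc k} pk → s≤s (m≤ pk) }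

-- Natural powers and the existence of roots.

module Powers (ℝ : CompleteOrderedField) where

  open CompleteOrderedField ℝ hiding (zero)
  open OrderedField ℝ
  open Algebra.Properties.CommutativeSemiring.Exp commutativeSemiring public
    using (^-congˡ; ^-congʳ; ^-homo-*; ^-assocʳ; ^-distrib-*)

  ^-nonneg : ∀ {x} n → 0# ≤ x → 0# ≤ x ^ n
  ^-nonneg zero  0≤x = 0≤1
  ^-nonneg (suc n) 0≤x = *-nonneg 0≤x (^-nonneg n 0≤x)

  ^-pos : ∀ {x} n → 0# < x → 0# < x ^ n
  ^-pos zero  0<x = 0<1
  ^-pos (suc n) 0<x = *-pos 0<x (^-pos n 0<x)

  ^-mono-≤ : ∀ {x y} n → 0# ≤ x → x ≤ y → x ^ n ≤ y ^ n
  ^-mono-≤ zero  0≤x x≤y = ≤-refl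
  ^-mono-≤ (suc n) 0≤x x≤y = *-mono-≤ 0≤x x≤y (^-nonneg n 0≤x) (^-mono-≤ n 0≤x x≤y)

  ^-mono-< : ∀ {x y} n → 0# ≤ x → x < y → x ^ suc n < y ^ suc n
  ^-mono-< {x} {y} n 0≤x x<y = begin-strict
    x * x ^ n  ≤⟨ *-monoˡ-≤ 0≤x (^-mono-≤ n 0≤x (<⇒≤ x<y)) ⟩
    x * y ^ n  ≈⟨ *-comm _ _ ⟩
    y ^ n * x  <⟨ *-monoˡ-< (^-pos n (≤-<-trans 0≤x x<y)) x<y ⟩
    y ^ n * y  ≈⟨ *-comm _ _ ⟩
    y * y ^ n  ∎
    where open ≤-Reasoning

  ^-cancel-≤ : ∀ {x y} n → 0# ≤ y → x ^ suc n ≤ y ^ suc n → x ≤ y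
  ^-cancel-≤ n 0≤y xⁿ≤yⁿ = ≮⇒≥ λ y<x → ≤⇒≯ xⁿ≤yⁿ (^-mono-< n 0≤y y<x)

  1^ : ∀ n → 1# ^ n ≈ 1#
  1^ zero  = refl
  1^ (suc n) = trans (*-identityˡ _) (1^ n)

  1≤^ : ∀ {x} n → 1# ≤ x → 1# ≤ x ^ n
  1≤^ {x} n 1≤x = ≤-trans (≤-reflexive (sym (1^ n))) (^-mono-≤ n 0≤1 1≤x)

  x≤x^ : ∀ {x} n → 1# ≤ x → x ≤ x ^ suc n
  x≤x^ {x} n 1≤x = ≤-trans (≤-reflexive (sym (*-identityʳ x))) (*-monoˡ-≤ (≤-trans 0≤1 1≤x) (1≤^ n 1≤x))

  ^-monoʳ-≤ : ∀ {x m n} → 1# ≤ x → m ℕ.≤ n → x ^ m ≤ x ^ n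
  ^-monoʳ-≤ {n = n} 1≤x z≤n = 1≤^ n 1≤x
  ^-monoʳ-≤ 1≤x (s≤s m≤n)  = *-monoˡ-≤ (≤-trans 0≤1 1≤x) (^-monoʳ-≤ 1≤x m≤n)

  bernoulli : ∀ n {h} → 0# ≤ h → 1# + fromℕ n * h ≤ (1# + h) ^ n
  bernoulli zero {h} 0≤h = ≤-reflexive (solve 1 (λ h → :1 :+ :0 :* h := :1) refl h)
  bernoulli (suc n) {h} 0≤h = begin
    1# + (1# + fromℕ n) * h  ≤⟨ ≤-cert (solve 2 (λ n h →
      (:1 :+ h) :* (:1 :+ n :* h) := :1 :+ (:1 :+ n) :* h :+ n :* (h :* h)) refl (fromℕ n) h)
      (*-nonneg (fromℕ-nonneg n) (square-nonneg h)) ⟩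
    (1# + h) * (1# + fromℕ n * h)  ≤⟨ *-monoˡ-≤ (+-nonneg 0≤1 0≤h) (bernoulli n 0≤h) ⟩
    (1# + h) * (1# + h) ^ n  ∎
    where open ≤-Reasoning

  -- The constant follows the product rule. It serves both the existence of roots and the estimate
  -- of (1 + θ)^k.
  ^-lipschitz : ∀ n {b} → 0# ≤ b → ∃[ c ] 0# ≤ c ×
    (∀ {t h} → 0# ≤ t → t ≤ b → 0# ≤ h → h ≤ 1# → (t + h) ^ n ≤ t ^ n + c * h)
  ^-lipschitz zero 0≤b = 0# , ≤-refl , λ {t} {h} _ _ _ _ →
    ≤-reflexive (solve 1 (λ h → :1 := :1 :+ :0 :* h) refl h)
  ^-lipschitz (suc n) {b} 0≤b with ^-lipschitz n 0≤b
  ... | c , 0≤c , bound = b ^ n + c * (b + 1#) , +-nonneg (^-nonneg n 0≤b) (*-nonneg 0≤c (+-nonneg 0≤b 0≤1)) ,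
    λ {t} {h} 0≤t t≤b 0≤h h≤1 → begin
      (t + h) * (t + h) ^ n
        ≤⟨ *-monoˡ-≤ (+-nonneg 0≤t 0≤h) (bound 0≤t t≤b 0≤h h≤1) ⟩
      (t + h) * (t ^ n + c * h)
        ≤⟨ ≤-cert (solve 6 (λ t h tn c b bn →
             t :* tn :+ (bn :+ c :* (b :+ :1)) :* h :=
             (t :+ h) :* (tn :+ c :* h) :+ (h :* (bn :- tn) :+ (c :* h :* (b :- t) :+ c :* h :* (:1 :- h))))
             refl t h (t ^ n) c b (b ^ n))
           (+-nonneg (*-nonneg 0≤h (≤⇒0≤- (^-mono-≤ n 0≤t t≤b)))
             (+-nonneg (*-nonneg (*-nonneg 0≤c 0≤h) (≤⇒0≤- t≤b)) (*-nonneg (*-nonneg 0≤c 0≤h) (≤⇒0≤- h≤1)))) ⟩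
      t * t ^ n + (b ^ n + c * (b + 1#)) * h ∎
    where open ≤-Reasoning

  -- The supremum s of all t with t^(n+1) ≤ x works. If s^(n+1) < x, then some s + h still belongs
  -- to the set; if s^(n+1) > x, then for small h no member exceeds s - h. `^-lipschitz` tells how
  -- small h must be.
  root : ∀ n {x} → 0# ≤ x → ∃[ y ] 0# ≤ y × y ^ suc n ≈ x
  root n {x} 0≤x = s , 0≤s , sⁿ≈x
    where
    S : Carrier → Set
    S t = 0# ≤ t × t ^ suc n ≤ x

    0∈S : S 0#
    0∈S = ≤-refl , ≤-trans (≤-reflexive (zeroˡ _)) 0≤x

    bounded : UpperBound S (1# + x)
    bounded {t} (0≤t , tⁿ≤x) = ≮⇒≥ λ 1+x<t → ≤⇒≯ tⁿ≤x (begin-strict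
      x  <⟨ <-cert (+-comm 1# x) 0<1 ⟩
      1# + x  <⟨ 1+x<t ⟩
      t  ≤⟨ x≤x^ n (≤-trans (≤-cert refl 0≤x) (<⇒≤ 1+x<t)) ⟩
      t ^ suc n  ∎)
      where open ≤-Reasoning

    s : Carrier
    s = sup S

    isSup : IsSup S s
    isSup = sup-isSup S (0# , 0∈S) (1# + x , bounded)

    0≤s : 0# ≤ s
    0≤s = proj₁ isSup 0∈S

    c : Carrier
    c = proj₁ (^-lipschitz (suc n) 0≤s)

    0≤c : 0# ≤ c
    0≤c = proj₁ (proj₂ (^-lipschitz (suc n) 0≤s))

    lipschitz : ∀ {t h} → 0# ≤ t → t ≤ s → 0# ≤ h → h ≤ 1# → (t + h) ^ suc n ≤ t ^ suc n + c * h
    lipschitz = proj₂ (proj₂ (^-lipschitz (suc n) 0≤s))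

    sⁿ≮x : ¬ s ^ suc n < x
    sⁿ≮x sⁿ<x = let h , 0<h , h≤1 , ch<g = small 0≤c (<⇒0<- sⁿ<x) in
      ≤⇒≯ (proj₁ isSup (+-nonneg 0≤s (<⇒≤ 0<h) , (begin
      (s + h) ^ suc n  ≤⟨ lipschitz 0≤s ≤-refl (<⇒≤ 0<h) h≤1 ⟩
      s ^ suc n + c * h  ≤⟨ +-monoʳ-≤ _ (<⇒≤ ch<g) ⟩
      s ^ suc n + (x - s ^ suc n) ≈⟨ solve 2 (λ a x → a :+ (x :- a) := x) refl (s ^ suc n) x ⟩
      x  ∎))) (<-cert refl 0<h)
      where open ≤-Reasoning

    x≮sⁿ : ¬ x < s ^ suc n
    x≮sⁿ x<sⁿ =
      let h , 0<h , h≤1 , ch<g = small 0≤c (<⇒0<- x<sⁿ)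
          t , (0≤t , tⁿ≤x) , s-h<t = proj₂ isSup (<-cert (solve 2 (λ s h → s := s :- h :+ h) refl s h) 0<h)
          s≤t+h = ≤-cert (solve 3 (λ s h t → t :+ h := s :+ (t :- (s :- h))) refl s h t) (≤⇒0≤- (<⇒≤ s-h<t))
      in <.irrefl refl (begin-strict
      s ^ suc n  ≤⟨ ^-mono-≤ (suc n) 0≤s s≤t+h ⟩
      (t + h) ^ suc n  ≤⟨ lipschitz 0≤t (proj₁ isSup (0≤t , tⁿ≤x)) (<⇒≤ 0<h) h≤1 ⟩
      t ^ suc n + c * h  <⟨ +-mono-≤-< tⁿ≤x ch<g ⟩
      x + (s ^ suc n - x)  ≈⟨ solve 2 (λ a x → x :+ (a :- x) := a) refl (s ^ suc n) x ⟩
      s ^ suc n  ∎)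
      where open ≤-Reasoning

    sⁿ≈x : s ^ suc n ≈ x
    sⁿ≈x with compare (s ^ suc n) x
    ... | tri< sⁿ<x _ _ = contradiction sⁿ<x sⁿ≮x
    ... | tri≈ _ sⁿ≈x _ = sⁿ≈x
    ... | tri> _ _ x<sⁿ = contradiction x<sⁿ x≮sⁿ

-- Finite sums over vertices and over tuples of vertices.

module Sums (ℝ : CompleteOrderedField) where

  open CompleteOrderedField ℝ hiding (zero)
  open OrderedField ℝ
  private module Sum = Algebra.Properties.Semiring.Sum semiring

  -- Opaque, so that unification can read the summand off a sum.
  opaque
    ∑ : ∀ {n} → (Fin n → Carrier) → Carrier
    ∑ = sum

    ∑≡sum : ∀ {n} (f : Fin n → Carrier) → ∑ f ≡ sum f
    ∑≡sum f = ≡.refl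

    ∑-zero : ∀ (f : Fin 0 → Carrier) → ∑ f ≡ 0#
    ∑-zero f = ≡.refl

    ∑-suc : ∀ {n} (f : Fin (suc n) → Carrier) → ∑ f ≡ f zero + ∑ (f ∘ suc)
    ∑-suc f = ≡.refl

    ∑-cong : ∀ {n} {f g : Fin n → Carrier} → (∀ i → f i ≈ g i) → ∑ f ≈ ∑ g
    ∑-cong = Sum.sum-cong-≋

    ∑-↑ : ∀ m {n} (f : Fin (m ℕ.+ n) → Carrier) → ∑ f ≈ ∑ (λ i → f (i ↑ˡ n)) + ∑ (λ j → f (m ↑ʳ j))
    ∑-↑ zero  f = sym (+-identityˡ _)
    ∑-↑ (suc m) f = trans (+-congˡ (∑-↑ m (f ∘ suc))) (sym (+-assoc _ _ _))

    ∑-distrib-+ : ∀ {n} (f g : Fin n → Carrier) → ∑ (λ i → f i + g i) ≈ ∑ f + ∑ g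
    ∑-distrib-+ = Sum.∑-distrib-+

    ∑-comm : ∀ {m n} (f : Fin m → Fin n → Carrier) →
             ∑ (λ i → ∑ λ j → f i j) ≈ ∑ (λ j → ∑ λ i → f i j)
    ∑-comm = Sum.∑-comm

    ∑-permute : ∀ {n} (f : Fin n → Carrier) (π : Permutation′ n) → ∑ f ≈ ∑ λ i → f (π ⟨$⟩ʳ i)
    ∑-permute = Sum.∑-permute

    ∑-mono-≤ : ∀ {n} {f g : Fin n → Carrier} → (∀ i → f i ≤ g i) → ∑ f ≤ ∑ g
    ∑-mono-≤ {zero}  f≤g = ≤-refl
    ∑-mono-≤ {suc n} f≤g = +-mono-≤ (f≤g zero) (∑-mono-≤ (f≤g ∘ suc))

    ∑-nonneg : ∀ {n} {f : Fin n → Carrier} → (∀ i → 0# ≤ f i) → 0# ≤ ∑ f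
    ∑-nonneg {zero}  0≤f = ≤-refl
    ∑-nonneg {suc n} 0≤f = +-nonneg (0≤f zero) (∑-nonneg (0≤f ∘ suc))

    ∑-const : ∀ n x → ∑ {n} (λ _ → x) ≈ fromℕ n * x
    ∑-const zero  x = sym (zeroˡ x)
    ∑-const (suc n) x = trans (+-congˡ (∑-const n x))
      (solve 2 (λ n x → x :+ n :* x := (:1 :+ n) :* x) refl (fromℕ n) x)

    ∑-*ˡ : ∀ {n} x (f : Fin n → Carrier) → ∑ (λ i → x * f i) ≈ x * ∑ f
    ∑-*ˡ x f = sym (Sum.*-distribˡ-sum x f)

    ∑-distrib-- : ∀ {n} (f g : Fin n → Carrier) → ∑ (λ i → f i - g i) ≈ ∑ f - ∑ g
    ∑-distrib-- {zero}  f g = sym (-‿inverseʳ 0#)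
    ∑-distrib-- {suc n} f g = trans (+-congˡ (∑-distrib-- (f ∘ suc) (g ∘ suc)))
      (solve 4 (λ a b c d → (a :- b) :+ (c :- d) := (a :+ c) :- (b :+ d)) refl _ _ _ _)

    term≤∑ : ∀ {n} {f : Fin n → Carrier} → (∀ i → 0# ≤ f i) → ∀ i → f i ≤ ∑ f
    term≤∑ 0≤f zero  = ≤-cert refl (∑-nonneg (0≤f ∘ suc))
    term≤∑ 0≤f (suc i) = ≤-trans (term≤∑ (0≤f ∘ suc) i) (≤-cert (+-comm _ _) (0≤f zero))

  ∑-*ʳ : ∀ {n} x (f : Fin n → Carrier) → ∑ (λ i → f i * x) ≈ ∑ f * x
  ∑-*ʳ x f = trans (∑-cong λ i → *-comm (f i) x) (trans (∑-*ˡ x f) (*-comm _ _))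

  ∑∑-* : ∀ {m n} (f : Fin m → Carrier) (g : Fin n → Carrier) →
         ∑ (λ i → ∑ λ j → f i * g j) ≈ ∑ f * ∑ g
  ∑∑-* f g = trans (∑-cong λ i → ∑-*ˡ (f i) g) (∑-*ʳ (∑ g) f)

  ∑-pigeonhole : ∀ {n} {f g : Fin n → Carrier} → ∑ f < ∑ g → ∃[ i ] f i < g i
  ∑-pigeonhole {f = f} {g} ∑f<∑g with Fin.any? (λ i → f i <? g i)
  ... | yes found = found
  ... | no  none  = contradiction ∑f<∑g (≤⇒≯ (∑-mono-≤ λ i → ≮⇒≥ λ fi<gi → none (i , fi<gi)))

  𝟙 : Bool → Carrier
  𝟙 true  = 1#
  𝟙 false = 0#

  0≤𝟙 : ∀ b → 0# ≤ 𝟙 b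
  0≤𝟙 true  = 0≤1
  0≤𝟙 false = ≤-refl

  𝟙≤1 : ∀ b → 𝟙 b ≤ 1#
  𝟙≤1 true  = ≤-refl
  𝟙≤1 false = 0≤1

  𝟙-∧ : ∀ a b → 𝟙 (a ∧ b) ≈ 𝟙 a * 𝟙 b
  𝟙-∧ true  b = sym (*-identityˡ _)
  𝟙-∧ false b = sym (zeroˡ _)

  δ : ∀ {n} → Fin n → Fin n → Carrier
  δ i j = 𝟙 (does (i Fin.≟ j))

  0≤δ : ∀ {n} (i j : Fin n) → 0# ≤ δ i j
  0≤δ i j = 0≤𝟙 (does (i Fin.≟ j))

  δ≤1 : ∀ {n} (i j : Fin n) → δ i j ≤ 1#
  δ≤1 i j = 𝟙≤1 (does (i Fin.≟ j))

  δ-diagonal : ∀ {n} {i j : Fin n} → i ≡ j → δ i j ≈ 1#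
  δ-diagonal {i = i} {j} i≡j with i Fin.≟ j
  ... | yes _  = refl
  ... | no  i≢j = contradiction i≡j i≢j

  δ-off-diagonal : ∀ {n} {i j : Fin n} → i ≢ j → δ i j ≈ 0#
  δ-off-diagonal {i = i} {j} i≢j with i Fin.≟ j
  ... | yes i≡j = contradiction i≡j i≢j
  ... | no  _  = refl

  opaque
    unfolding ∑

    ∑-δ : ∀ {n} i (f : Fin n → Carrier) → ∑ (λ j → δ i j * f j) ≈ f i
    ∑-δ {suc n} zero f = begin
      1# * f zero + ∑ (λ j → 0# * f (suc j)) ≈⟨ +-cong (*-identityˡ _) (trans (∑-*ˡ 0# (f ∘ suc)) (zeroˡ _)) ⟩
      f zero + 0#  ≈⟨ +-identityʳ _ ⟩
      f zero  ∎
      where open ≈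
    ∑-δ {suc n} (suc i) f = trans (+-cong (zeroˡ _) (∑-δ i (f ∘ suc))) (+-identityˡ _)

  ∑-δ-1 : ∀ {n} (i : Fin n) → ∑ (δ i) ≈ 1#
  ∑-δ-1 i = trans (∑-cong λ j → sym (*-identityʳ (δ i j))) (∑-δ i (λ _ → 1#))

  opaque
    ∑ᵛ : ∀ {n s} → (Vec (Fin n) s → Carrier) → Carrier
    ∑ᵛ {s = zero}  f = f []
    ∑ᵛ {s = suc s} f = ∑ λ v → ∑ᵛ λ L → f (v ∷ L)

    ∑ᵛ-zero : ∀ {n} (f : Vec (Fin n) 0 → Carrier) → ∑ᵛ f ≡ f []
    ∑ᵛ-zero f = ≡.refl

    ∑ᵛ-suc : ∀ {n s} (f : Vec (Fin n) (suc s) → Carrier) → ∑ᵛ f ≡ ∑ λ v → ∑ᵛ λ L → f (v ∷ L)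
    ∑ᵛ-suc f = ≡.refl

    ∑ᵛ-cong : ∀ {n s} {f g : Vec (Fin n) s → Carrier} → (∀ L → f L ≈ g L) → ∑ᵛ f ≈ ∑ᵛ g
    ∑ᵛ-cong {s = zero}  f≈g = f≈g []
    ∑ᵛ-cong {s = suc s} f≈g = ∑-cong λ v → ∑ᵛ-cong λ L → f≈g (v ∷ L)

    ∑ᵛ-mono-≤ : ∀ {n s} {f g : Vec (Fin n) s → Carrier} → (∀ L → f L ≤ g L) → ∑ᵛ f ≤ ∑ᵛ g
    ∑ᵛ-mono-≤ {s = zero}  f≤g = f≤g []
    ∑ᵛ-mono-≤ {s = suc s} f≤g = ∑-mono-≤ λ v → ∑ᵛ-mono-≤ λ L → f≤g (v ∷ L)

    ∑ᵛ-nonneg : ∀ {n s} {f : Vec (Fin n) s → Carrier} → (∀ L → 0# ≤ f L) → 0# ≤ ∑ᵛ f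
    ∑ᵛ-nonneg {s = zero}  0≤f = 0≤f []
    ∑ᵛ-nonneg {s = suc s} 0≤f = ∑-nonneg λ v → ∑ᵛ-nonneg λ L → 0≤f (v ∷ L)

    ∑ᵛ-*ˡ : ∀ {n s} x (f : Vec (Fin n) s → Carrier) → ∑ᵛ (λ L → x * f L) ≈ x * ∑ᵛ f
    ∑ᵛ-*ˡ {s = zero}  x f = refl
    ∑ᵛ-*ˡ {s = suc s} x f = trans (∑-cong λ v → ∑ᵛ-*ˡ x (λ L → f (v ∷ L))) (∑-*ˡ x _)

    ∑ᵛ-distrib-+ : ∀ {n s} (f g : Vec (Fin n) s → Carrier) → ∑ᵛ (λ L → f L + g L) ≈ ∑ᵛ f + ∑ᵛ g
    ∑ᵛ-distrib-+ {s = zero}  f g = refl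
    ∑ᵛ-distrib-+ {s = suc s} f g = trans
      (∑-cong λ v → ∑ᵛ-distrib-+ (λ L → f (v ∷ L)) (λ L → g (v ∷ L))) (∑-distrib-+ _ _)

    ∑ᵛ-const : ∀ n s x → ∑ᵛ {n} {s} (λ _ → x) ≈ fromℕ n ^ s * x
    ∑ᵛ-const n zero  x = sym (*-identityˡ x)
    ∑ᵛ-const n (suc s) x = trans (∑-cong {n} λ _ → ∑ᵛ-const n s x)
      (trans (∑-const n _) (sym (*-assoc _ _ _)))

    ∑ᵛ-pigeonhole : ∀ {n s} {f g : Vec (Fin n) s → Carrier} → ∑ᵛ f < ∑ᵛ g → ∃[ L ] f L < g L
    ∑ᵛ-pigeonhole {s = zero}  f<g = [] , f<g
    ∑ᵛ-pigeonhole {s = suc s} f<g =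
      let v , fv<gv = ∑-pigeonhole f<g
          L , p  = ∑ᵛ-pigeonhole fv<gv
      in v ∷ L , p

    ∑-∑ᵛ-comm : ∀ {m n s} (f : Fin m → Vec (Fin n) s → Carrier) →
                ∑ (λ i → ∑ᵛ (f i)) ≈ ∑ᵛ (λ L → ∑ λ i → f i L)
    ∑-∑ᵛ-comm {s = zero}  f = refl
    ∑-∑ᵛ-comm {s = suc s} f = trans (∑-comm λ i v → ∑ᵛ λ L → f i (v ∷ L))
      (∑-cong λ v → ∑-∑ᵛ-comm (λ i L → f i (v ∷ L)))

    -- Fubini for the coordinate j. It lets any entry of a clique, not just the first, play the role
    -- of the added vertex.
    ∑ᵛ-insertAt : ∀ {n s} (j : Fin (suc s)) (f : Vec (Fin n) (suc s) → Carrier) →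
                  ∑ᵛ f ≈ ∑ λ v → ∑ᵛ λ L → f (insertAt L j v)
    ∑ᵛ-insertAt  zero  f = refl
    ∑ᵛ-insertAt {s = suc s} (suc j) f = trans
      (∑-cong λ u → ∑ᵛ-insertAt j (λ L → f (u ∷ L)))
      (∑-comm λ u v → ∑ᵛ λ L → f (u ∷ insertAt L j v))

-- Weighted clique counts and the Moon-Moser inequalities.

module Cliques (ℝ : CompleteOrderedField) where

  open CompleteOrderedField ℝ hiding (zero)
  open OrderedField ℝ
  open Powers ℝ
  open Algebra.Properties.Ring ring using (+-cancelʳ)
  open Sums ℝ

  module _ {n : ℕ} (adj : Fin n → Fin n → Bool) where

    allAdj : ∀ {s} → Fin n → Vec (Fin n) s → Bool
    allAdj v []  = true
    allAdj v (u ∷ L) = adj v u ∧ allAdj v L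

    clique : ∀ {s} → Vec (Fin n) s → Bool
    clique []  = true
    clique (v ∷ L) = allAdj v L ∧ clique L

  module OfGraph {n : ℕ} (adj : Fin n → Fin n → Bool) (adj-sym : ∀ u v → adj u v ≡ adj v u) where

    allAdj-insertAt : ∀ {s} u (L : Vec (Fin n) s) j v → allAdj adj u (insertAt L j v) ≡ adj u v ∧ allAdj adj u L
    allAdj-insertAt u L  zero  v = ≡.refl
    allAdj-insertAt u (x ∷ L) (suc j) v =
      ≡.trans (≡.cong (adj u x ∧_) (allAdj-insertAt u L j v)) (x∙yz≈y∙xz (adj u x) (adj u v) (allAdj adj u L))

    clique-insertAt : ∀ {s} (L : Vec (Fin n) s) j v → clique adj (insertAt L j v) ≡ allAdj adj v L ∧ clique adj L
    clique-insertAt L  zero  v = ≡.refl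
    clique-insertAt (u ∷ L) (suc j) v = begin
      allAdj adj u (insertAt L j v) ∧ clique adj (insertAt L j v)
        ≡⟨ ≡.cong₂ _∧_ (allAdj-insertAt u L j v) (clique-insertAt L j v) ⟩
      (adj u v ∧ allAdj adj u L) ∧ (allAdj adj v L ∧ clique adj L)
        ≡⟨ ∧-interchange (adj u v) (allAdj adj u L) (allAdj adj v L) (clique adj L) ⟩
      (adj u v ∧ allAdj adj v L) ∧ (allAdj adj u L ∧ clique adj L)
        ≡⟨ ≡.cong (λ b → (b ∧ allAdj adj v L) ∧ (allAdj adj u L ∧ clique adj L)) (adj-sym u v) ⟩
      (adj v u ∧ allAdj adj v L) ∧ (allAdj adj u L ∧ clique adj L)
        ∎
      where open ≡.≡-Reasoning

    P : ∀ {s} → Fin n → Vec (Fin n) s → Carrier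
    P v L = 𝟙 (allAdj adj v L)

    Q : ∀ {s} → Fin n → Vec (Fin n) (suc s) → Carrier
    Q x K = ∑ λ j → P x (removeAt K j)

    -- If x is adjacent to every entry of K, both sides are s + 1; if it misses exactly one entry,
    -- both are 1; if it misses more, the left side is 0.
    Q≤1+sP : ∀ {s} x (K : Vec (Fin n) (suc s)) → Q x K ≤ 1# + fromℕ s * P x K
    Q≤1+sP {zero} x (v ∷ []) = ≤-reflexive (begin
      Q x (v ∷ [])  ≡⟨ ∑-suc _ ⟩
      1# + ∑ _  ≡⟨ ≡.cong (λ x → 1# + x) (∑-zero _) ⟩
      1# + 0#  ≈⟨ +-congˡ (zeroˡ _) ⟨
      1# + 0# * P x (v ∷ [])  ∎)
      where open ≈
    Q≤1+sP {suc s} x (v ∷ K@(_ ∷ _)) = ≤-trans (≤-reflexive Q-∷) (bound (adj x v))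
      where
      Q-∷ : Q x (v ∷ K) ≈ P x K + 𝟙 (adj x v) * Q x K
      Q-∷ = begin
        Q x (v ∷ K)  ≡⟨ ∑-suc _ ⟩
        P x K + ∑ (λ j → P x (v ∷ removeAt K j))  ≈⟨ +-congˡ (∑-cong λ j → 𝟙-∧ (adj x v) _) ⟩
        P x K + ∑ (λ j → 𝟙 (adj x v) * P x (removeAt K j))  ≈⟨ +-congˡ (∑-*ˡ _ _) ⟩
        P x K + 𝟙 (adj x v) * Q x K  ∎
        where open ≈
      bound : ∀ b → P x K + 𝟙 b * Q x K ≤ 1# + fromℕ (suc s) * 𝟙 (b ∧ allAdj adj x K)
      bound true  = begin
        P x K + 1# * Q x K  ≤⟨ +-monoʳ-≤ _ (*-monoˡ-≤ 0≤1 (Q≤1+sP x K)) ⟩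
        P x K + 1# * (1# + fromℕ s * P x K)
          ≈⟨ solve 2 (λ p s → p :+ :1 :* (:1 :+ s :* p) := :1 :+ (:1 :+ s) :* p) refl (P x K) (fromℕ s) ⟩
        1# + fromℕ (suc s) * P x K  ∎
        where open ≤-Reasoning
      bound false = begin
        P x K + 0# * Q x K  ≈⟨ solve 2 (λ p q → p :+ :0 :* q := p) refl (P x K) (Q x K) ⟩
        P x K  ≤⟨ 𝟙≤1 (allAdj adj x K) ⟩
        1#  ≈⟨ solve 1 (λ s → :1 := :1 :+ s :* :0) refl (fromℕ (suc s)) ⟩
        1# + fromℕ (suc s) * 0#  ∎
        where open ≤-Reasoning

    module Weighted (w : Fin n → Carrier) (0≤w : ∀ v → 0# ≤ w v) where

      W : Carrier
      W = ∑ w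

      0≤W : 0# ≤ W
      0≤W = ∑-nonneg 0≤w

      weight : ∀ {s} → Vec (Fin n) s → Carrier
      weight []  = 1#
      weight (v ∷ L) = w v * weight L

      0≤weight : ∀ {s} (L : Vec (Fin n) s) → 0# ≤ weight L
      0≤weight []  = 0≤1
      0≤weight (v ∷ L) = *-nonneg (0≤w v) (0≤weight L)

      weight-insertAt : ∀ {s} (L : Vec (Fin n) s) j v → weight (insertAt L j v) ≈ w v * weight L
      weight-insertAt L  zero  v = refl
      weight-insertAt (u ∷ L) (suc j) v = trans (*-congˡ (weight-insertAt L j v))
        (solve 3 (λ u v L → u :* (v :* L) := v :* (u :* L)) refl (w u) (w v) (weight L))

      -- Restricts `weight` to cliques, so that `N s` is the weighted number of ordered s-cliques
      -- and `extensions L` is the weight of the common neighbourhood of L.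
      κ : ∀ {s} → Vec (Fin n) s → Carrier
      κ L = weight L * 𝟙 (clique adj L)

      0≤κ : ∀ {s} (L : Vec (Fin n) s) → 0# ≤ κ L
      0≤κ L = *-nonneg (0≤weight L) (0≤𝟙 (clique adj L))

      κ-insertAt : ∀ {s} (L : Vec (Fin n) s) j v → κ (insertAt L j v) ≈ κ L * (w v * P v L)
      κ-insertAt L j v = begin
        weight (insertAt L j v) * 𝟙 (clique adj (insertAt L j v))
          ≈⟨ *-cong (weight-insertAt L j v) (reflexive (≡.cong 𝟙 (clique-insertAt L j v))) ⟩
        w v * weight L * 𝟙 (allAdj adj v L ∧ clique adj L)
          ≈⟨ *-congˡ (𝟙-∧ (allAdj adj v L) (clique adj L)) ⟩
        w v * weight L * (P v L * 𝟙 (clique adj L))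
          ≈⟨ solve 4 (λ a b c d → a :* b :* (c :* d) := b :* d :* (a :* c)) refl (w v) (weight L) (P v L) (𝟙 (clique adj L)) ⟩
        κ L * (w v * P v L)
          ∎
        where open ≈

      N : ℕ → Carrier
      N s = ∑ᵛ {s = s} κ

      N-zero : N 0 ≈ 1#
      N-zero = trans (reflexive (∑ᵛ-zero κ)) (*-identityˡ 1#)

      extensions : ∀ {s} → Vec (Fin n) s → Carrier
      extensions L = ∑ λ v → w v * P v L

      -- Without its j-th entry a clique K is a clique L, and the removed vertex ranges over the
      -- common neighbours of L; hence the factor `extensions L`.
      ∑-κ-insertAt : ∀ {s} (j : Fin (suc s)) (φ : Vec (Fin n) s → Carrier) →
                     ∑ᵛ (λ K → κ K * φ (removeAt K j)) ≈ ∑ᵛ (λ L → κ L * (extensions L * φ L))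
      ∑-κ-insertAt j φ = begin
        ∑ᵛ (λ K → κ K * φ (removeAt K j))
          ≈⟨ ∑ᵛ-insertAt j _ ⟩
        ∑ (λ v → ∑ᵛ λ L → κ (insertAt L j v) * φ (removeAt (insertAt L j v) j))
          ≈⟨ ∑-cong (λ v → ∑ᵛ-cong λ L → *-cong (κ-insertAt L j v) (reflexive (≡.cong φ (Vec.removeAt-insertAt L j v)))) ⟩
        ∑ (λ v → ∑ᵛ λ L → κ L * (w v * P v L) * φ L)
          ≈⟨ ∑-∑ᵛ-comm _ ⟩
        ∑ᵛ (λ L → ∑ λ v → κ L * (w v * P v L) * φ L)
          ≈⟨ ∑ᵛ-cong (λ L → trans (∑-*ʳ (φ L) _) (trans (*-congʳ (∑-*ˡ (κ L) _)) (*-assoc _ _ _))) ⟩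
        ∑ᵛ (λ L → κ L * (extensions L * φ L))
          ∎
        where open ≈

      ∑-κ-removeAt : ∀ {s} (φ : Vec (Fin n) s → Carrier) →
                     ∑ᵛ (λ K → κ K * ∑ λ j → φ (removeAt K j)) ≈ fromℕ (suc s) * ∑ᵛ (λ L → κ L * (extensions L * φ L))
      ∑-κ-removeAt {s} φ = begin
        ∑ᵛ (λ K → κ K * ∑ λ j → φ (removeAt K j))  ≈⟨ ∑ᵛ-cong (λ K → ∑-*ˡ (κ K) _) ⟨
        ∑ᵛ (λ K → ∑ λ j → κ K * φ (removeAt K j))  ≈⟨ ∑-∑ᵛ-comm _ ⟨
        ∑ (λ j → ∑ᵛ λ K → κ K * φ (removeAt K j))  ≈⟨ ∑-cong (λ j → ∑-κ-insertAt j φ) ⟩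
        ∑ {suc s} (λ _ → ∑ᵛ λ L → κ L * (extensions L * φ L)) ≈⟨ ∑-const (suc s) _ ⟩
        fromℕ (suc s) * ∑ᵛ (λ L → κ L * (extensions L * φ L)) ∎
        where open ≈

      N-suc : ∀ s → N (suc s) ≈ ∑ᵛ {s = s} (λ L → κ L * extensions L)
      N-suc s = begin
        N (suc s)  ≈⟨ ∑ᵛ-cong (λ K → *-identityʳ (κ K)) ⟨
        ∑ᵛ {s = suc s} (λ K → κ K * 1#)  ≈⟨ ∑-κ-insertAt zero (λ _ → 1#) ⟩
        ∑ᵛ (λ L → κ L * (extensions L * 1#))  ≈⟨ ∑ᵛ-cong (λ L → *-congˡ (*-identityʳ _)) ⟩
        ∑ᵛ (λ L → κ L * extensions L)  ∎
        where open ≈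

      N² : ℕ → Carrier
      N² s = ∑ᵛ {s = s} λ L → κ L * (extensions L * extensions L)

      -- A vertex x contributes 0 if it is adjacent to all members of K, or to all
      -- but one, and w x otherwise.
      defect : ∀ {s} → Vec (Fin n) (suc s) → Carrier
      defect {s} K = ∑ λ x → w x * (1# + fromℕ s * P x K - Q x K)

      0≤defect : ∀ {s} (K : Vec (Fin n) (suc s)) → 0# ≤ defect K
      0≤defect K = ∑-nonneg λ x → *-nonneg (0≤w x) (≤⇒0≤- (Q≤1+sP x K))

      defect≈ : ∀ {s} (K : Vec (Fin n) (suc s)) →
                defect K + ∑ (λ j → extensions (removeAt K j)) ≈ W + fromℕ s * extensions K
      defect≈ {s} K = begin
        defect K + ∑ (λ j → extensions (removeAt K j))
          ≈⟨ +-congˡ (trans (∑-comm λ j x → w x * P x (removeAt K j)) (∑-cong λ x → ∑-*ˡ (w x) _)) ⟩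
        defect K + ∑ (λ x → w x * Q x K)
          ≈⟨ ∑-distrib-+ _ _ ⟨
        ∑ (λ x → w x * (1# + fromℕ s * P x K - Q x K) + w x * Q x K)
          ≈⟨ ∑-cong (λ x → solve 4 (λ w s p q → w :* (:1 :+ s :* p :- q) :+ w :* q := w :+ s :* (w :* p))
               refl (w x) (fromℕ s) (P x K) (Q x K)) ⟩
        ∑ (λ x → w x + fromℕ s * (w x * P x K))
          ≈⟨ ∑-distrib-+ _ _ ⟩
        W + ∑ (λ x → fromℕ s * (w x * P x K))
          ≈⟨ +-congˡ (∑-*ˡ _ _) ⟩
        W + fromℕ s * extensions K
          ∎
        where open ≈

      -- Obtained by summing `defect≈` over all (s+1)-cliques. With the defect kept as a term this
      -- is an identity: dropping the term gives the usual inequality, and bounding it gives the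
      -- structure behind stability.
      moon-moser : ∀ s → ∑ᵛ {s = suc s} (λ K → κ K * defect K) + fromℕ (suc s) * N² s ≈
                         W * N (suc s) + fromℕ s * N (suc (suc s))
      moon-moser s = begin
        ∑ᵛ (λ K → κ K * defect K) + fromℕ (suc s) * N² s
          ≈⟨ +-congˡ (∑-κ-removeAt extensions) ⟨
        ∑ᵛ (λ K → κ K * defect K) + ∑ᵛ (λ K → κ K * ∑ λ j → extensions (removeAt K j))
          ≈⟨ ∑ᵛ-distrib-+ _ _ ⟨
        ∑ᵛ (λ K → κ K * defect K + κ K * ∑ λ j → extensions (removeAt K j))
          ≈⟨ ∑ᵛ-cong (λ K → trans (sym (distribˡ _ _ _)) (*-congˡ (defect≈ K))) ⟩
        ∑ᵛ (λ K → κ K * (W + fromℕ s * extensions K))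
          ≈⟨ ∑ᵛ-cong (λ K → solve 4 (λ k w s e → k :* (w :+ s :* e) := w :* k :+ s :* (k :* e))
               refl (κ K) W (fromℕ s) (extensions K)) ⟩
        ∑ᵛ (λ K → W * κ K + fromℕ s * (κ K * extensions K))
          ≈⟨ ∑ᵛ-distrib-+ _ _ ⟩
        ∑ᵛ (λ K → W * κ K) + ∑ᵛ (λ K → fromℕ s * (κ K * extensions K))
          ≈⟨ +-cong (∑ᵛ-*ˡ _ _) (trans (∑ᵛ-*ˡ _ _) (*-congˡ (sym (N-suc (suc s))))) ⟩
        W * N (suc s) + fromℕ s * N (suc (suc s))
          ∎
        where open ≈

      -- From ∑ κ(L) (extensions L - t)² ≥ 0.
      N²-lower : ∀ s {t} → 0# ≤ t → t * N s ≤ N (suc s) → t * N (suc s) ≤ N² s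
      N²-lower s {t} 0≤t tN≤N = ≤-cert (begin
        N² s
          ≈⟨ solve 4 (λ n2 n1 n0 t → n2 := t :* n1 :+ ((n2 :- :2 :* t :* n1 :+ t :* t :* n0) :+ t :* (n1 :- t :* n0)))
               refl (N² s) (N (suc s)) (N s) t ⟩
        t * N (suc s) + ((N² s - fromℕ 2 * t * N (suc s) + t * t * N s) + t * (N (suc s) - t * N s))
          ∎)
        (+-nonneg (≤-trans (∑ᵛ-nonneg λ L → *-nonneg (0≤κ L) (square-nonneg (extensions L - t))) (≤-reflexive (+-cancelʳ (fromℕ 2 * t * N (suc s)) _ _ expand)))
          (*-nonneg 0≤t (≤⇒0≤- tN≤N)))
        where
        open ≈
        expand : ∑ᵛ (λ L → κ L * ((extensions L - t) * (extensions L - t))) + fromℕ 2 * t * N (suc s) ≈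
                 (N² s - fromℕ 2 * t * N (suc s) + t * t * N s) + fromℕ 2 * t * N (suc s)
        expand = begin
          ∑ᵛ (λ L → κ L * ((extensions L - t) * (extensions L - t))) + fromℕ 2 * t * N (suc s)
            ≈⟨ +-congˡ (trans (*-congˡ (N-suc s)) (sym (∑ᵛ-*ˡ _ _))) ⟩
          ∑ᵛ (λ L → κ L * ((extensions L - t) * (extensions L - t))) + ∑ᵛ (λ L → fromℕ 2 * t * (κ L * extensions L))
            ≈⟨ ∑ᵛ-distrib-+ _ _ ⟨
          ∑ᵛ (λ L → κ L * ((extensions L - t) * (extensions L - t)) + fromℕ 2 * t * (κ L * extensions L))
            ≈⟨ ∑ᵛ-cong (λ L → solve 3 (λ k e t → k :* ((e :- t) :* (e :- t)) :+ :2 :* t :* (k :* e) := k :* (e :* e) :+ t :* t :* k)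
                 refl (κ L) (extensions L) t) ⟩
          ∑ᵛ (λ L → κ L * (extensions L * extensions L) + t * t * κ L)
            ≈⟨ trans (∑ᵛ-distrib-+ _ _) (+-congˡ (∑ᵛ-*ˡ _ _)) ⟩
          N² s + t * t * N s
            ≈⟨ solve 3 (λ a b c → a :+ b := (a :- c :+ b) :+ c) refl (N² s) (t * t * N s) (fromℕ 2 * t * N (suc s)) ⟩
          (N² s - fromℕ 2 * t * N (suc s) + t * t * N s) + fromℕ 2 * t * N (suc s)
            ∎

      moon-moser-≤ : ∀ s → fromℕ (suc s) * N² s ≤ W * N (suc s) + fromℕ s * N (suc (suc s))
      moon-moser-≤ s = ≤-cert (trans (sym (moon-moser s)) (+-comm _ _))
        (∑ᵛ-nonneg λ K → *-nonneg (0≤κ K) (0≤defect K))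

      N-one : N 1 ≈ W
      N-one = begin
        N 1  ≈⟨ N-suc 0 ⟩
        ∑ᵛ (λ L → κ L * extensions L)  ≡⟨ ∑ᵛ-zero _ ⟩
        1# * 1# * ∑ (λ v → w v * 1#)  ≈⟨ *-cong (*-identityˡ 1#) (∑-cong λ v → *-identityʳ (w v)) ⟩
        1# * W  ≈⟨ *-identityˡ W ⟩
        W  ∎
        where open ≈

      inside : ∀ {s} → Vec (Fin n) s → Carrier
      inside L = ∑ λ x → ∑ λ y → w x * w y * (𝟙 (adj x y) * (P x L * P y L))

      -- The two front entries of an (s+2)-clique form an edge in the common neighbourhood of the
      -- others, each edge being met in both orders.
      N-suc² : ∀ s → N (suc (suc s)) ≈ ∑ᵛ {s = s} (λ L → κ L * inside L)
      N-suc² s = begin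
        N (suc (suc s))
          ≡⟨ ∑ᵛ-suc κ ⟩
        ∑ (λ x → ∑ᵛ λ L → κ (x ∷ L))
          ≈⟨ ∑-cong (λ x → reflexive (∑ᵛ-suc λ L → κ (x ∷ L))) ⟩
        ∑ (λ x → ∑ λ y → ∑ᵛ λ L → κ (x ∷ y ∷ L))
          ≈⟨ ∑-cong (λ x → trans (∑-∑ᵛ-comm λ y L → κ (x ∷ y ∷ L)) (∑ᵛ-cong λ L → ∑-cong λ y → κ-∷∷ x y L)) ⟩
        ∑ (λ x → ∑ᵛ λ L → ∑ λ y → κ L * (w x * w y * (𝟙 (adj x y) * (P x L * P y L))))
          ≈⟨ ∑-∑ᵛ-comm _ ⟩
        ∑ᵛ (λ L → ∑ λ x → ∑ λ y → κ L * (w x * w y * (𝟙 (adj x y) * (P x L * P y L))))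
          ≈⟨ ∑ᵛ-cong (λ L → trans (∑-cong λ x → ∑-*ˡ (κ L) _) (∑-*ˡ (κ L) _)) ⟩
        ∑ᵛ (λ L → κ L * inside L)
          ∎
        where
        open ≈
        κ-∷∷ : ∀ x y L → κ (x ∷ y ∷ L) ≈ κ L * (w x * w y * (𝟙 (adj x y) * (P x L * P y L)))
        κ-∷∷ x y L = trans (*-congˡ (trans (𝟙-∧ (adj x y ∧ allAdj adj x L) _) (*-cong (𝟙-∧ (adj x y) _) (𝟙-∧ (allAdj adj y L) _))))
          (solve 7 (λ x y l a p q c → x :* (y :* l) :* (a :* p :* (q :* c)) := l :* c :* (x :* y :* (a :* (p :* q))))
            refl (w x) (w y) (weight L) (𝟙 (adj x y)) (P x L) (P y L) (𝟙 (clique adj L)))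

      N-two : N 2 ≈ ∑ (λ x → ∑ λ y → w x * w y * 𝟙 (adj x y))
      N-two = begin
        N 2  ≈⟨ N-suc² 0 ⟩
        ∑ᵛ (λ L → κ L * inside L)  ≡⟨ ∑ᵛ-zero _ ⟩
        1# * 1# * inside []  ≈⟨ trans (*-congʳ (*-identityˡ 1#)) (*-identityˡ _) ⟩
        inside []  ≈⟨ ∑-cong (λ x → ∑-cong λ y → *-congˡ (trans (*-congˡ (*-identityˡ 1#)) (*-identityʳ _))) ⟩
        ∑ (λ x → ∑ λ y → w x * w y * 𝟙 (adj x y)) ∎
        where open ≈

      module Chain (α : Carrier) (0≤α : 0# ≤ α) (N₂-lower : (1# - α) * W * W ≤ N 2) where

        -- The lower bound for N (s+1) / (W · N s). At α = 1/r it is 1 - s/r, which vanishes at s =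
        -- r: the Turán threshold.
        ρ : ℕ → Carrier
        ρ s = 1# - fromℕ s * α

        ρ-suc≤ρ : ∀ s → ρ (suc s) ≤ ρ s
        ρ-suc≤ρ s = ≤-cert (solve 2 (λ s α → :1 :- s :* α := :1 :- (:1 :+ s) :* α :+ α) refl (fromℕ s) α) 0≤α

        -- `N²-lower` with t = ρ s · W, inserted in Moon-Moser, leaves the factor (s+1) ρ s - 1 = s
        -- ρ (s+1). Cancelling s requires s ≥ 1, whence the second base case, which is the density
        -- hypothesis.
        chain : ∀ s → 0# ≤ ρ s → ρ s * W * N s ≤ N (suc s)
        chain zero 0≤ρ = ≤-reflexive (begin
          (1# - 0# * α) * W * N 0  ≈⟨ *-congˡ N-zero ⟩
          (1# - 0# * α) * W * 1#  ≈⟨ solve 2 (λ α w → (:1 :- :0 :* α) :* w :* :1 := w) refl α W ⟩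
          W  ≈⟨ N-one ⟨
          N 1  ∎)
          where open ≈
        chain (suc zero) 0≤ρ = begin
          ρ 1 * W * N 1  ≈⟨ *-congˡ N-one ⟩
          ρ 1 * W * W  ≈⟨ solve 2 (λ α w → (:1 :- (:1 :+ :0) :* α) :* w :* w := (:1 :- α) :* w :* w) refl α W ⟩
          (1# - α) * W * W  ≤⟨ N₂-lower ⟩
          N 2  ∎
          where open ≤-Reasoning
        chain (suc s@(suc s′)) 0≤ρ = *-cancelˡ-≤ (fromℕ-pos s′) (begin
          fromℕ s * (ρ (suc s) * W * N (suc s))
            ≈⟨ solve 4 (λ s α w n → s :* ((:1 :- (:1 :+ s) :* α) :* w :* n) := (:1 :+ s) :* ((:1 :- s :* α) :* w :* n) :- w :* n)
                 refl (fromℕ s) α W (N (suc s)) ⟩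
          fromℕ (suc s) * (ρ s * W * N (suc s)) - W * N (suc s)
            ≤⟨ +-monoˡ-≤ _ (*-monoˡ-≤ (fromℕ-nonneg (suc s)) (N²-lower s (*-nonneg 0≤ρₛ 0≤W) (chain s 0≤ρₛ))) ⟩
          fromℕ (suc s) * N² s - W * N (suc s)
            ≤⟨ +-monoˡ-≤ _ (moon-moser-≤ s) ⟩
          W * N (suc s) + fromℕ s * N (suc (suc s)) - W * N (suc s)
            ≈⟨ solve 2 (λ a b → a :+ b :- a := b) refl (W * N (suc s)) (fromℕ s * N (suc (suc s))) ⟩
          fromℕ s * N (suc (suc s))
            ∎)
          where
          open ≤-Reasoning
          0≤ρₛ : 0# ≤ ρ s
          0≤ρₛ = ≤-trans 0≤ρ (ρ-suc≤ρ s)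

        -- As ρ decreases, c lies below every ratio up to s, and the inequalities of `chain`
        -- multiply.
        N-lower : ∀ s {c} → 0# ≤ c → c ≤ ρ s → (c * W) ^ suc s ≤ N (suc s)
        N-lower s {c} 0≤c c≤ρ = begin
          c * W * (c * W) ^ s
            ≤⟨ *-mono-≤ (*-nonneg 0≤c 0≤W) (*-monoʳ-≤ 0≤W c≤ρ) (^-nonneg s (*-nonneg 0≤c 0≤W)) (lower s c≤ρ) ⟩
          ρ s * W * N s  ≤⟨ chain s (≤-trans 0≤c c≤ρ) ⟩
          N (suc s)  ∎
          where
          open ≤-Reasoning
          lower : ∀ s → c ≤ ρ s → (c * W) ^ s ≤ N s
          lower zero  _  = ≤-reflexive (sym N-zero)
          lower (suc s) c≤ρ = N-lower s 0≤c (≤-trans c≤ρ (ρ-suc≤ρ s))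

-- Stability: a dense graph with few (r+1)-cliques has a nearly proper r-colouring.

module Stability (ℝ : CompleteOrderedField) where

  open CompleteOrderedField ℝ hiding (zero)
  open OrderedField ℝ
  open Powers ℝ
  open Sums ℝ
  open Cliques ℝ

  degreeSum : ∀ {n} → (Fin n → Fin n → Bool) → Carrier
  degreeSum adj = ∑ λ u → ∑ λ v → 𝟙 (adj u v)

  cliqueCount : ∀ {n} → (Fin n → Fin n → Bool) → ℕ → Carrier
  cliqueCount adj s = ∑ᵛ {s = s} λ K → 𝟙 (clique adj K)

  monochromatic : ∀ {n r} → (Fin n → Fin n → Bool) → (Fin n → Fin r) → Carrier
  monochromatic adj c = ∑ λ u → ∑ λ v → δ (c u) (c v) * 𝟙 (adj u v)

  *-≤1 : ∀ {x y z} → 0# ≤ x → x ≤ 1# → 0# ≤ y → y ≤ z → x * y ≤ z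
  *-≤1 0≤x x≤1 0≤y y≤z = ≤-trans (*-mono-≤ 0≤x x≤1 0≤y y≤z) (≤-reflexive (*-identityˡ _))

  module _ {n : ℕ} (adj : Fin n → Fin n → Bool) (adj-sym : ∀ u v → adj u v ≡ adj v u) where

    open OfGraph adj adj-sym
    open Weighted (λ _ → 1#) (λ _ → 0≤1)

    W≈n : W ≈ fromℕ n
    W≈n = trans (∑-const n 1#) (*-identityʳ _)

    weight≈1 : ∀ {s} (K : Vec (Fin n) s) → weight K ≈ 1#
    weight≈1 []  = refl
    weight≈1 (v ∷ K) = trans (*-identityˡ _) (weight≈1 K)

    N≈cliqueCount : ∀ s → N s ≈ cliqueCount adj s
    N≈cliqueCount s = ∑ᵛ-cong λ K → trans (*-congʳ (weight≈1 K)) (*-identityˡ _)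

    N-two≈degreeSum : N 2 ≈ degreeSum adj
    N-two≈degreeSum = trans N-two (∑-cong λ x → ∑-cong λ y → trans (*-congʳ (*-identityˡ 1#)) (*-identityˡ _))

    module Partition {s : ℕ} (K : Vec (Fin n) (suc s)) where

      colour? : ∀ x → Dec (∃[ j ] allAdj adj x (removeAt K j) ≡ true)
      colour? x = Fin.any? λ j → allAdj adj x (removeAt K j) Bool.≟ true

      -- Colour j goes to a vertex adjacent to all entries of K except possibly the j-th. The
      -- default `zero` is given to vertices missing at least two entries, and `bad` charges for
      -- those.
      colour : Fin n → Fin (suc s)
      colour x with colour? x
      ... | yes (j , _) = j
      ... | no  _  = zero

      bad : Fin n → Carrier
      bad x = 1# * (1# + fromℕ s * P x K - Q x K)

      0≤bad : ∀ x → 0# ≤ bad x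
      0≤bad x = *-nonneg 0≤1 (≤⇒0≤- (Q≤1+sP x K))

      colour-spec : ∀ x → 1# ≤ bad x ⊎ P x (removeAt K (colour x)) ≈ 1#
      colour-spec x with colour? x
      ... | yes (j , adjacent) = inj₂ (reflexive (≡.cong 𝟙 adjacent))
      ... | no  none  = inj₁ (≤-cert
        (trans (*-congˡ (+-congˡ (-‿cong Q≈0))) (solve 1 (λ sp → :1 :* (:1 :+ sp :- :0) := :1 :+ sp) refl (fromℕ s * P x K)))
        (*-nonneg (fromℕ-nonneg s) (0≤𝟙 (allAdj adj x K))))
        where
        P≈0 : ∀ j → P x (removeAt K j) ≈ 0#
        P≈0 j with allAdj adj x (removeAt K j) in eq
        ... | true  = contradiction (j , eq) none
        ... | false = refl
        Q≈0 : Q x K ≈ 0#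
        Q≈0 = trans (∑-cong P≈0) (trans (∑-const (suc s) 0#) (zeroʳ _))

      inside-term : Fin n → Fin n → Fin (suc s) → Carrier
      inside-term x y j = 1# * 1# * (𝟙 (adj x y) * (P x (removeAt K j) * P y (removeAt K j)))

      0≤inside-term : ∀ x y j → 0# ≤ inside-term x y j
      0≤inside-term x y j = *-nonneg (*-nonneg 0≤1 0≤1)
        (*-nonneg (0≤𝟙 (adj x y)) (*-nonneg (0≤𝟙 (allAdj adj x (removeAt K j))) (0≤𝟙 (allAdj adj y (removeAt K j)))))

      -- A monochromatic edge has a bad end, or both its ends are joined to all entries of K except
      -- that of their common colour, so that it lies inside that common neighbourhood.
      monochromatic-≤ : ∀ x y → δ (colour x) (colour y) * 𝟙 (adj x y) ≤ bad x + bad y + ∑ (inside-term x y)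
      monochromatic-≤ x y with colour-spec x | colour-spec y
      ... | inj₁ 1≤bx | _ = ≤-trans (*-≤1 (0≤δ (colour x) (colour y)) (δ≤1 (colour x) (colour y)) (0≤𝟙 (adj x y)) (≤-trans (𝟙≤1 (adj x y)) 1≤bx))
        (≤-trans (≤-cert refl (0≤bad y)) (≤-cert refl (∑-nonneg (0≤inside-term x y))))
      ... | inj₂ _ | inj₁ 1≤by = ≤-trans (*-≤1 (0≤δ (colour x) (colour y)) (δ≤1 (colour x) (colour y)) (0≤𝟙 (adj x y)) (≤-trans (𝟙≤1 (adj x y)) 1≤by))
        (≤-trans (≤-cert (+-comm _ _) (0≤bad x)) (≤-cert refl (∑-nonneg (0≤inside-term x y))))
      ... | inj₂ Px≈1 | inj₂ Py≈1 with colour x Fin.≟ colour y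
      ...  | no _  = ≤-trans (≤-reflexive (zeroˡ _))
        (+-nonneg (+-nonneg (0≤bad x) (0≤bad y)) (∑-nonneg (0≤inside-term x y)))
      ...  | yes cx≡cy = begin
        1# * 𝟙 (adj x y)  ≈⟨ *-congʳ (*-identityˡ 1#) ⟨
        1# * 1# * 𝟙 (adj x y)
          ≈⟨ *-congˡ (trans (*-congˡ (trans (*-cong Px≈1 Py≈1′) (*-identityˡ 1#))) (*-identityʳ _)) ⟨
        inside-term x y (colour x)  ≤⟨ term≤∑ (0≤inside-term x y) (colour x) ⟩
        ∑ (inside-term x y)  ≤⟨ ≤-cert (+-comm _ _) (+-nonneg (0≤bad x) (0≤bad y)) ⟩
        bad x + bad y + ∑ (inside-term x y)  ∎
        where
        open ≤-Reasoning
        Py≈1′ : P y (removeAt K (colour x)) ≈ 1#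
        Py≈1′ = ≡.subst (λ c → P y (removeAt K c) ≈ 1#) (≡.sym cx≡cy) Py≈1

      monochromatic-total : monochromatic adj colour ≤ fromℕ 2 * (fromℕ n * defect K) + ∑ (λ j → inside (removeAt K j))
      monochromatic-total = begin
        monochromatic adj colour
          ≤⟨ ∑-mono-≤ (λ x → ∑-mono-≤ λ y → monochromatic-≤ x y) ⟩
        ∑ (λ x → ∑ λ y → bad x + bad y + ∑ (inside-term x y))
          ≈⟨ ∑-cong (λ x → trans (∑-distrib-+ _ _) (+-congʳ (trans (∑-distrib-+ _ _) (+-congʳ (∑-const n (bad x)))))) ⟩
        ∑ (λ x → fromℕ n * bad x + ∑ bad + ∑ λ y → ∑ (inside-term x y))
          ≈⟨ trans (∑-distrib-+ _ _) (+-congʳ (trans (∑-distrib-+ _ _) (+-cong (∑-*ˡ _ _) (∑-const n (∑ bad))))) ⟩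
        fromℕ n * defect K + fromℕ n * defect K + ∑ (λ x → ∑ λ y → ∑ (inside-term x y))
          ≈⟨ +-cong (solve 1 (λ d → d :+ d := :2 :* d) refl (fromℕ n * defect K))
               (trans (∑-cong λ x → ∑-comm _) (∑-comm _)) ⟩
        fromℕ 2 * (fromℕ n * defect K) + ∑ (λ j → inside (removeAt K j))
          ∎
        where open ≤-Reasoning

    -- Twice this bounds the monochromatic sum of the colouring by K, and its average over the
    -- cliques K can be computed.
    total : ∀ {s} → Vec (Fin n) (suc s) → Carrier
    total K = fromℕ n * defect K + ∑ (λ j → inside (removeAt K j))

    extensions≤n : ∀ {s} (L : Vec (Fin n) s) → extensions L ≤ fromℕ n
    extensions≤n L = ≤-trans (∑-mono-≤ λ v → ≤-trans (≤-reflexive (*-identityˡ _)) (𝟙≤1 (allAdj adj v L))) (≤-reflexive W≈n)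

    0≤inside : ∀ {s} (L : Vec (Fin n) s) → 0# ≤ inside L
    0≤inside L = ∑-nonneg λ x → ∑-nonneg λ y → *-nonneg (*-nonneg 0≤1 0≤1)
      (*-nonneg (0≤𝟙 (adj x y)) (*-nonneg (0≤𝟙 (allAdj adj x L)) (0≤𝟙 (allAdj adj y L))))

    -- The defects are the loss in Moon-Moser, which `N²-lower` limits to n N₁ (1 - (s+1) ρ) + s N₂.
    -- An edge in the common neighbourhood of an s-clique L makes an (s+2)-clique, and L arises from
    -- at most n cliques K by removal at a given position.
    total-sum : ∀ s {α} (0≤α : 0# ≤ α) → (1# - α) * W * W ≤ N 2 → 0# ≤ 1# - fromℕ s * α →
                ∑ᵛ {s = suc s} (λ K → κ K * total K) ≤
                fromℕ n * fromℕ n * N (suc s) * (1# - fromℕ (suc s) * (1# - fromℕ s * α)) +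
                (fromℕ s + fromℕ (suc s)) * (fromℕ n * N (suc (suc s)))
    total-sum s {α} 0≤α N₂-lower 0≤ρ = begin
      ∑ᵛ (λ K → κ K * total K)
        ≈⟨ ∑ᵛ-cong (λ K → solve 4 (λ k n d j → k :* (n :* d :+ j) := n :* (k :* d) :+ k :* j)
             refl (κ K) ν (defect K) (∑ λ j → inside (removeAt K j))) ⟩
      ∑ᵛ (λ K → ν * (κ K * defect K) + κ K * ∑ λ j → inside (removeAt K j))
        ≈⟨ trans (∑ᵛ-distrib-+ _ _) (+-cong (∑ᵛ-*ˡ _ _) (∑-κ-removeAt inside)) ⟩
      ν * ∑ᵛ (λ K → κ K * defect K) + r * ∑ᵛ (λ L → κ L * (extensions L * inside L))
        ≤⟨ +-mono-≤ (*-monoˡ-≤ (fromℕ-nonneg n) D≤) (*-monoˡ-≤ (fromℕ-nonneg (suc s)) I≤) ⟩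
      ν * (ν * N₁ + fromℕ s * N₂ - r * (ρ * ν * N₁)) + r * (ν * N₂)
        ≈⟨ solve 6 (λ v n1 n2 s r ρ → v :* (v :* n1 :+ s :* n2 :- r :* (ρ :* v :* n1)) :+ r :* (v :* n2) :=
             v :* v :* n1 :* (:1 :- r :* ρ) :+ (s :+ r) :* (v :* n2)) refl ν N₁ N₂ (fromℕ s) r ρ ⟩
      ν * ν * N₁ * (1# - r * ρ) + (fromℕ s + r) * (ν * N₂)
        ∎
      where
      open ≤-Reasoning
      open Chain α 0≤α N₂-lower using (chain)
      ν = fromℕ n
      r = fromℕ (suc s)
      ρ = 1# - fromℕ s * α
      N₁ = N (suc s)
      N₂ = N (suc (suc s))
      N²≥ : ρ * ν * N₁ ≤ N² s
      N²≥ = N²-lower s (*-nonneg 0≤ρ (fromℕ-nonneg n))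
        (≤-trans (≤-reflexive (*-congʳ (*-congˡ (sym W≈n)))) (chain s 0≤ρ))
      D≤ : ∑ᵛ (λ K → κ K * defect K) ≤ ν * N₁ + fromℕ s * N₂ - r * (ρ * ν * N₁)
      D≤ = begin
        ∑ᵛ (λ K → κ K * defect K)
          ≈⟨ solve 2 (λ d n → d := d :+ n :- n) refl _ (r * N² s) ⟩
        ∑ᵛ (λ K → κ K * defect K) + r * N² s - r * N² s
          ≈⟨ +-congʳ (trans (moon-moser s) (+-congʳ (*-congʳ W≈n))) ⟩
        ν * N₁ + fromℕ s * N₂ - r * N² s
          ≤⟨ ≤-cert (solve 4 (λ x r n m → x :- r :* m := x :- r :* n :+ r :* (n :- m)) refl (ν * N₁ + fromℕ s * N₂) r (N² s) (ρ * ν * N₁))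
               (*-nonneg (fromℕ-nonneg (suc s)) (≤⇒0≤- N²≥)) ⟩
        ν * N₁ + fromℕ s * N₂ - r * (ρ * ν * N₁)
          ∎
      I≤ : ∑ᵛ (λ L → κ L * (extensions L * inside L)) ≤ ν * N₂
      I≤ = begin
        ∑ᵛ (λ L → κ L * (extensions L * inside L))
          ≤⟨ ∑ᵛ-mono-≤ (λ L → *-monoˡ-≤ (0≤κ L) (*-monoʳ-≤ (0≤inside L) (extensions≤n L))) ⟩
        ∑ᵛ (λ L → κ L * (ν * inside L))
          ≈⟨ ∑ᵛ-cong (λ L → solve 3 (λ k n i → k :* (n :* i) := n :* (k :* i)) refl (κ L) ν (inside L)) ⟩
        ∑ᵛ (λ L → ν * (κ L * inside L))
          ≈⟨ trans (∑ᵛ-*ˡ _ _) (*-congˡ (sym (N-suc² s))) ⟩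
        ν * N₂
          ∎

  2*⁻¹ : ∀ {x} → 0# < x → x ⁻¹ ≈ fromℕ 2 * (fromℕ 2 * x) ⁻¹
  2*⁻¹ {x} 0<x = begin
    x ⁻¹  ≈⟨ *-identityʳ _ ⟨
    x ⁻¹ * 1#  ≈⟨ *-congˡ (*-⁻¹ (*-pos (fromℕ-pos 1) 0<x)) ⟨
    x ⁻¹ * (fromℕ 2 * x * (fromℕ 2 * x) ⁻¹)
      ≈⟨ solve 3 (λ x i j → i :* (:2 :* x :* j) := :2 :* j :* (x :* i)) refl x (x ⁻¹) ((fromℕ 2 * x) ⁻¹) ⟩
    fromℕ 2 * (fromℕ 2 * x) ⁻¹ * (x * x ⁻¹)  ≈⟨ trans (*-congˡ (*-⁻¹ 0<x)) (*-identityʳ _) ⟩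
    fromℕ 2 * (fromℕ 2 * x) ⁻¹  ∎
    where open ≈

  Stable : ℕ → Carrier → Carrier → Set
  Stable s ε h = ∀ {n} (adj : Fin n → Fin n → Bool) → (∀ u v → adj u v ≡ adj v u) → 0# < fromℕ n →
    (1# - fromℕ (suc s) ⁻¹ - h) * (fromℕ n * fromℕ n) ≤ degreeSum adj →
    cliqueCount adj (suc (suc s)) ≤ h * fromℕ n ^ suc (suc s) →
    ∃[ c ] monochromatic {r = suc s} adj c ≤ ε * (fromℕ n * fromℕ n)

  stability : ∀ s {ε} → 0# < ε → ∃[ h ] 0# < h × Stable s ε h
  stability s {ε} 0<ε =
    let h , 0<h , sh<b , ch<εbʳ = small₂ (fromℕ-nonneg s) 0<b 0≤c (*-pos 0<ε 0<bʳ)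
    in h , 0<h , λ adj adj-sym 0<n → conclude adj adj-sym 0<n (<⇒≤ 0<h) (<⇒≤ sh<b) ch<εbʳ
    where
    r = fromℕ (suc s)
    -- Half of 1/r. Since ρ s = 1/r - s h, the condition s h ≤ b keeps ρ s above b, and the
    -- r-cliques then have density at least `bʳ`.
    b = (fromℕ 2 * r) ⁻¹
    bʳ = b ^ suc s
    -- The factor of h in `average`: r s comes from 1 - r ρ s, and s + r from the (r+1)-cliques, of
    -- which there are at most h n N₁ / bʳ.
    c = fromℕ 2 * (r * fromℕ s * bʳ + (fromℕ s + r))

    0<r : 0# < r
    0<r = fromℕ-pos s

    0<b : 0# < b
    0<b = ⁻¹-pos (*-pos (fromℕ-pos 1) 0<r)

    0<bʳ : 0# < bʳ
    0<bʳ = ^-pos (suc s) 0<b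

    0≤c : 0# ≤ c
    0≤c = *-nonneg (fromℕ-nonneg 2) (+-nonneg (*-nonneg (*-nonneg (<⇒≤ 0<r) (fromℕ-nonneg s)) (<⇒≤ 0<bʳ))
      (+-nonneg (fromℕ-nonneg s) (<⇒≤ 0<r)))

    module _ {n} (adj : Fin n → Fin n → Bool) (adj-sym : ∀ u v → adj u v ≡ adj v u) (0<n : 0# < fromℕ n)
      {h} (0≤h : 0# ≤ h) (sh≤b : fromℕ s * h ≤ b) (ch<εbʳ : c * h < ε * bʳ)
      (dense : (1# - r ⁻¹ - h) * (fromℕ n * fromℕ n) ≤ degreeSum adj)
      (few : cliqueCount adj (suc (suc s)) ≤ h * fromℕ n ^ suc (suc s))
      where

      open OfGraph adj adj-sym
      open Weighted (λ _ → 1#) (λ _ → 0≤1)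

      ν = fromℕ n
      α = r ⁻¹ + h

      0≤α : 0# ≤ α
      0≤α = +-nonneg (<⇒≤ (⁻¹-pos 0<r)) 0≤h

      N₂-lower : (1# - α) * W * W ≤ N 2
      N₂-lower = begin
        (1# - α) * W * W  ≈⟨ *-cong (*-congˡ (W≈n adj adj-sym)) (W≈n adj adj-sym) ⟩
        (1# - α) * ν * ν
          ≈⟨ solve 3 (λ i h v → (:1 :- (i :+ h)) :* v :* v := (:1 :- i :- h) :* (v :* v)) refl (r ⁻¹) h ν ⟩
        (1# - r ⁻¹ - h) * (ν * ν)  ≤⟨ dense ⟩
        degreeSum adj  ≈⟨ N-two≈degreeSum adj adj-sym ⟨
        N 2  ∎
        where open ≤-Reasoning

      open Chain α 0≤α N₂-lower

      ρ≈ : ρ s ≈ r ⁻¹ - fromℕ s * h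
      ρ≈ = begin
        1# - fromℕ s * α  ≈⟨ +-congʳ (*-⁻¹ 0<r) ⟨
        r * r ⁻¹ - fromℕ s * (r ⁻¹ + h)
          ≈⟨ solve 3 (λ s i h → (:1 :+ s) :* i :- s :* (i :+ h) := i :- s :* h) refl (fromℕ s) (r ⁻¹) h ⟩
        r ⁻¹ - fromℕ s * h  ∎
        where open ≈

      b≤ρ : b ≤ ρ s
      b≤ρ = ≤-cert (begin
        ρ s  ≈⟨ ρ≈ ⟩
        r ⁻¹ - fromℕ s * h  ≈⟨ +-congʳ (2*⁻¹ 0<r) ⟩
        fromℕ 2 * b - fromℕ s * h  ≈⟨ solve 2 (λ b x → :2 :* b :- x := b :+ (b :- x)) refl b (fromℕ s * h) ⟩
        b + (b - fromℕ s * h)  ∎) (≤⇒0≤- sh≤b)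
        where open ≈

      1-rρ≈ : 1# - r * ρ s ≈ r * fromℕ s * h
      1-rρ≈ = begin
        1# - r * ρ s  ≈⟨ +-congˡ (-‿cong (*-congˡ ρ≈)) ⟩
        1# - r * (r ⁻¹ - fromℕ s * h)
          ≈⟨ solve 4 (λ r i s h → :1 :- r :* (i :- s :* h) := (:1 :- r :* i) :+ r :* s :* h) refl r (r ⁻¹) (fromℕ s) h ⟩
        1# - r * r ⁻¹ + r * fromℕ s * h  ≈⟨ +-congʳ (+-congˡ (-‿cong (*-⁻¹ 0<r))) ⟩
        1# - 1# + r * fromℕ s * h  ≈⟨ solve 1 (λ x → :1 :- :1 :+ x := x) refl (r * fromℕ s * h) ⟩
        r * fromℕ s * h  ∎
        where open ≈

      N₁ = N (suc s)
      N₂ = N (suc (suc s))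

      N₁-lower : bʳ * ν ^ suc s ≤ N₁
      N₁-lower = begin
        bʳ * ν ^ suc s  ≈⟨ ^-distrib-* b ν (suc s) ⟨
        (b * ν) ^ suc s  ≈⟨ ^-congˡ (suc s) (*-congˡ (W≈n adj adj-sym)) ⟨
        (b * W) ^ suc s  ≤⟨ N-lower s (<⇒≤ 0<b) b≤ρ ⟩
        N₁  ∎
        where open ≤-Reasoning

      0<N₁ : 0# < N₁
      0<N₁ = <-≤-trans (*-pos 0<bʳ (^-pos (suc s) 0<n)) N₁-lower

      bʳN₂≤ : bʳ * N₂ ≤ h * ν * N₁
      bʳN₂≤ = begin
        bʳ * N₂  ≈⟨ *-congˡ (N≈cliqueCount adj adj-sym (suc (suc s))) ⟩
        bʳ * cliqueCount adj _  ≤⟨ *-monoˡ-≤ (<⇒≤ 0<bʳ) few ⟩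
        bʳ * (h * (ν * ν ^ suc s))
          ≈⟨ solve 4 (λ b h v n → b :* (h :* (v :* n)) := h :* v :* (b :* n)) refl bʳ h ν (ν ^ suc s) ⟩
        h * ν * (bʳ * ν ^ suc s)  ≤⟨ *-monoˡ-≤ (*-nonneg 0≤h (<⇒≤ 0<n)) N₁-lower ⟩
        h * ν * N₁  ∎
        where open ≤-Reasoning

      average : ∑ᵛ (λ K → κ K * (fromℕ 2 * total adj adj-sym K)) < ∑ᵛ (λ (K : Vec (Fin n) (suc s)) → κ K * (ε * (ν * ν)))
      average = *-cancelˡ-< (<⇒≤ 0<bʳ) (begin-strict
        bʳ * ∑ᵛ (λ K → κ K * (fromℕ 2 * total adj adj-sym K))
          ≈⟨ *-congˡ (trans (∑ᵛ-cong λ K → solve 2 (λ k t → k :* (:2 :* t) := :2 :* (k :* t)) refl (κ K) (total adj adj-sym K)) (∑ᵛ-*ˡ (fromℕ 2) _)) ⟩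
        bʳ * (fromℕ 2 * ∑ᵛ (λ K → κ K * total adj adj-sym K))
          ≤⟨ *-monoˡ-≤ (<⇒≤ 0<bʳ) (*-monoˡ-≤ (fromℕ-nonneg 2) (total-sum adj adj-sym s 0≤α N₂-lower (≤-trans (<⇒≤ 0<b) b≤ρ))) ⟩
        bʳ * (fromℕ 2 * (ν * ν * N₁ * (1# - r * ρ s) + (fromℕ s + r) * (ν * N₂)))
          ≈⟨ *-congˡ (*-congˡ (+-congʳ (*-congˡ 1-rρ≈))) ⟩
        bʳ * (fromℕ 2 * (ν * ν * N₁ * (r * fromℕ s * h) + (fromℕ s + r) * (ν * N₂)))
          ≈⟨ solve 6 (λ b q rsh sr v n2 → b :* (:2 :* (q :* rsh :+ sr :* (v :* n2))) := :2 :* (b :* q :* rsh) :+ :2 :* sr :* v :* (b :* n2))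
               refl bʳ (ν * ν * N₁) (r * fromℕ s * h) (fromℕ s + r) ν N₂ ⟩
        fromℕ 2 * (bʳ * (ν * ν * N₁) * (r * fromℕ s * h)) + fromℕ 2 * (fromℕ s + r) * ν * (bʳ * N₂)
          ≤⟨ +-monoʳ-≤ _ (*-monoˡ-≤ (*-nonneg (*-nonneg (fromℕ-nonneg 2) (+-nonneg (fromℕ-nonneg s) (<⇒≤ 0<r))) (<⇒≤ 0<n)) bʳN₂≤) ⟩
        fromℕ 2 * (bʳ * (ν * ν * N₁) * (r * fromℕ s * h)) + fromℕ 2 * (fromℕ s + r) * ν * (h * ν * N₁)
          ≈⟨ solve 6 (λ b rs h sr v n1 → :2 :* (b :* (v :* v :* n1) :* (rs :* h)) :+ :2 :* sr :* v :* (h :* v :* n1) :=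
               v :* v :* n1 :* (:2 :* (rs :* b :+ sr) :* h))
               refl bʳ (r * fromℕ s) h (fromℕ s + r) ν N₁ ⟩
        ν * ν * N₁ * (c * h)
          <⟨ *-monoˡ-< (*-pos (*-pos 0<n 0<n) 0<N₁) ch<εbʳ ⟩
        ν * ν * N₁ * (ε * bʳ)
          ≈⟨ solve 4 (λ v n1 e b → v :* n1 :* (e :* b) := b :* (e :* v :* n1)) refl (ν * ν) N₁ ε bʳ ⟩
        bʳ * (ε * (ν * ν) * N₁)
          ≈⟨ *-congˡ (trans (∑ᵛ-cong λ K → *-comm (κ K) _) (∑ᵛ-*ˡ _ κ)) ⟨
        bʳ * ∑ᵛ (λ K → κ K * (ε * (ν * ν)))
          ∎)
        where open ≤-Reasoning

      conclude : ∃[ c ] monochromatic {r = suc s} adj c ≤ ε * (fromℕ n * fromℕ n)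
      conclude =
        let K , κt<κε = ∑ᵛ-pigeonhole average
            open Partition adj adj-sym K
        in colour , ≤-trans monochromatic-total (≤-trans
          (≤-cert (solve 2 (λ d i → :2 :* (d :+ i) := :2 :* d :+ i :+ i) refl (ν * defect K) _)
            (∑-nonneg λ j → 0≤inside adj adj-sym (removeAt K j)))
          -- The strict inequality excludes κ K = 0, so K is a genuine clique and its weight
          -- cancels.
          (<⇒≤ (*-cancelˡ-< (0≤κ K) κt<κε)))

-- Erdős's theorem: a dense s-ary relation contains a box with t vertices in each part.

module Boxes (ℝ : CompleteOrderedField) where

  open CompleteOrderedField ℝ hiding (zero)
  open OrderedField ℝ
  open Powers ℝ
  open Sums ℝ

  degree : ∀ {n s} → (Fin n → Vec (Fin n) s → Bool) → Vec (Fin n) s → Carrier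
  degree F y = ∑ λ v → 𝟙 (F v y)

  module _ {n s : ℕ} (F : Fin n → Vec (Fin n) s → Bool) where

    0≤degree : ∀ y → 0# ≤ degree F y
    0≤degree y = ∑-nonneg λ v → 0≤𝟙 (F v y)

    degree≤n : ∀ y → degree F y ≤ fromℕ n
    degree≤n y = ≤-trans (∑-mono-≤ λ v → 𝟙≤1 (F v y)) (≤-reflexive (trans (∑-const n 1#) (*-identityʳ _)))

    -- Counts the y in `g` together with t vertices, repetitions allowed, each related to y by `F`.
    moment : ℕ → (Vec (Fin n) s → Bool) → Carrier
    moment t g = ∑ᵛ λ y → 𝟙 (g y) * degree F y ^ t

    moment≤ : ∀ t g → moment t g ≤ fromℕ n ^ t * fromℕ n ^ s
    moment≤ t g = begin
      moment t g
        ≤⟨ ∑ᵛ-mono-≤ (λ y → *-mono-≤ (0≤𝟙 (g y)) (𝟙≤1 (g y)) (^-nonneg t (0≤degree y)) (^-mono-≤ t (0≤degree y) (degree≤n y))) ⟩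
      ∑ᵛ {n} {s} (λ _ → 1# * fromℕ n ^ t)
        ≈⟨ trans (∑ᵛ-const n s _) (trans (*-congˡ (*-identityˡ _)) (*-comm _ _)) ⟩
      fromℕ n ^ t * fromℕ n ^ s  ∎
      where open ≤-Reasoning

    moment-suc : ∀ t g → moment (suc t) g ≈ ∑ λ v → moment t λ y → g y ∧ F v y
    moment-suc t g = begin
      ∑ᵛ (λ y → 𝟙 (g y) * (degree F y * degree F y ^ t))
        ≈⟨ ∑ᵛ-cong (λ y → trans (solve 3 (λ g d e → g :* (d :* e) := g :* e :* d) refl (𝟙 (g y)) (degree F y) _) (sym (∑-*ˡ _ _))) ⟩
      ∑ᵛ (λ y → ∑ λ v → 𝟙 (g y) * degree F y ^ t * 𝟙 (F v y))
        ≈⟨ ∑-∑ᵛ-comm _ ⟨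
      ∑ (λ v → ∑ᵛ λ y → 𝟙 (g y) * degree F y ^ t * 𝟙 (F v y))
        ≈⟨ ∑-cong (λ v → ∑ᵛ-cong λ y → trans (solve 3 (λ g e f → g :* e :* f := g :* f :* e) refl (𝟙 (g y)) (degree F y ^ t) (𝟙 (F v y)))
             (*-congʳ (sym (𝟙-∧ (g y) (F v y))))) ⟩
      ∑ (λ v → moment t λ y → g y ∧ F v y)
        ∎
      where open ≈

    module _ {m : ℕ} (t : ℕ) (g : Vec (Fin n) s → Bool) (used : Fin m → Fin n)
      {c : Carrier} (0<c : 0# < c) (m<cn : fromℕ m < c * fromℕ n) where

      private
        ν = fromℕ n
        B = ν ^ t * ν ^ s

      uses : Fin n → Carrier
      uses v = ∑ λ j → δ (used j) v

      0≤uses : ∀ v → 0# ≤ uses v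
      0≤uses v = ∑-nonneg λ j → 0≤δ (used j) v

      0<B : 0# < B
      0<B = *-pos (^-pos t 0<n) (^-pos s 0<n)
        where
        0<n : 0# < ν
        0<n = *-cancelˡ-< (<⇒≤ 0<c) (≤-<-trans (≤-trans (≤-reflexive (zeroʳ c)) (fromℕ-nonneg m)) m<cn)

      ∑uses : ∑ (λ v → (uses v + c) * B) ≈ (fromℕ m + ν * c) * B
      ∑uses = trans (∑-*ʳ B _) (*-congʳ (trans (∑-distrib-+ _ _) (+-cong
        (trans (∑-comm _) (trans (∑-cong λ j → ∑-δ-1 (used j)) (trans (∑-const m 1#) (*-identityʳ _))))
        (∑-const n c))))

      -- The penalty `uses v` lets one averaging step do two things. Its total m is below c n, so
      -- half of the moment survives; but at a used vertex the threshold is at least B, the largest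
      -- value of any moment, so no used vertex can exceed it.
      chosen : (c + c) * (fromℕ n ^ suc t * fromℕ n ^ s) ≤ moment (suc t) g →
               ∃[ v ] (uses v + c) * B < moment t (λ y → g y ∧ F v y)
      chosen large = ∑-pigeonhole (begin-strict
        ∑ (λ v → (uses v + c) * B)  ≈⟨ ∑uses ⟩
        (fromℕ m + ν * c) * B  ≈⟨ *-comm _ _ ⟩
        B * (fromℕ m + ν * c)  <⟨ *-monoˡ-< 0<B (+-monoˡ-< _ m<cn) ⟩
        B * (c * ν + ν * c)
          ≈⟨ solve 4 (λ a b c v → a :* b :* (c :* v :+ v :* c) := (c :+ c) :* (v :* a :* b)) refl (ν ^ t) (ν ^ s) c ν ⟩
        (c + c) * (ν ^ suc t * ν ^ s)  ≤⟨ large ⟩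
        moment (suc t) g  ≈⟨ moment-suc t g ⟩
        ∑ (λ v → moment t λ y → g y ∧ F v y)  ∎)
        where open ≤-Reasoning

      chosen-unused : ∀ {v} → (uses v + c) * B < moment t (λ y → g y ∧ F v y) → ∀ j → v ≢ used j
      chosen-unused {v} large j v≡used = ≤⇒≯ (moment≤ t (λ y → g y ∧ F v y)) (≤-<-trans (begin
        B  ≈⟨ *-identityˡ B ⟨
        1# * B  ≈⟨ *-congʳ (δ-diagonal (≡.sym v≡used)) ⟨
        δ (used j) v * B
          ≤⟨ *-monoʳ-≤ (<⇒≤ 0<B) (≤-trans (term≤∑ (λ j → 0≤δ (used j) v) j) (≤-cert refl (<⇒≤ 0<c))) ⟩
        (uses v + c) * B  ∎) large)
        where open ≤-Reasoning

      chosen-large : ∀ {v} → (uses v + c) * B < moment t (λ y → g y ∧ F v y) → c * B ≤ moment t (λ y → g y ∧ F v y)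
      chosen-large {v} large = begin
        c * B
          ≤⟨ ≤-cert (solve 3 (λ u c b → (u :+ c) :* b := c :* b :+ u :* b) refl (uses v) c B) (*-nonneg (0≤uses v) (<⇒≤ 0<B)) ⟩
        (uses v + c) * B  ≤⟨ <⇒≤ large ⟩
        moment t (λ y → g y ∧ F v y)  ∎
        where open ≤-Reasoning

      unused : (c + c) * (fromℕ n ^ suc t * fromℕ n ^ s) ≤ moment (suc t) g →
               ∃[ v ] (∀ j → v ≢ used j) × c * (fromℕ n ^ t * fromℕ n ^ s) ≤ moment t (λ y → g y ∧ F v y)
      unused large = let v , large′ = chosen large in v , chosen-unused large′ , chosen-large large′

  Choice : ∀ {n s m} → ℕ → Carrier → (Fin n → Vec (Fin n) s → Bool) → (Vec (Fin n) s → Bool) → (Fin m → Fin n) → Set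
  Choice {n} {s} t c F g used = Σ (Fin t → Fin n) λ vs → Σ (Vec (Fin n) s → Bool) λ h →
    Injective _≡_ _≡_ vs × (∀ i j → vs i ≢ used j) ×
    (∀ y → h y ≡ true → g y ≡ true × ∀ i → F (vs i) y ≡ true) ×
    c * fromℕ n ^ s ≤ ∑ᵛ (λ y → 𝟙 (h y))

  -- The t vertices are chosen one at a time; the moment of order t - i stays large
  -- after i choices, and finally the moment of order 0 counts the tuples left.
  Greedy : (s t m : ℕ) → Carrier → Carrier → ℕ → Set
  Greedy s t m c c′ n =
    (F : Fin n → Vec (Fin n) s → Bool) (g : Vec (Fin n) s → Bool) (used : Fin m → Fin n) →
    c * (fromℕ n ^ t * fromℕ n ^ s) ≤ moment F t g → Choice t c′ F g used

  greedy-zero : ∀ s m c n → Greedy s 0 m c c n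
  greedy-zero s m c n F g used large =
    (λ ()) , g , (λ { {()} }) , (λ ()) , (λ y gy → gy , λ ()) ,
    ≤-trans (≤-reflexive (*-congˡ (sym (*-identityˡ _)))) (≤-trans large (≤-reflexive (∑ᵛ-cong λ y → *-identityʳ _)))

  -- One half of c pays for avoiding the m used vertices, the other half remains for the later
  -- choices.
  greedy-suc : ∀ {s t m c c₂ c′ n} → 0# < c₂ → c₂ + c₂ ≈ c → fromℕ m < c₂ * fromℕ n →
               Greedy s t (suc m) c₂ c′ n → Greedy s (suc t) m c c′ n
  greedy-suc {s} {t} {m} {c} {c₂} {c′} {n} 0<c₂ c₂+c₂≈c m<c₂n rest F g used large =
    extend (unused F t g used 0<c₂ m<c₂n (≤-trans (≤-reflexive (*-congʳ c₂+c₂≈c)) large))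
    where
    injective-∷ : ∀ {v : Fin n} {vs : Fin t → Fin n} → Injective _≡_ _≡_ vs → (∀ i → vs i ≢ v) →
                  Injective _≡_ _≡_ (v Vector.∷ vs)
    injective-∷ inj vs≢v {zero}  {zero}  _  = ≡.refl
    injective-∷ inj vs≢v {zero}  {suc j} v≡  = contradiction (≡.sym v≡) (vs≢v j)
    injective-∷ inj vs≢v {suc i} {zero}  v≡  = contradiction v≡ (vs≢v i)
    injective-∷ inj vs≢v {suc i} {suc j} vs≡ = ≡.cong suc (inj vs≡)

    add : ∀ v → (∀ j → v ≢ used j) →
      Choice t c′ F (λ y → g y ∧ F v y) (v Vector.∷ used) → Choice (suc t) c′ F g used
    add v v-unused (vs , h , vs-injective , vs-unused , h⇒ , many) =
      v Vector.∷ vs , h , injective-∷ vs-injective (λ i → vs-unused i zero) ,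
      (λ { zero j → v-unused j ; (suc i) j → vs-unused i (suc j) }) ,
      (λ y hy → ∧-conicalˡ (g y) (F v y) (proj₁ (h⇒ y hy)) ,
        λ { zero → ∧-conicalʳ (g y) (F v y) (proj₁ (h⇒ y hy)) ; (suc i) → proj₂ (h⇒ y hy) i }) ,
      many

    extend : (∃[ v ] (∀ j → v ≢ used j) × c₂ * (fromℕ n ^ t * fromℕ n ^ s) ≤ moment F t (λ y → g y ∧ F v y)) → Choice (suc t) c′ F g used
    extend (v , v-unused , large′) = add v v-unused (rest F (λ y → g y ∧ F v y) (v Vector.∷ used) large′)

  greedy : ∀ s t m {c} → 0# < c → ∃[ c′ ] 0# < c′ × ∃[ n₀ ] (∀ {n} → n₀ ℕ.≤ n → Greedy s t m c c′ n)
  greedy s zero  m {c} 0<c = c , 0<c , 0 , λ {n} _ → greedy-zero s m c n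
  greedy s (suc t) m {c} 0<c = halve (half 0<c)
    where
    halve : ∃[ c₂ ] 0# < c₂ × c₂ + c₂ ≈ c → ∃[ c′ ] 0# < c′ × ∃[ n₀ ] (∀ {n} → n₀ ℕ.≤ n → Greedy s (suc t) m c c′ n)
    halve (c₂ , 0<c₂ , c₂+c₂≈c) = combine (greedy s t (suc m) 0<c₂) (archimedean-< (fromℕ m) 0<c₂)
      where
      combine : (∃[ c′ ] 0# < c′ × ∃[ n₀ ] (∀ {n} → n₀ ℕ.≤ n → Greedy s t (suc m) c₂ c′ n)) →
                ∃[ n₀ ] (∀ {n} → n₀ ℕ.≤ n → fromℕ m < c₂ * fromℕ n) →
                ∃[ c′ ] 0# < c′ × ∃[ n₀ ] (∀ {n} → n₀ ℕ.≤ n → Greedy s (suc t) m c c′ n)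
      combine (c′ , 0<c′ , n₁ , rest) (n₂ , m<) = c′ , 0<c′ , n₁ ℕ.⊔ n₂ , λ n₀≤n →
        greedy-suc 0<c₂ c₂+c₂≈c (m< (ℕ.≤-trans (ℕ.m≤n⊔m n₁ n₂) n₀≤n)) (rest (ℕ.≤-trans (ℕ.m≤m⊔n n₁ n₂) n₀≤n))

  -- The slope k is t D^(t-1), built by the product rule; each step of the induction gains k (d -
  -- D)².
  ^-tangent : ∀ t {D} → 0# ≤ D → ∃[ k ] 0# ≤ k × (∀ {d} → 0# ≤ d → D ^ t + k * (d - D) ≤ d ^ t)
  ^-tangent zero 0≤D = 0# , ≤-refl , λ {d} _ → ≤-reflexive (solve 1 (λ x → :1 :+ :0 :* x := :1) refl _)
  ^-tangent (suc t) {D} 0≤D =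
    let k , 0≤k , tangent = ^-tangent t 0≤D
    in D ^ t + D * k , +-nonneg (^-nonneg t 0≤D) (*-nonneg 0≤D 0≤k) , λ {d} 0≤d → ≤-trans
      (≤-cert (solve 4 (λ D Dt k d → d :* (Dt :+ k :* (d :- D)) := D :* Dt :+ (Dt :+ D :* k) :* (d :- D) :+ k :* ((d :- D) :* (d :- D)))
        refl D (D ^ t) k d) (*-nonneg 0≤k (square-nonneg (d - D))))
      (*-monoˡ-≤ 0≤d (tangent 0≤d))

  -- Jensen's inequality by averaging the tangent line at D; its slope is nonnegative, so a mean
  -- above D only helps.
  power-mean : ∀ {n s} t {D} → 0# ≤ D → (d : Vec (Fin n) s → Carrier) → (∀ y → 0# ≤ d y) →
               D * fromℕ n ^ s ≤ ∑ᵛ d → D ^ t * fromℕ n ^ s ≤ ∑ᵛ λ y → d y ^ t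
  power-mean {n} {s} t {D} 0≤D d 0≤d large =
    let k , 0≤k , tangent = ^-tangent t 0≤D in begin
    D ^ t * ν
      ≤⟨ ≤-cert refl (*-nonneg 0≤k (≤⇒0≤- large)) ⟩
    D ^ t * ν + k * (∑ᵛ d - D * ν)
      ≈⟨ solve 5 (λ Dt v k d D → Dt :* v :+ k :* (d :- D :* v) := v :* (Dt :- k :* D) :+ k :* d) refl (D ^ t) ν k (∑ᵛ d) D ⟩
    ν * (D ^ t - k * D) + k * ∑ᵛ d
      ≈⟨ trans (∑ᵛ-distrib-+ _ _) (+-cong (∑ᵛ-const n s _) (∑ᵛ-*ˡ k d)) ⟨
    ∑ᵛ (λ y → (D ^ t - k * D) + k * d y)
      ≈⟨ ∑ᵛ-cong (λ y → solve 4 (λ Dt k D d → (Dt :- k :* D) :+ k :* d := Dt :+ k :* (d :- D)) refl (D ^ t) k D (d y)) ⟩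
    ∑ᵛ (λ y → D ^ t + k * (d y - D))
      ≤⟨ ∑ᵛ-mono-≤ (λ y → tangent (0≤d y)) ⟩
    ∑ᵛ (λ y → d y ^ t)
      ∎
    where
    open ≤-Reasoning
    ν = fromℕ n ^ s

  -- The parts `A l` may overlap. For relations consisting of cliques they are disjoint, because
  -- adjacency is irreflexive.
  Box : ∀ {n s} → ℕ → (Vec (Fin n) s → Bool) → Set
  Box {n} {s} t f = Σ (Fin s → Fin t → Fin n) λ A →
    (∀ l → Injective _≡_ _≡_ (A l)) × (∀ (τ : Fin s → Fin t) → f (Vec.tabulate λ l → A l (τ l)) ≡ true)

  Boxes : (s t : ℕ) → Carrier → ℕ → Set
  Boxes s t c n = (f : Vec (Fin n) s → Bool) → c * fromℕ n ^ s ≤ ∑ᵛ (λ K → 𝟙 (f K)) → Box t f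

  boxes-zero : ∀ t {c} n → 0# < c → Boxes 0 t c n
  boxes-zero t {c} n 0<c f large = (λ ()) , (λ ()) , λ _ →
    positive (f []) (<-≤-trans (<-≤-trans 0<c (≤-reflexive (sym (*-identityʳ c)))) (≤-trans large (≤-reflexive (reflexive (∑ᵛ-zero _)))))
    where
    positive : ∀ b → 0# < 𝟙 b → b ≡ true
    positive true  _  = ≡.refl
    positive false 0<0 = contradiction 0<0 (<.irrefl refl)

  -- By convexity the moment of order t is large, so t distinct first coordinates with many common
  -- completions can be picked greedily. Those completions form a dense s-ary relation, and a box in
  -- it extends by the picked vertices.
  boxes-suc : ∀ {s t c c′ n} → 0# < c → Greedy s t 0 (c ^ t) c′ n → Boxes s t c′ n → Boxes (suc s) t c n
  boxes-suc {s} {t} {c} {c′} {n} 0<c choose rest f large =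
    combine (choose F (λ _ → true) (λ ()) large-moment)
    where
    F : Fin n → Vec (Fin n) s → Bool
    F v y = f (v ∷ y)

    large-moment : c ^ t * (fromℕ n ^ t * fromℕ n ^ s) ≤ moment F t (λ _ → true)
    large-moment = begin
      c ^ t * (fromℕ n ^ t * fromℕ n ^ s)  ≈⟨ *-assoc _ _ _ ⟨
      c ^ t * fromℕ n ^ t * fromℕ n ^ s  ≈⟨ *-congʳ (^-distrib-* c (fromℕ n) t) ⟨
      (c * fromℕ n) ^ t * fromℕ n ^ s
        ≤⟨ power-mean t (*-nonneg (<⇒≤ 0<c) (fromℕ-nonneg n)) (degree F) (0≤degree F) average ⟩
      ∑ᵛ (λ y → degree F y ^ t)  ≈⟨ ∑ᵛ-cong (λ y → *-identityˡ _) ⟨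
      moment F t (λ _ → true)  ∎
      where
      open ≤-Reasoning
      average : c * fromℕ n * fromℕ n ^ s ≤ ∑ᵛ (degree F)
      average = begin
        c * fromℕ n * fromℕ n ^ s  ≈⟨ *-assoc _ _ _ ⟩
        c * fromℕ n ^ suc s  ≤⟨ large ⟩
        ∑ᵛ (λ K → 𝟙 (f K))  ≡⟨ ∑ᵛ-suc _ ⟩
        ∑ (λ v → ∑ᵛ λ y → 𝟙 (F v y))  ≈⟨ ∑-∑ᵛ-comm _ ⟩
        ∑ᵛ (degree F)  ∎

    combine : ∀ {used : Fin 0 → Fin n} → Choice t c′ F (λ _ → true) used → Box t f
    combine (vs , h , vs-injective , _ , h⇒ , many) = add (rest h many)
      where
      add : Box t h → Box t f
      add (A , A-injective , A-box) = vs Vector.∷ A , (λ { zero → vs-injective ; (suc l) → A-injective l }) ,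
        λ τ → proj₂ (h⇒ _ (A-box (τ ∘ suc))) (τ zero)

  boxes : ∀ s t {c} → 0# < c → ∃[ n₀ ] (∀ {n} → n₀ ℕ.≤ n → Boxes s t c n)
  boxes zero  t {c} 0<c = 0 , λ {n} _ → boxes-zero t n 0<c
  boxes (suc s) t {c} 0<c = combine (greedy s t 0 (^-pos t 0<c))
    where
    combine : (∃[ c′ ] 0# < c′ × ∃[ n₀ ] (∀ {n} → n₀ ℕ.≤ n → Greedy s t 0 (c ^ t) c′ n)) →
              ∃[ n₀ ] (∀ {n} → n₀ ℕ.≤ n → Boxes (suc s) t c n)
    combine (c′ , 0<c′ , n₁ , choose) = proj₁ ih ℕ.⊔ n₁ , λ n₀≤n →
      boxes-suc 0<c (choose (ℕ.≤-trans (ℕ.m≤n⊔m (proj₁ ih) n₁) n₀≤n)) (proj₂ ih (ℕ.≤-trans (ℕ.m≤m⊔n (proj₁ ih) n₁) n₀≤n))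
      where
      ih : ∃[ n₀ ] (∀ {n} → n₀ ℕ.≤ n → Boxes s t c′ n)
      ih = boxes s t 0<c′

-- From bounded weighted forms to the number of edges.

module Weights (ℝ : CompleteOrderedField) where

  open CompleteOrderedField ℝ hiding (zero)
  open OrderedField ℝ
  open Powers ℝ
  open Sums ℝ
  open Cliques ℝ
  open Stability ℝ

  -- k + 1 times the defect in Young's inequality v^k ≤ k/(k+1) v^(k+1) + 1/(k+1).
  gap : ℕ → Carrier → Carrier
  gap k v = fromℕ k * v ^ suc k + 1# - fromℕ (suc k) * v ^ k

  -- The recursion behind both properties of `gap`: nonnegativity, and the lower bound (v - 1)(v^k -
  -- 1), a quantitative form of strict convexity.
  gap-suc : ∀ k v → gap (suc k) v ≈ (v - 1#) * (v ^ suc k - 1#) + v * gap k v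
  gap-suc k v = solve 3 (λ k v w → (:1 :+ k) :* (v :* (v :* w)) :+ :1 :- (:1 :+ (:1 :+ k)) :* (v :* w) :=
    (v :- :1) :* (v :* w :- :1) :+ v :* (k :* (v :* w) :+ :1 :- (:1 :+ k) :* w)) refl (fromℕ k) v (v ^ k)

  0≤[v-1][v^k-1] : ∀ k {v} → 0# ≤ v → 0# ≤ (v - 1#) * (v ^ k - 1#)
  0≤[v-1][v^k-1] k {v} 0≤v with ≤-total 1# v
  ... | inj₁ 1≤v = *-nonneg (≤⇒0≤- 1≤v) (≤⇒0≤- (1≤^ k 1≤v))
  ... | inj₂ v≤1 = ≤-trans (*-nonneg (≤⇒0≤- v≤1) (≤⇒0≤- (≤-trans (^-mono-≤ k 0≤v v≤1) (≤-reflexive (1^ k)))))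
    (≤-reflexive (solve 2 (λ v w → (:1 :- v) :* (:1 :- w) := (v :- :1) :* (w :- :1)) refl v (v ^ k)))

  0≤gap : ∀ k {v} → 0# ≤ v → 0# ≤ gap k v
  0≤gap zero {v} 0≤v = ≤-reflexive (solve 1 (λ v → :0 := :0 :* (v :* :1) :+ :1 :- (:1 :+ :0) :* :1) refl v)
  0≤gap (suc k) {v} 0≤v = ≤-trans (+-nonneg (0≤[v-1][v^k-1] (suc k) 0≤v) (*-nonneg 0≤v (0≤gap k 0≤v)))
    (≤-reflexive (sym (gap-suc k v)))

  [v-1][v^k-1]≤gap : ∀ k {v} → 0# ≤ v → (v - 1#) * (v ^ k - 1#) ≤ gap k v
  [v-1][v^k-1]≤gap zero {v} 0≤v = ≤-trans
    (≤-reflexive (solve 1 (λ v → (v :- :1) :* (:1 :- :1) := :0) refl v)) (0≤gap zero 0≤v)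
  [v-1][v^k-1]≤gap (suc k) {v} 0≤v = ≤-cert (gap-suc k v) (*-nonneg 0≤v (0≤gap k 0≤v))

  ExcessBound : ℕ → Carrier → Set
  ExcessBound k C = ∀ {θ v} → 0# < θ → θ ≤ 1# → 0# ≤ v → v ^ k ≤ 1# + (C * θ + θ ⁻¹ * gap k v)

  -- Up to v = 1 + θ the power is Lipschitz; beyond, v - 1 ≥ θ makes the gap at least θ (v^k - 1).
  -- The total excess over 1 is thereby controlled by the total gap.
  excess-bound : ∀ k → ∃[ C ] 0# ≤ C × ExcessBound k C
  excess-bound k = bound (^-lipschitz k 0≤1)
    where
    open ≤-Reasoning
    bound : (∃[ C ] 0# ≤ C × (∀ {t h} → 0# ≤ t → t ≤ 1# → 0# ≤ h → h ≤ 1# → (t + h) ^ k ≤ t ^ k + C * h)) →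
            ∃[ C ] 0# ≤ C × ExcessBound k C
    bound (C , 0≤C , lipschitz) = C , 0≤C , cases
      where
      cases : ExcessBound k C
      cases {θ} {v} 0<θ θ≤1 0≤v with ≤-total v (1# + θ)
      ... | inj₁ v≤1+θ = begin
        v ^ k  ≤⟨ ^-mono-≤ k 0≤v v≤1+θ ⟩
        (1# + θ) ^ k  ≤⟨ lipschitz 0≤1 ≤-refl (<⇒≤ 0<θ) θ≤1 ⟩
        1# ^ k + C * θ  ≈⟨ +-congʳ (1^ k) ⟩
        1# + C * θ  ≤⟨ +-monoʳ-≤ 1# (≤-cert refl (*-nonneg (<⇒≤ (⁻¹-pos 0<θ)) (0≤gap k 0≤v))) ⟩
        1# + (C * θ + θ ⁻¹ * gap k v)  ∎
      ... | inj₂ 1+θ≤v = begin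
        v ^ k  ≈⟨ solve 1 (λ w → w := :1 :+ :1 :* (w :- :1)) refl (v ^ k) ⟩
        1# + 1# * (v ^ k - 1#)  ≈⟨ +-congˡ (*-congʳ (⁻¹-inverseˡ (pos⇒≉0 0<θ))) ⟨
        1# + θ ⁻¹ * θ * (v ^ k - 1#)
          ≤⟨ +-monoʳ-≤ 1# (≤-trans (≤-reflexive (*-assoc _ _ _)) (*-monoˡ-≤ (<⇒≤ (⁻¹-pos 0<θ)) θ[v^k-1]≤gap)) ⟩
        1# + θ ⁻¹ * gap k v  ≤⟨ +-monoʳ-≤ 1# (≤-cert (+-comm _ _) (*-nonneg 0≤C (<⇒≤ 0<θ))) ⟩
        1# + (C * θ + θ ⁻¹ * gap k v)  ∎
        where
        1≤v : 1# ≤ v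
        1≤v = ≤-trans (≤-cert refl (<⇒≤ 0<θ)) 1+θ≤v
        θ[v^k-1]≤gap : θ * (v ^ k - 1#) ≤ gap k v
        θ[v^k-1]≤gap = ≤-trans
          (*-monoʳ-≤ (≤⇒0≤- (1≤^ k 1≤v)) (≤-cert (solve 2 (λ v θ → v :- :1 := θ :+ (v :- (:1 :+ θ))) refl v θ) (≤⇒0≤- 1+θ≤v)))
          ([v-1][v^k-1]≤gap k 0≤v)

  ∑∑-linear : ∀ {n} (a b c d : Fin n → Carrier) (e : Fin n → Fin n → Carrier) →
    ∑ (λ i → ∑ λ j → e i j + (a i * b j + c i * d j)) ≈ ∑ (λ i → ∑ λ j → e i j) + (∑ a * ∑ b + ∑ c * ∑ d)
  ∑∑-linear a b c d e = trans
    (∑-cong λ i → trans (∑-distrib-+ _ _) (+-congˡ (∑-distrib-+ _ _)))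
    (trans (∑-distrib-+ _ _) (+-congˡ (trans (∑-distrib-+ _ _) (+-cong (∑∑-* a b) (∑∑-* c d)))))

  module PowerWeights (k : ℕ) {n : ℕ} (adj : Fin n → Fin n → Bool) (adj-sym : ∀ u v → adj u v ≡ adj v u)
    (v : Fin n → Carrier) (0≤v : ∀ i → 0# ≤ v i) (∑v≤n : ∑ (λ i → v i ^ suc k) ≤ fromℕ n) where

    -- The bound on ∑ v^(k+1) is a bound on the moment of order (k+1)/k of these weights, the
    -- surrogate for the moment of order p.
    u : Fin n → Carrier
    u i = v i ^ k

    0≤u : ∀ i → 0# ≤ u i
    0≤u i = ^-nonneg k (0≤v i)

    S : Carrier
    S = ∑ u

    0≤S : 0# ≤ S
    0≤S = ∑-nonneg 0≤u

    form : Carrier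
    form = ∑ λ i → ∑ λ j → u i * u j * 𝟙 (adj i j)

    -- Young's inequality summed over the vertices, with its defect kept: nonnegativity of the gaps
    -- yields S ≤ n, and S close to n makes the gaps small.
    ∑gap≤ : ∑ (λ i → gap k (v i)) ≤ fromℕ (suc k) * (fromℕ n - S)
    ∑gap≤ = begin
      ∑ (λ i → gap k (v i))
        ≈⟨ trans (∑-distrib-- _ _) (+-cong (trans (∑-distrib-+ _ _) (+-cong (∑-*ˡ _ _) (trans (∑-const n 1#) (*-identityʳ _)))) (-‿cong (∑-*ˡ _ _))) ⟩
      fromℕ k * ∑ (λ i → v i ^ suc k) + fromℕ n - fromℕ (suc k) * S
        ≤⟨ +-monoˡ-≤ _ (+-monoˡ-≤ _ (*-monoˡ-≤ (fromℕ-nonneg k) ∑v≤n)) ⟩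
      fromℕ k * fromℕ n + fromℕ n - fromℕ (suc k) * S
        ≈⟨ solve 3 (λ k n s → k :* n :+ n :- (:1 :+ k) :* s := (:1 :+ k) :* (n :- s)) refl (fromℕ k) (fromℕ n) S ⟩
      fromℕ (suc k) * (fromℕ n - S)
        ∎
      where open ≤-Reasoning

    S≤n : S ≤ fromℕ n
    S≤n = *-cancelˡ-≤ (fromℕ-pos k) (≤-cert
      (solve 3 (λ k n s → k :* n := k :* s :+ k :* (n :- s)) refl (fromℕ (suc k)) (fromℕ n) S)
      (≤-trans (∑-nonneg λ i → 0≤gap k (0≤v i)) ∑gap≤))

    -- If x ≤ 1 + a and y ≤ 1 + b, then xy ≤ 1 + ay + b. Only excess over 1 has to be controlled,
    -- for lowering a weight lowers the form.
    form≤degreeSum : ∀ {C θ} → 0# ≤ C → 0# < θ →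
      (∀ i → u i ≤ 1# + (C * θ + θ ⁻¹ * gap k (v i))) →
      form ≤ degreeSum adj + fromℕ 2 * fromℕ n * (C * θ * fromℕ n + θ ⁻¹ * (fromℕ (suc k) * (fromℕ n - S)))
    form≤degreeSum {C} {θ} 0≤C 0<θ u≤ = begin
      form
        ≤⟨ ∑-mono-≤ (λ i → ∑-mono-≤ λ j → pointwise (adj i j) (0≤Z i) (0≤Z j) (0≤u j) (u≤ i) (u≤ j)) ⟩
      ∑ (λ i → ∑ λ j → 𝟙 (adj i j) + (Z i * u j + 1# * Z j))
        ≈⟨ ∑∑-linear Z u (λ _ → 1#) Z (λ i j → 𝟙 (adj i j)) ⟩
      degreeSum adj + (∑ Z * S + ∑ {n} (λ _ → 1#) * ∑ Z)
        ≤⟨ +-monoʳ-≤ _ (+-mono-≤ (*-monoˡ-≤ (∑-nonneg 0≤Z) S≤n) (≤-reflexive (*-congʳ (trans (∑-const n 1#) (*-identityʳ _))))) ⟩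
      degreeSum adj + (∑ Z * ν + ν * ∑ Z)
        ≈⟨ +-congˡ (solve 2 (λ z v → z :* v :+ v :* z := :2 :* v :* z) refl (∑ Z) ν) ⟩
      degreeSum adj + fromℕ 2 * ν * ∑ Z
        ≤⟨ +-monoʳ-≤ _ (*-monoˡ-≤ (*-nonneg (fromℕ-nonneg 2) (fromℕ-nonneg n)) ∑Z≤) ⟩
      degreeSum adj + fromℕ 2 * ν * (C * θ * ν + θ ⁻¹ * (fromℕ (suc k) * (ν - S)))
        ∎
      where
      open ≤-Reasoning
      ν = fromℕ n

      Z : Fin n → Carrier
      Z i = C * θ + θ ⁻¹ * gap k (v i)

      0≤Z : ∀ i → 0# ≤ Z i
      0≤Z i = +-nonneg (*-nonneg 0≤C (<⇒≤ 0<θ)) (*-nonneg (<⇒≤ (⁻¹-pos 0<θ)) (0≤gap k (0≤v i)))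

      ∑Z≤ : ∑ Z ≤ C * θ * ν + θ ⁻¹ * (fromℕ (suc k) * (ν - S))
      ∑Z≤ = begin
        ∑ Z ≈⟨ trans (∑-distrib-+ _ _) (+-cong (trans (∑-const n _) (*-comm _ _)) (∑-*ˡ _ _)) ⟩
        C * θ * ν + θ ⁻¹ * ∑ (λ i → gap k (v i)) ≤⟨ +-monoʳ-≤ _ (*-monoˡ-≤ (<⇒≤ (⁻¹-pos 0<θ)) ∑gap≤) ⟩
        C * θ * ν + θ ⁻¹ * (fromℕ (suc k) * (ν - S)) ∎

      pointwise : ∀ b {x y zx zy} → 0# ≤ zx → 0# ≤ zy → 0# ≤ y → x ≤ 1# + zx → y ≤ 1# + zy →
                  x * y * 𝟙 b ≤ 𝟙 b + (zx * y + 1# * zy)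
      pointwise true {x} {y} {zx} {zy} _ _ 0≤y x≤ y≤ = ≤-cert
        (solve 4 (λ x y a b → :1 :+ (a :* y :+ :1 :* b) := x :* y :* :1 :+ (y :* (:1 :+ a :- x) :+ (:1 :+ b :- y))) refl x y zx zy)
        (+-nonneg (*-nonneg 0≤y (≤⇒0≤- x≤)) (≤⇒0≤- y≤))
      pointwise false {x} {y} {zx} {zy} 0≤zx 0≤zy 0≤y _ _ = ≤-cert
        (solve 4 (λ x y a b → :0 :+ (a :* y :+ :1 :* b) := x :* y :* :0 :+ (a :* y :+ b)) refl x y zx zy)
        (+-nonneg (*-nonneg 0≤zx 0≤y) 0≤zy)

    module Truncated {τ : Carrier} (0<τ : 0# < τ) where

      t : Fin n → Carrier
      t i with 1# <? τ * v i
      ... | yes _ = 0#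
      ... | no  _ = u i

      0≤t : ∀ i → 0# ≤ t i
      0≤t i with 1# <? τ * v i
      ... | yes _ = ≤-refl
      ... | no  _ = 0≤u i

      t≤u : ∀ i → t i ≤ u i
      t≤u i with 1# <? τ * v i
      ... | yes _ = 0≤u i
      ... | no  _ = ≤-refl

      t≤τ⁻ᵏ : ∀ i → t i ≤ (τ ⁻¹) ^ k
      t≤τ⁻ᵏ i with 1# <? τ * v i
      ... | yes _  = ^-nonneg k (<⇒≤ (⁻¹-pos 0<τ))
      ... | no  1≮τv = ^-mono-≤ k (0≤v i) (*-cancelˡ-≤ 0<τ (≤-trans (≮⇒≥ 1≮τv) (≤-reflexive (sym (*-⁻¹ 0<τ)))))

      -- Where the weight is cut, τ v > 1 and v^k is at most τ v^(k+1): the higher moment pays for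
      -- the truncation.
      u≤t+τv : ∀ i → u i ≤ t i + τ * v i ^ suc k
      u≤t+τv i with 1# <? τ * v i
      ... | yes 1<τv = begin
        u i  ≈⟨ *-identityˡ _ ⟨
        1# * u i  ≤⟨ *-monoʳ-≤ (0≤u i) (<⇒≤ 1<τv) ⟩
        τ * v i * u i  ≈⟨ solve 3 (λ t v u → t :* v :* u := :0 :+ t :* (v :* u)) refl τ (v i) (u i) ⟩
        0# + τ * v i ^ suc k  ∎
        where open ≤-Reasoning
      ... | no  _  = ≤-cert refl (*-nonneg (<⇒≤ 0<τ) (^-nonneg (suc k) (0≤v i)))

      open OfGraph adj adj-sym
      open Weighted t 0≤t public

      W≤S : W ≤ S
      W≤S = ∑-mono-≤ t≤u

      form≤N₂ : form ≤ N 2 + fromℕ 2 * τ * (fromℕ n * fromℕ n)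
      form≤N₂ = begin
        form
          ≤⟨ ∑-mono-≤ (λ i → ∑-mono-≤ λ j → pointwise (adj i j) (0≤t i) (0≤t j) (t≤u i) (t≤u j) (0≤q i) (0≤q j) (u≤t+τv i) (u≤t+τv j)) ⟩
        ∑ (λ i → ∑ λ j → t i * t j * 𝟙 (adj i j) + (q i * u j + u i * q j))
          ≈⟨ ∑∑-linear q u u q _ ⟩
        ∑ (λ i → ∑ λ j → t i * t j * 𝟙 (adj i j)) + (∑ q * S + S * ∑ q)
          ≈⟨ +-cong (sym N-two) (solve 2 (λ q s → q :* s :+ s :* q := :2 :* (q :* s)) refl (∑ q) S) ⟩
        N 2 + fromℕ 2 * (∑ q * S)
          ≤⟨ +-monoʳ-≤ _ (*-monoˡ-≤ (fromℕ-nonneg 2) (*-mono-≤ (∑-nonneg 0≤q) ∑q≤ 0≤S S≤n)) ⟩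
        N 2 + fromℕ 2 * (τ * fromℕ n * fromℕ n)
          ≈⟨ +-congˡ (solve 2 (λ t v → :2 :* (t :* v :* v) := :2 :* t :* (v :* v)) refl τ (fromℕ n)) ⟩
        N 2 + fromℕ 2 * τ * (fromℕ n * fromℕ n)
          ∎
        where
        open ≤-Reasoning
        q : Fin n → Carrier
        q i = τ * v i ^ suc k

        0≤q : ∀ i → 0# ≤ q i
        0≤q i = *-nonneg (<⇒≤ 0<τ) (^-nonneg (suc k) (0≤v i))

        ∑q≤ : ∑ q ≤ τ * fromℕ n
        ∑q≤ = ≤-trans (≤-reflexive (∑-*ˡ _ _)) (*-monoˡ-≤ (<⇒≤ 0<τ) ∑v≤n)

        pointwise : ∀ b {x y x′ y′ qx qy} → 0# ≤ x′ → 0# ≤ y′ → x′ ≤ x → y′ ≤ y → 0# ≤ qx → 0# ≤ qy →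
                    x ≤ x′ + qx → y ≤ y′ + qy → x * y * 𝟙 b ≤ x′ * y′ * 𝟙 b + (qx * y + x * qy)
        pointwise true {x} {y} {x′} {y′} {qx} {qy} 0≤x′ 0≤y′ x′≤x y′≤y 0≤qx 0≤qy x≤ y≤ = ≤-cert
          (solve 6 (λ x y s t p q → s :* t :* :1 :+ (p :* y :+ x :* q) :=
             x :* y :* :1 :+ (y :* (s :+ p :- x) :+ (s :* (t :+ q :- y) :+ (x :- s) :* q))) refl x y x′ y′ qx qy)
          (+-nonneg (*-nonneg (≤-trans 0≤y′ y′≤y) (≤⇒0≤- x≤))
            (+-nonneg (*-nonneg 0≤x′ (≤⇒0≤- y≤)) (*-nonneg (≤⇒0≤- x′≤x) 0≤qy)))
        pointwise false {x} {y} {x′} {y′} {qx} {qy} 0≤x′ 0≤y′ x′≤x y′≤y 0≤qx 0≤qy x≤ y≤ = ≤-cert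
          (solve 6 (λ x y s t p q → s :* t :* :0 :+ (p :* y :+ x :* q) := x :* y :* :0 :+ (p :* y :+ x :* q)) refl x y x′ y′ qx qy)
          (+-nonneg (*-nonneg 0≤qx (≤-trans 0≤y′ y′≤y)) (*-nonneg (≤-trans 0≤x′ x′≤x) 0≤qy))

      N₂≤W² : N 2 ≤ W * W
      N₂≤W² = begin
        N 2  ≈⟨ N-two ⟩
        ∑ (λ i → ∑ λ j → t i * t j * 𝟙 (adj i j))
          ≤⟨ ∑-mono-≤ (λ i → ∑-mono-≤ λ j → ≤-trans (*-monoˡ-≤ (*-nonneg (0≤t i) (0≤t j)) (𝟙≤1 (adj i j))) (≤-reflexive (*-identityʳ _))) ⟩
        ∑ (λ i → ∑ λ j → t i * t j)  ≈⟨ ∑∑-* t t ⟩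
        W * W  ∎
        where open ≤-Reasoning

      weight≤ : ∀ {s} (K : Vec (Fin n) s) → weight K ≤ ((τ ⁻¹) ^ k) ^ s
      weight≤ []  = ≤-refl
      weight≤ (x ∷ K) = *-mono-≤ (0≤t x) (t≤τ⁻ᵏ x) (0≤weight K) (weight≤ K)

      N≤cliqueCount : ∀ s → N s ≤ ((τ ⁻¹) ^ k) ^ s * cliqueCount adj s
      N≤cliqueCount s = ≤-trans (∑ᵛ-mono-≤ λ K → *-monoʳ-≤ (0≤𝟙 (clique adj K)) (weight≤ K)) (≤-reflexive (∑ᵛ-*ˡ _ _))

      -- A larger N 2 would allow α = 1/r - τ in `Chain`, where ρ r = r τ is positive. This produces
      -- weighted (r+1)-cliques of total at least (r τ W)^(r+1) ≥ (b n)^(r+1), more than `few`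
      -- admits for weights bounded by τ^(-k).
      N₂-upper : ∀ R {b h} → 0# < b → b + b ≈ fromℕ (suc R) * τ → τ ≤ fromℕ (suc R) ⁻¹ → 0# < fromℕ n →
        ((τ ⁻¹) ^ k) ^ suc (suc R) * h < b ^ suc (suc R) →
        cliqueCount adj (suc (suc R)) ≤ h * fromℕ n ^ suc (suc R) → fromℕ n ≤ fromℕ 2 * W →
        N 2 ≤ (1# - fromℕ (suc R) ⁻¹ + τ) * (W * W)
      N₂-upper R {b} {h} 0<b 2b≈rτ τ≤r⁻¹ 0<n h-small few n≤2W = ≮⇒≥ λ large → <.irrefl refl (begin-strict
        (r * τ * W) ^ suc r′
          ≤⟨ Chain.N-lower α 0≤α (large′ large) r′ (*-nonneg (fromℕ-nonneg r′) (<⇒≤ 0<τ)) (≤-reflexive rτ≈ρ) ⟩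
        N (suc r′)
          ≤⟨ N≤cliqueCount (suc r′) ⟩
        T ^ suc r′ * cliqueCount adj (suc r′)
          ≤⟨ *-monoˡ-≤ (^-nonneg (suc r′) (^-nonneg k (<⇒≤ (⁻¹-pos 0<τ)))) few ⟩
        T ^ suc r′ * (h * ν ^ suc r′)
          ≈⟨ solve 3 (λ t h v → t :* (h :* v) := v :* (t :* h)) refl (T ^ suc r′) h (ν ^ suc r′) ⟩
        ν ^ suc r′ * (T ^ suc r′ * h)
          <⟨ *-monoˡ-< (^-pos (suc r′) 0<n) h-small ⟩
        ν ^ suc r′ * b ^ suc r′
          ≈⟨ trans (*-comm _ _) (sym (^-distrib-* b ν (suc r′))) ⟩
        (b * ν) ^ suc r′
          ≤⟨ ^-mono-≤ (suc r′) (*-nonneg (<⇒≤ 0<b) (<⇒≤ 0<n)) bν≤rτW ⟩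
        (r * τ * W) ^ suc r′
          ∎)
        where
        open ≤-Reasoning
        r′ = suc R
        r = fromℕ r′
        ν = fromℕ n
        α = r ⁻¹ - τ
        T = (τ ⁻¹) ^ k

        0≤α : 0# ≤ α
        0≤α = ≤⇒0≤- τ≤r⁻¹

        large′ : (1# - r ⁻¹ + τ) * (W * W) < N 2 → (1# - α) * W * W ≤ N 2
        large′ large = ≤-trans (≤-reflexive (solve 3 (λ i t w → (:1 :- (i :- t)) :* w :* w := (:1 :- i :+ t) :* (w :* w)) refl (r ⁻¹) τ W)) (<⇒≤ large)

        rτ≈ρ : r * τ ≈ 1# - r * α
        rτ≈ρ = trans (solve 2 (λ r t → r :* t := :1 :- :1 :+ r :* t) refl r τ)
          (trans (+-congʳ (+-congˡ (-‿cong (sym (*-⁻¹ (fromℕ-pos R))))))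
            (solve 3 (λ r i t → :1 :- r :* i :+ r :* t := :1 :- r :* (i :- t)) refl r (r ⁻¹) τ))

        bν≤rτW : b * ν ≤ r * τ * W
        bν≤rτW = ≤-trans (*-monoˡ-≤ (<⇒≤ 0<b) n≤2W) (≤-reflexive
          (trans (solve 2 (λ b w → b :* (:2 :* w) := (b :+ b) :* w) refl b W) (*-congʳ 2b≈rτ)))

      -- A crude preliminary bound, which lets `N₂-upper` compare powers of W with powers of n: W² ≥
      -- N 2 ≥ (1/2 - 3τ) n² ≥ n²/4, the last step by 12 τ ≤ 1.
      n≤2W : ∀ {ι h} → fromℕ 2 * ι ≤ 1# → h ≤ τ → fromℕ 12 * τ ≤ 1# → (1# - ι - h) * (fromℕ n * fromℕ n) ≤ form →
             fromℕ n ≤ fromℕ 2 * W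
      n≤2W {ι} {h} 2ι≤1 h≤τ 12τ≤1 dense = ^-cancel-≤ 1 (*-nonneg (fromℕ-nonneg 2) 0≤W) (begin
        ν * (ν * 1#)
          ≤⟨ ≤-cert (solve 4 (λ v i h t → :4 :* ((:1 :- i :- h) :* (v :* v) :- :2 :* t :* (v :* v)) :=
               v :* (v :* :1) :+ (:2 :* (:1 :- :2 :* i) :+ (:4 :* (t :- h) :+ (:1 :- con (+ 12) :* t))) :* (v :* v))
               refl ν ι h τ)
             (*-nonneg (+-nonneg (*-nonneg (fromℕ-nonneg 2) (≤⇒0≤- 2ι≤1))
               (+-nonneg (*-nonneg (fromℕ-nonneg 4) (≤⇒0≤- h≤τ)) (≤⇒0≤- 12τ≤1))) (square-nonneg ν)) ⟩
        fromℕ 4 * ((1# - ι - h) * (ν * ν) - fromℕ 2 * τ * (ν * ν))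
          ≤⟨ *-monoˡ-≤ (fromℕ-nonneg 4) (≤-trans (+-monoˡ-≤ _ (≤-trans dense form≤N₂))
               (≤-reflexive (solve 2 (λ n x → n :+ x :- x := n) refl (N 2) _))) ⟩
        fromℕ 4 * N 2
          ≤⟨ *-monoˡ-≤ (fromℕ-nonneg 4) N₂≤W² ⟩
        fromℕ 4 * (W * W)
          ≈⟨ solve 1 (λ w → :4 :* (w :* w) := (:2 :* w) :* (:2 :* w :* :1)) refl W ⟩
        (fromℕ 2 * W) ^ 2
          ∎)
        where
        open ≤-Reasoning
        ν = fromℕ n
        :4 : ∀ {m} → Polynomial m
        :4 = con (+ 4)

      -- Comparing (1 - ι - h) n² with (1 - ι + τ) S n + 2 τ n² gives (1 - ι)(n - S) ≤ 4 τ n, and 1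
      -- - ι is at least 1/2.
      deficit : ∀ {ι h} → fromℕ 2 * ι ≤ 1# → h ≤ τ → 0# < fromℕ n → (1# - ι - h) * (fromℕ n * fromℕ n) ≤ form →
                N 2 ≤ (1# - ι + τ) * (W * W) → fromℕ n - S ≤ fromℕ 8 * τ * fromℕ n
      deficit {ι} {h} 2ι≤1 h≤τ 0<n dense N₂≤ = begin
        ν - S
          ≤⟨ ≤-cert (solve 3 (λ v s i → :2 :* ((:1 :- i) :* (v :- s)) := (v :- s) :+ (:1 :- :2 :* i) :* (v :- s)) refl ν S ι)
               (*-nonneg (≤⇒0≤- 2ι≤1) (≤⇒0≤- S≤n)) ⟩
        fromℕ 2 * ((1# - ι) * (ν - S))
          ≤⟨ *-monoˡ-≤ (fromℕ-nonneg 2) β[n-S]≤4τn ⟩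
        fromℕ 2 * (fromℕ 4 * τ * ν)
          ≈⟨ solve 2 (λ t v → :2 :* (con (+ 4) :* t :* v) := con (+ 8) :* t :* v) refl τ ν ⟩
        fromℕ 8 * τ * ν
          ∎
        where
        open ≤-Reasoning
        ν = fromℕ n
        0≤β+τ : 0# ≤ 1# - ι + τ
        0≤β+τ = +-nonneg (*-cancelˡ-≤ (fromℕ-pos 1) (≤-cert
          (solve 1 (λ i → :2 :* (:1 :- i) := :2 :* :0 :+ (:1 :+ (:1 :- :2 :* i))) refl ι) (+-nonneg 0≤1 (≤⇒0≤- 2ι≤1)))) (<⇒≤ 0<τ)

        upper : (1# - ι - h) * (ν * ν) ≤ (1# - ι + τ) * (S * ν) + fromℕ 2 * τ * (ν * ν)
        upper = ≤-trans dense (≤-trans form≤N₂ (+-monoˡ-≤ _ (≤-trans N₂≤ (*-monoˡ-≤ 0≤β+τ (*-mono-≤ 0≤W W≤S 0≤W (≤-trans W≤S S≤n))))))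

        β[n-S]≤4τn : (1# - ι) * (ν - S) ≤ fromℕ 4 * τ * ν
        β[n-S]≤4τn = *-cancelˡ-≤ 0<n (≤-cert
          (solve 5 (λ v s i h t → v :* (con (+ 4) :* t :* v) := v :* ((:1 :- i) :* (v :- s)) :+
            (((:1 :- i :+ t) :* (s :* v) :+ :2 :* t :* (v :* v) :- (:1 :- i :- h) :* (v :* v)) :+ ((t :- h) :* (v :* v) :+ t :* v :* (v :- s))))
            refl ν S ι h τ)
          (+-nonneg (≤⇒0≤- upper) (+-nonneg (*-nonneg (≤⇒0≤- h≤τ) (square-nonneg ν))
            (*-nonneg (*-nonneg (<⇒≤ 0<τ) (<⇒≤ 0<n)) (≤⇒0≤- S≤n)))))

  -- The condition χ(F) ≥ 3, that is r ≥ 2, enters through this bound.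
  2*⁻¹≤1 : ∀ R → fromℕ 2 * fromℕ (suc (suc R)) ⁻¹ ≤ 1#
  2*⁻¹≤1 R = begin
    fromℕ 2 * r ⁻¹
      ≤⟨ *-monoʳ-≤ (<⇒≤ (⁻¹-pos (fromℕ-pos (suc R)))) (fromℕ-mono-≤ {2} {suc (suc R)} (s≤s (s≤s z≤n))) ⟩
    r * r ⁻¹  ≈⟨ *-⁻¹ (fromℕ-pos (suc R)) ⟩
    1#  ∎
    where
    open ≤-Reasoning
    r = fromℕ (suc (suc R))

  Concentration : (k R : ℕ) → Carrier → Carrier → Set
  Concentration k R ε h =
    ∀ {n} (adj : Fin n → Fin n → Bool) → (∀ u v → adj u v ≡ adj v u) → 0# < fromℕ n →
    (v : Fin n → Carrier) → (∀ i → 0# ≤ v i) → ∑ (λ i → v i ^ suc k) ≤ fromℕ n →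
    (1# - fromℕ (suc (suc R)) ⁻¹ - h) * (fromℕ n * fromℕ n) ≤ ∑ (λ i → ∑ λ j → v i ^ k * v j ^ k * 𝟙 (adj i j)) →
    cliqueCount adj (suc (suc (suc R))) ≤ h * fromℕ n ^ suc (suc (suc R)) →
    (1# - fromℕ (suc (suc R)) ⁻¹ - ε) * (fromℕ n * fromℕ n) ≤ degreeSum adj

  -- Relative to n², the losses are h ≤ τ, then 2 C θ from weights near 1, then 2 θ⁻¹ (k+1) · 8 τ
  -- from the deficit, whence the constant 16. The second loss is charged to one half e of ε, the
  -- others to the other half.
  concentrate : ∀ k R {ε e C θ τ b h} → e + e ≈ ε → 0# ≤ C → 0# < θ →
    (∀ {v} → 0# ≤ v → v ^ k ≤ 1# + (C * θ + θ ⁻¹ * gap k v)) → fromℕ 2 * C * θ ≤ e →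
    0# < τ → (1# + fromℕ 16 * θ ⁻¹ * fromℕ (suc k)) * τ ≤ e → fromℕ 12 * τ ≤ 1# → τ ≤ fromℕ (suc (suc R)) ⁻¹ →
    0# < b → b + b ≈ fromℕ (suc (suc R)) * τ → h ≤ τ →
    ((τ ⁻¹) ^ k) ^ suc (suc (suc R)) * h < b ^ suc (suc (suc R)) → Concentration k R ε h
  concentrate k R {ε} {e} {C} {θ} {τ} {b} {h} 2e≈ε 0≤C 0<θ u≤ 2Cθ≤e 0<τ Dτ≤e 12τ≤1 τ≤ι 0<b 2b≈rτ h≤τ h-small
    {n} adj adj-sym 0<n v 0≤v ∑v≤n dense few = begin
    (1# - ι - ε) * (ν * ν)
      ≈⟨ *-congʳ (+-congˡ (-‿cong (sym 2e≈ε))) ⟩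
    (1# - ι - (e + e)) * (ν * ν)
      ≤⟨ ≤-cert (solve 8 (λ v i h e t c x k → (:1 :- i :- h) :* (v :* v) :- :2 :* v :* (c :* v :+ x :* (k :* (con (+ 8) :* t :* v))) :=
           (:1 :- i :- (e :+ e)) :* (v :* v) :+ ((e :- :2 :* c) :+ ((e :- (:1 :+ con (+ 16) :* x :* k) :* t) :+ (t :- h))) :* (v :* v))
           refl ν ι h e τ (C * θ) (θ ⁻¹) (fromℕ (suc k)))
         (*-nonneg (+-nonneg (≤⇒0≤- (≤-trans (≤-reflexive (sym (*-assoc _ _ _))) 2Cθ≤e)) (+-nonneg (≤⇒0≤- Dτ≤e) (≤⇒0≤- h≤τ))) (square-nonneg ν)) ⟩
    (1# - ι - h) * (ν * ν) - fromℕ 2 * ν * (C * θ * ν + θ ⁻¹ * (fromℕ (suc k) * (fromℕ 8 * τ * ν)))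
      ≤⟨ +-mono-≤ dense (≤-cert
           (solve 5 (λ v c x d s → :- (:2 :* v :* (c :+ x :* d)) := :- (:2 :* v :* (c :+ x :* s)) :+ :2 :* v :* (x :* (s :- d)))
             refl ν (C * θ * ν) (θ ⁻¹) (fromℕ (suc k) * (ν - S)) (fromℕ (suc k) * (fromℕ 8 * τ * ν)))
           (*-nonneg (*-nonneg (fromℕ-nonneg 2) (<⇒≤ 0<n)) (*-nonneg (<⇒≤ (⁻¹-pos 0<θ)) (≤⇒0≤- (*-monoˡ-≤ (fromℕ-nonneg (suc k))
             (deficit 2ι≤1 h≤τ 0<n dense (N₂-upper (suc R) 0<b 2b≈rτ τ≤ι 0<n h-small few (n≤2W 2ι≤1 h≤τ 12τ≤1 dense)))))))) ⟩
    form - fromℕ 2 * ν * (C * θ * ν + θ ⁻¹ * (fromℕ (suc k) * (ν - S)))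
      ≤⟨ +-monoˡ-≤ _ (form≤degreeSum 0≤C 0<θ (λ i → u≤ (0≤v i))) ⟩
    degreeSum adj + fromℕ 2 * ν * (C * θ * ν + θ ⁻¹ * (fromℕ (suc k) * (ν - S))) - fromℕ 2 * ν * (C * θ * ν + θ ⁻¹ * (fromℕ (suc k) * (ν - S)))
      ≈⟨ solve 2 (λ d x → d :+ x :- x := d) refl (degreeSum adj) _ ⟩
    degreeSum adj
      ∎
    where
    open ≤-Reasoning
    ν = fromℕ n
    ι = fromℕ (suc (suc R)) ⁻¹
    2ι≤1 : fromℕ 2 * ι ≤ 1#
    2ι≤1 = 2*⁻¹≤1 R
    open PowerWeights k adj adj-sym v 0≤v ∑v≤n
    open Truncated 0<τ

  -- As θ⁻¹ multiplies τ, and a power of τ⁻¹ multiplies h, the constants have to be chosen in the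
  -- order θ, τ, h.
  concentration : ∀ k R {ε} → 0# < ε → ∃[ h ] 0# < h × Concentration k R ε h
  concentration k R {ε} 0<ε = choose-e (half 0<ε) (excess-bound k)
    where
    Goal : Set
    Goal = ∃[ h ] 0# < h × Concentration k R ε h

    r = fromℕ (suc (suc R))

    choose-e : ∃[ e ] 0# < e × e + e ≈ ε →
      ∃[ C ] 0# ≤ C × ExcessBound k C → Goal
    choose-e (e , 0<e , 2e≈ε) (C , 0≤C , u≤) = choose-θ (small (*-nonneg (fromℕ-nonneg 2) 0≤C) 0<e)
      where
      choose-θ : ∃[ θ ] 0# < θ × θ ≤ 1# × fromℕ 2 * C * θ < e → Goal
      choose-θ (θ , 0<θ , θ≤1 , 2Cθ<e) = choose-τ (small₂ 0≤D 0<e (+-nonneg (fromℕ-nonneg 12) (fromℕ-nonneg (suc (suc R)))) 0<1)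
        where
        D = 1# + fromℕ 16 * θ ⁻¹ * fromℕ (suc k)
        0≤D : 0# ≤ D
        0≤D = +-nonneg 0≤1 (*-nonneg (*-nonneg (fromℕ-nonneg 16) (<⇒≤ (⁻¹-pos 0<θ))) (fromℕ-nonneg (suc k)))

        choose-τ : ∃[ τ ] 0# < τ × D * τ < e × (fromℕ 12 + r) * τ < 1# → Goal
        choose-τ (τ , 0<τ , Dτ<e , [12+r]τ<1) = choose-b (half (*-pos (fromℕ-pos (suc R)) 0<τ))
          where
          12τ≤1 : fromℕ 12 * τ ≤ 1#
          12τ≤1 = ≤-trans (≤-cert (distribʳ τ (fromℕ 12) r) (*-nonneg (fromℕ-nonneg (suc (suc R))) (<⇒≤ 0<τ))) (<⇒≤ [12+r]τ<1)
          τ≤r⁻¹ : τ ≤ r ⁻¹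
          τ≤r⁻¹ = *-cancelˡ-≤ (fromℕ-pos (suc R)) (≤-trans
            (≤-cert (trans (distribʳ τ (fromℕ 12) r) (+-comm _ _)) (*-nonneg (fromℕ-nonneg 12) (<⇒≤ 0<τ)))
            (≤-trans (<⇒≤ [12+r]τ<1) (≤-reflexive (sym (*-⁻¹ (fromℕ-pos (suc R)))))))

          choose-b : ∃[ b ] 0# < b × b + b ≈ r * τ → Goal
          choose-b (b , 0<b , 2b≈rτ) = choose-h (small₂ 0≤1 0<τ
              (^-nonneg (suc (suc (suc R))) (^-nonneg k (<⇒≤ (⁻¹-pos 0<τ)))) (^-pos (suc (suc (suc R))) 0<b))
            where
            choose-h : ∃[ h ] 0# < h × 1# * h < τ × ((τ ⁻¹) ^ k) ^ suc (suc (suc R)) * h < b ^ suc (suc (suc R)) → Goal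
            choose-h (h , 0<h , h<τ , h-small) = h , 0<h , concentrate k R 2e≈ε 0≤C 0<θ (u≤ 0<θ θ≤1) (<⇒≤ 2Cθ<e)
              0<τ (<⇒≤ Dτ<e) 12τ≤1 τ≤r⁻¹ 0<b 2b≈rτ (≤-trans (≤-reflexive (sym (*-identityˡ h))) (<⇒≤ h<τ)) h-small

-- Comparison of real powers with rational ones.

module RealPowers (ℝ : CompleteOrderedField) where

  open CompleteOrderedField ℝ hiding (zero)
  open OrderedField ℝ
  open Powers ℝ
  open Weights ℝ using (0≤gap)

  0≤∣∣ : ∀ x → 0# ≤ ∣ x ∣
  0≤∣∣ x with x <? 0#
  ... | yes x<0 = ≤-trans (≤⇒0≤- (<⇒≤ x<0)) (≤-reflexive (+-identityˡ _))
  ... | no  x≮0 = ≮⇒≥ x≮0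

  *≤∣∣*∣∣ : ∀ x y → x * y ≤ ∣ x ∣ * ∣ y ∣
  *≤∣∣*∣∣ x y with x <? 0# | y <? 0#
  ... | yes x<0 | yes y<0 = ≤-reflexive (solve 2 (λ x y → x :* y := (:- x) :* (:- y)) refl x y)
  ... | yes x<0 | no  y≮0 = ≤-cert (solve 2 (λ x y → (:- x) :* y := x :* y :+ :2 :* ((:0 :- x) :* y)) refl x y)
    (*-nonneg (fromℕ-nonneg 2) (*-nonneg (≤⇒0≤- (<⇒≤ x<0)) (≮⇒≥ y≮0)))
  ... | no  x≮0 | yes y<0 = ≤-cert (solve 2 (λ x y → x :* (:- y) := x :* y :+ :2 :* (x :* (:0 :- y))) refl x y)
    (*-nonneg (fromℕ-nonneg 2) (*-nonneg (≮⇒≥ x≮0) (≤⇒0≤- (<⇒≤ y<0))))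
  ... | no  x≮0 | no  y≮0 = ≤-refl

  -- The lower set whose supremum is powFrom1 x p.
  LowerPower : Carrier → Carrier → Carrier → Set
  LowerPower x p t = ∃[ a ] ∃[ b ] 0 ℕ.< b × fromℕ a ≤ p * fromℕ b × 0# ≤ t × t ^ b ≤ x ^ a

  -- With y the (b+1)-st root of x, raising to the power `suc b′` turns the claim into a comparison
  -- of the natural exponents (b+1) a′ and a (b′+1) of y.
  lowerPower-≤ : ∀ {x p y t} a b → 1# ≤ y → x ≈ y ^ suc b → p * fromℕ (suc b) ≤ fromℕ a →
                 LowerPower x p t → t ≤ y ^ a
  lowerPower-≤ {x} {p} {y} {t} a b 1≤y x≈yᵇ pb≤a (a′ , suc b′ , _ , a′≤pb′ , 0≤t , tᵇ≤xᵃ) =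
    ^-cancel-≤ b′ (^-nonneg a (≤-trans 0≤1 1≤y)) (begin
      t ^ suc b′  ≤⟨ tᵇ≤xᵃ ⟩
      x ^ a′  ≈⟨ ^-congˡ a′ x≈yᵇ ⟩
      (y ^ suc b) ^ a′  ≈⟨ ^-assocʳ y (suc b) a′ ⟩
      y ^ (suc b ℕ.* a′)  ≤⟨ ^-monoʳ-≤ 1≤y (fromℕ-cancel-≤ {suc b ℕ.* a′} {a ℕ.* suc b′} exponents) ⟩
      y ^ (a ℕ.* suc b′)  ≈⟨ ^-assocʳ y a (suc b′) ⟨
      (y ^ a) ^ suc b′  ∎)
    where
    open ≤-Reasoning
    exponents : fromℕ (suc b ℕ.* a′) ≤ fromℕ (a ℕ.* suc b′)
    exponents = begin
      fromℕ (suc b ℕ.* a′)  ≈⟨ fromℕ-* (suc b) a′ ⟩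
      fromℕ (suc b) * fromℕ a′  ≤⟨ *-monoˡ-≤ (fromℕ-nonneg (suc b)) a′≤pb′ ⟩
      fromℕ (suc b) * (p * fromℕ (suc b′))
        ≈⟨ solve 3 (λ b p c → b :* (p :* c) := (p :* b) :* c) refl (fromℕ (suc b)) p (fromℕ (suc b′)) ⟩
      p * fromℕ (suc b) * fromℕ (suc b′)  ≤⟨ *-monoʳ-≤ (fromℕ-nonneg (suc b′)) pb≤a ⟩
      fromℕ a * fromℕ (suc b′)  ≈⟨ fromℕ-* a (suc b′) ⟨
      fromℕ (a ℕ.* suc b′)  ∎

  module _ {x p : Carrier} (1≤x : 1# ≤ x) (0≤p : 0# ≤ p) where

    1∈lowerPower : LowerPower x p 1#
    1∈lowerPower = 0 , 1 , s≤s z≤n , *-nonneg 0≤p (fromℕ-nonneg 1) , 0≤1 , ≤-reflexive (1^ 1)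

    powFrom1-isSup : IsSup (LowerPower x p) (powFrom1 x p)
    powFrom1-isSup = sup-isSup _ (1# , 1∈lowerPower) bounded
      where
      bounded : ∃ (UpperBound (LowerPower x p))
      bounded = let A , p<A = archimedean p in x ^ A , lowerPower-≤ A 0 1≤x (sym (*-identityʳ x))
        (≤-trans (≤-reflexive (trans (*-congˡ (+-identityʳ 1#)) (*-identityʳ p))) (<⇒≤ p<A))

    powFrom1-lower : ∀ {t} → LowerPower x p t → t ≤ powFrom1 x p
    powFrom1-lower = proj₁ powFrom1-isSup

    powFrom1-upper : ∀ {y} a b → 1# ≤ y → x ≈ y ^ suc b → p * fromℕ (suc b) ≤ fromℕ a → powFrom1 x p ≤ y ^ a
    powFrom1-upper a b 1≤y x≈yᵇ pb≤a = ≮⇒≥ λ yᵃ<pow →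
      let t , t∈ , yᵃ<t = proj₂ powFrom1-isSup yᵃ<pow in ≤⇒≯ (lowerPower-≤ a b 1≤y x≈yᵇ pb≤a t∈) yᵃ<t

    1≤powFrom1 : 1# ≤ powFrom1 x p
    1≤powFrom1 = powFrom1-lower 1∈lowerPower

  ^ℝ-≥1 : ∀ {x} p → 1# ≤ x → x ^ℝ p ≡ powFrom1 x p
  ^ℝ-≥1 {x} p 1≤x with x <? 1#
  ... | yes x<1 = contradiction x<1 (≤⇒≯ 1≤x)
  ... | no  _  = ≡.refl

  ^ℝ-<1 : ∀ {x} p → 0# < x → x < 1# → x ^ℝ p ≡ powFrom1 (x ⁻¹) p ⁻¹
  ^ℝ-<1 {x} p 0<x x<1 with x <? 1#
  ... | no  x≮1 = contradiction x<1 x≮1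
  ... | yes _ with 0# <? x
  ...  | yes _  = ≡.refl
  ...  | no  0≮x = contradiction 0<x 0≮x

  ^ℝ-≤0 : ∀ {x} p → x ≤ 0# → x ^ℝ p ≡ 0#
  ^ℝ-≤0 {x} p x≤0 with x <? 1#
  ... | no  x≮1 = contradiction (≤-<-trans x≤0 0<1) x≮1
  ... | yes _ with 0# <? x
  ...  | yes 0<x = contradiction 0<x (≤⇒≯ x≤0)
  ...  | no  _  = ≡.refl

  1≤⁻¹ : ∀ {x} → 0# < x → x ≤ 1# → 1# ≤ x ⁻¹
  1≤⁻¹ {x} 0<x x≤1 = *-cancelˡ-≤ 0<x (≤-trans (≤-trans (≤-reflexive (*-identityʳ x)) x≤1) (≤-reflexive (sym (*-⁻¹ 0<x))))

  ⁻¹-^ : ∀ {x} n → 0# < x → x ^ n * (x ⁻¹) ^ n ≈ 1#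
  ⁻¹-^ {x} n 0<x = trans (sym (^-distrib-* x (x ⁻¹) n)) (trans (^-congˡ n (*-⁻¹ 0<x)) (1^ n))

  -- Since x ≤ 1, its rational power ξᵃ = x^(a/(b+1)) is at most x^p once a/(b+1) ≥ p.
  ^ℝ-lower : ∀ {x p ξ} a b → 0# < p → 0# ≤ ξ → ξ ^ suc b ≈ x → x ≤ 1# → p * fromℕ (suc b) ≤ fromℕ a → ξ ^ a ≤ x ^ℝ p
  ^ℝ-lower {x} {p} {ξ} a b 0<p 0≤ξ ξᵇ≈x x≤1 pb≤a = cases a pb≤a (<-or-≥ 0# ξ) (<-or-≥ x 1#)
    where
    open ≤-Reasoning
    cases : ∀ a → p * fromℕ (suc b) ≤ fromℕ a → 0# < ξ ⊎ ξ ≤ 0# → x < 1# ⊎ 1# ≤ x → ξ ^ a ≤ x ^ℝ p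
    cases zero pb≤0 _ _ = contradiction (*-pos 0<p (fromℕ-pos b)) (≤⇒≯ pb≤0)
    cases (suc a) _ (inj₂ ξ≤0) _ = begin
      ξ * ξ ^ a  ≤⟨ *-monoʳ-≤ (^-nonneg a 0≤ξ) ξ≤0 ⟩
      0# * ξ ^ a ≈⟨ zeroˡ _ ⟩
      0#  ≡⟨ ^ℝ-≤0 p x≤0 ⟨
      x ^ℝ p  ∎
      where
      x≤0 : x ≤ 0#
      x≤0 = ≤-trans (≤-reflexive (sym ξᵇ≈x)) (≤-trans (*-monoʳ-≤ (^-nonneg b 0≤ξ) ξ≤0) (≤-reflexive (zeroˡ _)))
    cases a pb≤a (inj₁ 0<ξ) (inj₁ x<1) = *-cancelˡ-≤ 0<pow (begin
      pow * ξ ^ a  ≤⟨ *-monoʳ-≤ (^-nonneg a 0≤ξ) (powFrom1-upper 1≤x⁻¹ (<⇒≤ 0<p) a b (1≤⁻¹ 0<ξ ξ≤1) x⁻¹≈ pb≤a) ⟩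
      (ξ ⁻¹) ^ a * ξ ^ a  ≈⟨ trans (*-comm _ _) (⁻¹-^ a 0<ξ) ⟩
      1#  ≈⟨ *-⁻¹ 0<pow ⟨
      pow * pow ⁻¹  ≡⟨ ≡.cong (pow *_) (^ℝ-<1 p 0<x x<1) ⟨
      pow * x ^ℝ p  ∎)
      where
      0<x : 0# < x
      0<x = <-≤-trans (^-pos (suc b) 0<ξ) (≤-reflexive ξᵇ≈x)
      pow = powFrom1 (x ⁻¹) p
      1≤x⁻¹ : 1# ≤ x ⁻¹
      1≤x⁻¹ = 1≤⁻¹ 0<x x≤1
      0<pow : 0# < pow
      0<pow = <-≤-trans 0<1 (1≤powFrom1 1≤x⁻¹ (<⇒≤ 0<p))
      ξ≤1 : ξ ≤ 1#
      ξ≤1 = ^-cancel-≤ b 0≤1 (≤-trans (≤-reflexive ξᵇ≈x) (≤-trans x≤1 (≤-reflexive (sym (1^ (suc b))))))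
      x⁻¹≈ : x ⁻¹ ≈ (ξ ⁻¹) ^ suc b
      x⁻¹≈ = trans (sym (*-identityʳ _)) (trans (*-congˡ (sym (⁻¹-^ (suc b) 0<ξ))) (trans (sym (*-assoc _ _ _))
        (trans (*-congʳ (trans (*-congˡ ξᵇ≈x) (⁻¹-inverseˡ (pos⇒≉0 0<x)))) (*-identityˡ _))))
    cases a _ (inj₁ 0<ξ) (inj₂ 1≤x) = begin
      ξ ^ a  ≤⟨ ^-mono-≤ a 0≤ξ ξ≤1 ⟩
      1# ^ a  ≈⟨ 1^ a ⟩
      1#  ≤⟨ 1≤powFrom1 1≤x (<⇒≤ 0<p) ⟩
      powFrom1 x p  ≡⟨ ^ℝ-≥1 p 1≤x ⟨
      x ^ℝ p  ∎
      where
      ξ≤1 : ξ ≤ 1#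
      ξ≤1 = ^-cancel-≤ b 0≤1 (≤-trans (≤-reflexive ξᵇ≈x) (≤-trans x≤1 (≤-reflexive (sym (1^ (suc b))))))

  x≤x^ℝ : ∀ {x p} → 1# ≤ x → 1# ≤ p → x ≤ x ^ℝ p
  x≤x^ℝ {x} {p} 1≤x 1≤p = ≤-trans (powFrom1-lower 1≤x (≤-trans 0≤1 1≤p)
    (1 , 1 , s≤s z≤n , ≤-trans (≤-reflexive (sym (*-identityˡ _))) (*-monoʳ-≤ (fromℕ-nonneg 1) 1≤p) , ≤-trans 0≤1 1≤x , ≤-refl))
    (≤-reflexive (reflexive (≡.sym (^ℝ-≥1 p 1≤x))))

  0≤^ℝ : ∀ {x p} → 0# ≤ p → 0# ≤ x ^ℝ p
  0≤^ℝ {x} {p} 0≤p = cases (<-or-≥ 0# x) (<-or-≥ x 1#)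
    where
    cases : 0# < x ⊎ x ≤ 0# → x < 1# ⊎ 1# ≤ x → 0# ≤ x ^ℝ p
    cases (inj₂ x≤0) _ = ≤-reflexive (reflexive (≡.sym (^ℝ-≤0 p x≤0)))
    cases (inj₁ 0<x) (inj₁ x<1) = ≤-trans
      (<⇒≤ (⁻¹-pos (<-≤-trans 0<1 (1≤powFrom1 (1≤⁻¹ 0<x (<⇒≤ x<1)) 0≤p))))
      (≤-reflexive (reflexive (≡.sym (^ℝ-<1 p 0<x x<1))))
    cases (inj₁ 0<x) (inj₂ 1≤x) = ≤-trans (≤-trans 0≤1 (1≤powFrom1 1≤x 0≤p))
      (≤-reflexive (reflexive (≡.sym (^ℝ-≥1 p 1≤x))))

  -- The weighted AM-GM inequality for w^(c+1+d) and 1; induction on d chains the one-step cases,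
  -- which are `0≤gap`.
  young : ∀ c d {w} → 0# ≤ w → fromℕ (suc c ℕ.+ d) * w ^ suc c ≤ fromℕ (suc c) * w ^ (suc c ℕ.+ d) + fromℕ d
  young c zero {w} 0≤w = ≤-reflexive (trans (reflexive (≡.cong₂ (λ m m′ → fromℕ m * w ^ suc c) (ℕ.+-identityʳ (suc c)) (≡.refl {x = 0})))
    (trans (sym (+-identityʳ _)) (+-congʳ (*-congˡ (^-congʳ w (≡.sym (ℕ.+-identityʳ (suc c))))))))
  young c (suc d) {w} 0≤w = *-cancelˡ-≤ (fromℕ-pos (c ℕ.+ d)) (begin
    m * (fromℕ (suc c ℕ.+ suc d) * wᶜ)
      ≈⟨ *-congˡ (*-congʳ (reflexive (≡.cong fromℕ (ℕ.+-suc (suc c) d)))) ⟩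
    m * ((1# + m) * wᶜ)
      ≈⟨ solve 2 (λ m w → m :* ((:1 :+ m) :* w) := (:1 :+ m) :* (m :* w)) refl m wᶜ ⟩
    (1# + m) * (m * wᶜ)
      ≤⟨ *-monoˡ-≤ (fromℕ-nonneg (suc (suc c ℕ.+ d))) (young c d 0≤w) ⟩
    (1# + m) * (fromℕ (suc c) * wᵐ + fromℕ d)
      ≈⟨ solve 4 (λ m c w d → (:1 :+ m) :* (c :* w :+ d) := c :* ((:1 :+ m) :* w) :+ (:1 :+ m) :* d) refl m (fromℕ (suc c)) wᵐ (fromℕ d) ⟩
    fromℕ (suc c) * ((1# + m) * wᵐ) + (1# + m) * fromℕ d
      ≤⟨ +-monoˡ-≤ _ (*-monoˡ-≤ (fromℕ-nonneg (suc c)) (≤-cert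
           (solve 2 (λ a b → a := b :+ (a :- b)) refl (m * (w * wᵐ) + 1#) ((1# + m) * wᵐ)) (0≤gap (suc c ℕ.+ d) 0≤w))) ⟩
    fromℕ (suc c) * (m * (w * wᵐ) + 1#) + (1# + m) * fromℕ d
      ≈⟨ +-congˡ (*-congʳ (+-congˡ m≈)) ⟩
    fromℕ (suc c) * (m * (w * wᵐ) + 1#) + (1# + (fromℕ (suc c) + fromℕ d)) * fromℕ d
      ≈⟨ solve 4 (λ c m x d → c :* (m :* x :+ :1) :+ (:1 :+ (c :+ d)) :* d := m :* (c :* x) :+ (c :+ d) :* (:1 :+ d)) refl (fromℕ (suc c)) m (w * wᵐ) (fromℕ d) ⟩
    m * (fromℕ (suc c) * (w * wᵐ)) + (fromℕ (suc c) + fromℕ d) * (1# + fromℕ d)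
      ≈⟨ +-congˡ (*-congʳ (sym m≈)) ⟩
    m * (fromℕ (suc c) * (w * wᵐ)) + m * (1# + fromℕ d)
      ≈⟨ distribˡ _ _ _ ⟨
    m * (fromℕ (suc c) * (w * wᵐ) + fromℕ (suc d))
      ≈⟨ *-congˡ (+-congʳ (*-congˡ (^-congʳ w (ℕ.+-suc (suc c) d)))) ⟨
    m * (fromℕ (suc c) * w ^ (suc c ℕ.+ suc d) + fromℕ (suc d))
      ∎)
    where
    open ≤-Reasoning
    m = fromℕ (suc c ℕ.+ d)
    wᶜ = w ^ suc c
    wᵐ = w ^ (suc c ℕ.+ d)
    m≈ : m ≈ fromℕ (suc c) + fromℕ d
    m≈ = fromℕ-+ (suc c) d

-- Rescaling a vector of p-norm at most 1 to weights that are natural powers.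

module Rescaling (ℝ : CompleteOrderedField) where

  open CompleteOrderedField ℝ hiding (zero)
  open OrderedField ℝ
  open Powers ℝ
  open Sums ℝ
  open RealPowers ℝ

  -- The rational exponent a/b lies just above p: a - 1 ≤ pb ≤ a.  Passing to roots,
  -- all powers become natural; M is the a(a-1)-st root of n.
  module RationalApproximation {p τ M : Carrier} (1<p : 1# < p) (0<τ : 0# < τ) (1≤M : 1# ≤ M)
    (k′ B′ c : ℕ)
    (pb≤a : p * fromℕ (suc k′ ℕ.* suc B′) ≤ fromℕ (suc (suc k′ ℕ.* suc B′ ℕ.+ c)))
    (a₁≤pb : fromℕ (suc k′ ℕ.* suc B′ ℕ.+ c) ≤ p * fromℕ (suc k′ ℕ.* suc B′))
    {d : ℕ} (a≡ : suc (suc k′ ℕ.* suc B′ ℕ.+ c) ≡ suc (suc k′) ℕ.* suc B′ ℕ.+ d)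
    {n : ℕ} (M^≈n : M ^ (suc (suc k′ ℕ.* suc B′ ℕ.+ c) ℕ.* (suc k′ ℕ.* suc B′ ℕ.+ c)) ≈ fromℕ n)
    (n²<τB : fromℕ n * fromℕ n < τ * fromℕ (suc B′)) where

    k B b a₁ a : ℕ
    k  = suc k′
    B  = suc B′
    b  = k ℕ.* B
    a₁ = b ℕ.+ c
    a  = suc a₁

    open ≤-Reasoning

    -- In terms of n, q is n^(b/(a a₁)) and μ is n^(b/a). Thus μ = q^a₁ lies below n^(1/p) and q^a =
    -- n^(b/a₁) above it, and the two differ only by the factor q.
    ν μ q exponent : Carrier
    ν = fromℕ n
    q = M ^ b
    μ = q ^ a₁
    exponent = fromℕ 2 - fromℕ 2 * p ⁻¹

    0<p : 0# < p
    0<p = <.trans 0<1 1<p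

    1≤ν : 1# ≤ ν
    1≤ν = ≤-trans (1≤^ (a ℕ.* a₁) 1≤M) (≤-reflexive M^≈n)

    0<ν : 0# < ν
    0<ν = <-≤-trans 0<1 1≤ν

    1≤q : 1# ≤ q
    1≤q = 1≤^ b 1≤M

    0<q : 0# < q
    0<q = <-≤-trans 0<1 1≤q

    0≤μ : 0# ≤ μ
    0≤μ = ^-nonneg a₁ (<⇒≤ 0<q)

    μ≤ν : μ ≤ ν
    μ≤ν = begin
      (M ^ b) ^ a₁  ≈⟨ ^-assocʳ M b a₁ ⟩
      M ^ (b ℕ.* a₁)  ≤⟨ ^-monoʳ-≤ 1≤M (ℕ.*-monoˡ-≤ a₁ (ℕ.≤-trans (ℕ.m≤m+n b c) (ℕ.n≤1+n a₁))) ⟩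
      M ^ (a ℕ.* a₁)  ≈⟨ M^≈n ⟩
      ν  ∎

    -- Otherwise Bernoulli makes (q²)^a₁ exceed a₁ τ ≥ B τ, whereas it equals μ² ≤ n² < τ B. This is
    -- why B is chosen large in terms of n.
    q²≤1+τ : q * q ≤ 1# + τ
    q²≤1+τ = ≮⇒≥ λ 1+τ<q² → <.irrefl refl (begin-strict
      ν * ν  <⟨ n²<τB ⟩
      τ * fromℕ B
        ≤⟨ *-monoˡ-≤ (<⇒≤ 0<τ) (fromℕ-mono-≤ {B} {a₁} (ℕ.≤-trans (ℕ.m≤m+n B (k′ ℕ.* B)) (ℕ.m≤m+n b c))) ⟩
      τ * fromℕ a₁  ≤⟨ ≤-cert (solve 2 (λ t a → :1 :+ a :* t := t :* a :+ :1) refl τ (fromℕ a₁)) 0≤1 ⟩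
      1# + fromℕ a₁ * τ  ≤⟨ bernoulli a₁ (<⇒≤ 0<τ) ⟩
      (1# + τ) ^ a₁  ≤⟨ ^-mono-≤ a₁ (+-nonneg 0≤1 (<⇒≤ 0<τ)) (<⇒≤ 1+τ<q²) ⟩
      (q * q) ^ a₁  ≈⟨ ^-distrib-* q q a₁ ⟩
      μ * μ  ≤⟨ *-mono-≤ 0≤μ μ≤ν 0≤μ μ≤ν ⟩
      ν * ν  ∎)

    Q t : Carrier
    Q = (q * q) ^ a
    t = ν * ν * Q ⁻¹

    0<Q : 0# < Q
    0<Q = ^-pos a (*-pos 0<q 0<q)

    tQ≈ν² : t * Q ≈ ν * ν
    tQ≈ν² = trans (*-assoc _ _ _) (trans (*-congˡ (⁻¹-inverseˡ (pos⇒≉0 0<Q))) (*-identityʳ _))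

    Q^a₁≈ : Q ^ a₁ ≈ ν ^ b * ν ^ b
    Q^a₁≈ = begin-equality
      ((q * q) ^ a) ^ a₁  ≈⟨ ^-assocʳ (q * q) a a₁ ⟩
      (q * q) ^ (a ℕ.* a₁)  ≈⟨ ^-distrib-* q q (a ℕ.* a₁) ⟩
      q ^ (a ℕ.* a₁) * q ^ (a ℕ.* a₁)  ≈⟨ *-cong q^≈ q^≈ ⟩
      ν ^ b * ν ^ b  ∎
      where
      q^≈ : q ^ (a ℕ.* a₁) ≈ ν ^ b
      q^≈ = trans (^-assocʳ M b (a ℕ.* a₁)) (trans (^-congʳ M (ℕ.*-comm b (a ℕ.* a₁)))
        (trans (sym (^-assocʳ M (a ℕ.* a₁) b)) (^-congˡ b M^≈n)))

    -- Since a₁ = b + c, t = n²/n^(2b/a₁) is n^(2c/a₁). The exponent 2c/a₁ = 2 - 2b/a₁ is at most 2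
    -- - 2/p because a₁ ≤ p b.
    t∈ : LowerPower ν exponent t
    t∈ = c ℕ.+ c , a₁ , s≤s z≤n , exponents , *-nonneg (*-nonneg (<⇒≤ 0<ν) (<⇒≤ 0<ν)) (<⇒≤ (⁻¹-pos 0<Q)) ,
      *-cancelˡ-≤ (*-pos (^-pos b 0<ν) (^-pos b 0<ν)) (≤-reflexive power)
      where
      power : ν ^ b * ν ^ b * t ^ a₁ ≈ ν ^ b * ν ^ b * ν ^ (c ℕ.+ c)
      power = trans (*-congʳ (sym Q^a₁≈)) (trans (*-comm _ _) (trans (sym (^-distrib-* t Q a₁)) (trans (^-congˡ a₁ tQ≈ν²)
        (trans (^-distrib-* ν ν a₁) (trans (*-cong (^-homo-* ν b c) (^-homo-* ν b c))
        (trans (solve 2 (λ b c → (b :* c) :* (b :* c) := b :* b :* (c :* c)) refl (ν ^ b) (ν ^ c))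
          (*-congˡ (sym (^-homo-* ν c c)))))))))

      p⁻¹a₁≤b : p ⁻¹ * fromℕ a₁ ≤ fromℕ b
      p⁻¹a₁≤b = ≤-trans (*-monoˡ-≤ (<⇒≤ (⁻¹-pos 0<p)) a₁≤pb) (≤-reflexive
        (trans (sym (*-assoc _ _ _)) (trans (*-congʳ (⁻¹-inverseˡ (pos⇒≉0 0<p))) (*-identityˡ _))))

      exponents : fromℕ (c ℕ.+ c) ≤ exponent * fromℕ a₁
      exponents = begin
        fromℕ (c ℕ.+ c)  ≈⟨ fromℕ-+ c c ⟩
        fromℕ c + fromℕ c  ≤⟨ ≤-cert (solve 3 (λ b c x →
          :2 :* (b :+ c) :- :2 :* x := (c :+ c) :+ :2 :* (b :- x)) refl (fromℕ b) (fromℕ c) (p ⁻¹ * fromℕ a₁))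
          (*-nonneg (fromℕ-nonneg 2) (≤⇒0≤- p⁻¹a₁≤b)) ⟩
        fromℕ 2 * (fromℕ b + fromℕ c) - fromℕ 2 * (p ⁻¹ * fromℕ a₁)  ≈⟨ +-congʳ (*-congˡ (fromℕ-+ b c)) ⟨
        fromℕ 2 * fromℕ a₁ - fromℕ 2 * (p ⁻¹ * fromℕ a₁)
          ≈⟨ solve 2 (λ i x → :2 :* x :- :2 :* (i :* x) := (:2 :- :2 :* i) :* x) refl (p ⁻¹) (fromℕ a₁) ⟩
        exponent * fromℕ a₁  ∎

    0≤exponent : 0# ≤ exponent
    0≤exponent = ≤-trans (*-nonneg (fromℕ-nonneg 2) (≤⇒0≤- p⁻¹≤1))
      (≤-reflexive (solve 1 (λ i → :2 :* (:1 :- i) := :2 :- :2 :* i) refl (p ⁻¹)))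
      where
      p⁻¹≤1 : p ⁻¹ ≤ 1#
      p⁻¹≤1 = *-cancelˡ-≤ 0<p (≤-trans (≤-reflexive (*-⁻¹ 0<p)) (≤-trans (<⇒≤ 1<p) (≤-reflexive (sym (*-identityʳ p)))))

    n²≤ : ν * ν ≤ (1# + τ) * (μ * μ * ν ^ℝ exponent)
    n²≤ = begin
      ν * ν  ≈⟨ tQ≈ν² ⟨
      t * (q * q * (q * q) ^ a₁)  ≈⟨ *-congˡ (*-congˡ (^-distrib-* q q a₁)) ⟩
      t * (q * q * (μ * μ))  ≈⟨ solve 3 (λ t q m → t :* (q :* m) := q :* (m :* t)) refl t (q * q) (μ * μ) ⟩
      q * q * (μ * μ * t)
        ≤⟨ *-mono-≤ (square-nonneg q) q²≤1+τ (*-nonneg (square-nonneg μ) 0≤t) (*-monoˡ-≤ (square-nonneg μ) t≤) ⟩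
      (1# + τ) * (μ * μ * ν ^ℝ exponent) ∎
      where
      0≤t : 0# ≤ t
      0≤t = *-nonneg (*-nonneg (<⇒≤ 0<ν) (<⇒≤ 0<ν)) (<⇒≤ (⁻¹-pos 0<Q))
      t≤ : t ≤ ν ^ℝ exponent
      t≤ = ≤-trans (powFrom1-lower 1≤ν 0≤exponent t∈) (≤-reflexive (reflexive (≡.sym (^ℝ-≥1 exponent 1≤ν))))

    module _ {y ξ : Carrier} (0≤ξ : 0# ≤ ξ) (ξᵇ≈y : ξ ^ b ≈ y) where

      -- Here w is (μ y)^(1/b), so that v is (μ y)^(1/k) and w^a is n y^(a/b).
      w v : Carrier
      w = M ^ a₁ * ξ
      v = w ^ B

      0≤w : 0# ≤ w
      0≤w = *-nonneg (^-nonneg a₁ (≤-trans 0≤1 1≤M)) 0≤ξ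

      0≤v : 0# ≤ v
      0≤v = ^-nonneg B 0≤w

      v^k≈μy : v ^ k ≈ μ * y
      v^k≈μy = trans (^-assocʳ w B k) (trans (^-congʳ w (ℕ.*-comm B k)) (trans (^-distrib-* (M ^ a₁) ξ b)
        (*-cong (trans (^-assocʳ M a₁ b) (trans (^-congʳ M (ℕ.*-comm a₁ b)) (sym (^-assocʳ M b a₁)))) ξᵇ≈y)))

      w^a≤ : y ≤ 1# → w ^ a ≤ ν * y ^ℝ p
      w^a≤ y≤1 = begin
        w ^ a  ≈⟨ ^-distrib-* (M ^ a₁) ξ a ⟩
        (M ^ a₁) ^ a * ξ ^ a  ≈⟨ *-congʳ (trans (^-assocʳ M a₁ a) (trans (^-congʳ M (ℕ.*-comm a₁ a)) M^≈n)) ⟩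
        ν * ξ ^ a  ≤⟨ *-monoˡ-≤ (<⇒≤ 0<ν) (^ℝ-lower a (B′ ℕ.+ k′ ℕ.* B) 0<p 0≤ξ ξᵇ≈y y≤1 pb≤a) ⟩
        ν * y ^ℝ p  ∎

      -- As (k+1) B ≤ a, AM-GM bounds w^((k+1)B) by a convex combination of w^a and 1, each of which
      -- sums to at most n over the vertices.
      v^[1+k]≤ : y ≤ 1# → fromℕ a * v ^ suc k ≤ fromℕ (suc k ℕ.* B) * (ν * y ^ℝ p) + fromℕ d
      v^[1+k]≤ y≤1 = begin
        fromℕ a * v ^ suc k
          ≈⟨ *-cong (reflexive (≡.cong fromℕ a≡)) (trans (^-assocʳ w B (suc k)) (^-congʳ w (ℕ.*-comm B (suc k)))) ⟩
        fromℕ (suc k ℕ.* B ℕ.+ d) * w ^ (suc k ℕ.* B)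
          ≤⟨ young (B′ ℕ.+ b) d 0≤w ⟩
        fromℕ (suc k ℕ.* B) * w ^ (suc k ℕ.* B ℕ.+ d) + fromℕ d
          ≈⟨ +-congʳ (*-congˡ (^-congʳ w (≡.sym a≡))) ⟩
        fromℕ (suc k ℕ.* B) * w ^ a + fromℕ d
          ≤⟨ +-monoˡ-≤ _ (*-monoˡ-≤ (fromℕ-nonneg (suc k ℕ.* B)) (w^a≤ y≤1)) ⟩
        fromℕ (suc k ℕ.* B) * (ν * y ^ℝ p) + fromℕ d
          ∎

    ∑v^[1+k]≤ : ∀ {y ξ : Fin n → Carrier} (0≤ξ : ∀ i → 0# ≤ ξ i) (ξᵇ≈y : ∀ i → ξ i ^ b ≈ y i) → (∀ i → y i ≤ 1#) →
                ∑ (λ i → y i ^ℝ p) ≤ 1# → ∑ (λ i → v (0≤ξ i) (ξᵇ≈y i) ^ suc k) ≤ ν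
    ∑v^[1+k]≤ {y} {ξ} 0≤ξ ξᵇ≈y y≤1 ∑y≤1 = *-cancelˡ-≤ (fromℕ-pos a₁) (begin
      fromℕ a * ∑ (λ i → v (0≤ξ i) (ξᵇ≈y i) ^ suc k)
        ≈⟨ ∑-*ˡ _ _ ⟨
      ∑ (λ i → fromℕ a * v (0≤ξ i) (ξᵇ≈y i) ^ suc k)
        ≤⟨ ∑-mono-≤ (λ i → v^[1+k]≤ (0≤ξ i) (ξᵇ≈y i) (y≤1 i)) ⟩
      ∑ (λ i → C * (ν * y i ^ℝ p) + fromℕ d)
        ≈⟨ trans (∑-distrib-+ _ _) (+-cong (trans (∑-*ˡ C _) (*-congˡ (∑-*ˡ ν _))) (∑-const n _)) ⟩
      C * (ν * ∑ (λ i → y i ^ℝ p)) + ν * fromℕ d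
        ≤⟨ +-monoˡ-≤ _ (*-monoˡ-≤ (fromℕ-nonneg (suc k ℕ.* B)) (*-monoˡ-≤ (<⇒≤ 0<ν) ∑y≤1)) ⟩
      C * (ν * 1#) + ν * fromℕ d
        ≈⟨ solve 3 (λ c v d → c :* (v :* :1) :+ v :* d := (c :+ d) :* v) refl C ν (fromℕ d) ⟩
      (C + fromℕ d) * ν
        ≈⟨ *-congʳ (fromℕ-+ (suc k ℕ.* B) d) ⟨
      fromℕ (suc k ℕ.* B ℕ.+ d) * ν
        ≡⟨ ≡.cong (λ m → fromℕ m * ν) a≡ ⟨
      fromℕ a * ν
        ∎)
      where C = fromℕ (suc k ℕ.* B)

  Rescaled : Carrier → ℕ → Carrier → (n : ℕ) → (Fin n → Carrier) → Set
  Rescaled p k τ n y = ∃[ μ ] Σ (Fin n → Carrier) λ v → (∀ i → 0# ≤ v i) × (∀ i → v i ^ k ≈ μ * y i) ×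
    ∑ (λ i → v i ^ suc k) ≤ fromℕ n ×
    fromℕ n * fromℕ n ≤ (1# + τ) * (μ * μ * fromℕ n ^ℝ (fromℕ 2 - fromℕ 2 * p ⁻¹))

  Rescalable : Carrier → ℕ → Set
  Rescalable p k = ∀ {τ} → 0# < τ → ∀ {n} → 1# ≤ fromℕ n → (y : Fin n → Carrier) → (∀ i → 0# ≤ y i) →
    (∀ i → y i ≤ 1#) → ∑ (λ i → y i ^ℝ p) ≤ 1# → Rescaled p k τ n y

  -- The condition 1 < (p - 1) k gives (k+1)/k ≤ p. It involves p alone, so k is fixed before n and
  -- τ, while B, a and the roots vary with them.
  rescale : ∀ {p} → 1# < p → ∃ (Rescalable p)
  rescale {p} 1<p = choose-k (archimedean-< 1# (<⇒0<- 1<p))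
    where
    open ≤-Reasoning
    0<p : 0# < p
    0<p = <.trans 0<1 1<p

    choose-k : ∃[ k ] (∀ {n} → k ℕ.≤ n → 1# < (p - 1#) * fromℕ n) → ∃ (Rescalable p)
    choose-k (k′ , 1<) = k , λ {τ} 0<τ {n} 1≤n y 0≤y y≤1 ∑y≤1 →
      choose-B 0<τ 1≤n y 0≤y y≤1 ∑y≤1 (archimedean-< (fromℕ n * fromℕ n) 0<τ)
      where
      k = suc k′

      module _ {τ} (0<τ : 0# < τ) {n} (1≤n : 1# ≤ fromℕ n) (y : Fin n → Carrier) (0≤y : ∀ i → 0# ≤ y i)
        (y≤1 : ∀ i → y i ≤ 1#) (∑y≤1 : ∑ (λ i → y i ^ℝ p) ≤ 1#) where

        choose-B : ∃[ B ] (∀ {m} → B ℕ.≤ m → fromℕ n * fromℕ n < τ * fromℕ m) → Rescaled p k τ n y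
        choose-B (B′ , n²<) = choose-A (archimedean (p * fromℕ b))
          where
          B = suc B′
          b = k ℕ.* B

          [1+k]≤pk : fromℕ (suc k) ≤ p * fromℕ k
          [1+k]≤pk = begin
            1# + fromℕ k  ≤⟨ +-monoˡ-≤ _ (<⇒≤ (1< (ℕ.n≤1+n k′))) ⟩
            (p - 1#) * fromℕ k + fromℕ k  ≈⟨ solve 2 (λ p k → (p :- :1) :* k :+ k := p :* k) refl p (fromℕ k) ⟩
            p * fromℕ k  ∎

          choose-a : ∃[ a ] (p * fromℕ b ≤ fromℕ a) × (∀ {j} → p * fromℕ b ≤ fromℕ j → a ℕ.≤ j) → Rescaled p k τ n y
          choose-a (a , pb≤a , minimal) = split a [1+k]B≤a pb≤a minimal
            where
            [1+k]B≤a : suc k ℕ.* B ℕ.≤ a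
            [1+k]B≤a = fromℕ-cancel-≤ {suc k ℕ.* B} {a} (begin
              fromℕ (suc k ℕ.* B)  ≈⟨ fromℕ-* (suc k) B ⟩
              fromℕ (suc k) * fromℕ B  ≤⟨ *-monoʳ-≤ (fromℕ-nonneg B) [1+k]≤pk ⟩
              p * fromℕ k * fromℕ B  ≈⟨ *-assoc _ _ _ ⟩
              p * (fromℕ k * fromℕ B)  ≈⟨ *-congˡ (fromℕ-* k B) ⟨
              p * fromℕ b  ≤⟨ pb≤a ⟩
              fromℕ a  ∎)

            split : ∀ a → suc k ℕ.* B ℕ.≤ a → p * fromℕ b ≤ fromℕ a → (∀ {j} → p * fromℕ b ≤ fromℕ j → a ℕ.≤ j) → Rescaled p k τ n y
            split (suc a₁) [1+k]B≤a pb≤a minimal = conclude (a₁ ℕ.∸ b) (≡.sym (ℕ.m+[n∸m]≡n b≤a₁))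
              where
              b≤a₁ : b ℕ.≤ a₁
              b≤a₁ = ℕ.≤-trans (ℕ.m≤n+m b B′) (ℕ.s≤s⁻¹ [1+k]B≤a)

              a₁≤pb : fromℕ a₁ ≤ p * fromℕ b
              a₁≤pb = ≮⇒≥ λ pb<a₁ → ℕ.1+n≰n (minimal (<⇒≤ pb<a₁))

              conclude : ∀ c → a₁ ≡ b ℕ.+ c → Rescaled p k τ n y
              conclude c ≡.refl = roots (root m (≤-trans 0≤1 1≤n))
                where
                b′ m : ℕ
                b′ = B′ ℕ.+ k′ ℕ.* B
                -- `suc m` unfolds to a · a₁, the degree of the root M of n.
                m = b′ ℕ.+ c ℕ.+ a₁ ℕ.* a₁

                roots : ∃[ M ] 0# ≤ M × M ^ suc m ≈ fromℕ n → Rescaled p k τ n y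
                roots (M , 0≤M , M^≈n) = A.μ , (λ i → A.v (0≤ξ i) (ξᵇ≈y i)) , (λ i → A.0≤v (0≤ξ i) (ξᵇ≈y i)) ,
                  (λ i → A.v^k≈μy (0≤ξ i) (ξᵇ≈y i)) , A.∑v^[1+k]≤ 0≤ξ ξᵇ≈y y≤1 ∑y≤1 , A.n²≤
                  where
                  1≤M : 1# ≤ M
                  1≤M = ^-cancel-≤ m 0≤M (≤-trans (≤-reflexive (1^ (suc m))) (≤-trans 1≤n (≤-reflexive (sym M^≈n))))

                  ξ : Fin n → Carrier
                  ξ i = proj₁ (root b′ (0≤y i))

                  0≤ξ : ∀ i → 0# ≤ ξ i
                  0≤ξ i = proj₁ (proj₂ (root b′ (0≤y i)))

                  ξᵇ≈y : ∀ i → ξ i ^ b ≈ y i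
                  ξᵇ≈y i = proj₂ (proj₂ (root b′ (0≤y i)))

                  module A = RationalApproximation 1<p 0<τ 1≤M k′ B′ c pb≤a a₁≤pb
                    (≡.sym (ℕ.m+[n∸m]≡n [1+k]B≤a)) {n} M^≈n (n²< (ℕ.n≤1+n B′))

          choose-A : ∃[ A ] p * fromℕ b < fromℕ A → Rescaled p k τ n y
          choose-A (A , pb<A) = choose-a (least (λ a → p * fromℕ b ≤ fromℕ a) {A} (<⇒≤ pb<A))

-- Fitting a nearly proper colouring to the classes of the Turán graph.

module Balancing (ℝ : CompleteOrderedField) where

  open CompleteOrderedField ℝ hiding (zero)
  open OrderedField ℝ
  open Sums ℝ
  open Stability ℝ using (degreeSum; monochromatic)

  module Classes (s : ℕ) where

    private r = suc s

    class : ℕ → Fin r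
    class t = t mod r

    toℕ-class : ∀ t → toℕ (class t) ≡ t % r
    toℕ-class t = Fin.toℕ-fromℕ< (m%n<n t r)

    class-+r : ∀ t → class (r ℕ.+ t) ≡ class t
    class-+r t = Fin.toℕ-injective (≡.trans (toℕ-class (r ℕ.+ t)) (≡.trans
      (≡.cong (_% r) (ℕ.+-comm r t)) (≡.trans ([m+n]%n≡m%n t r) (≡.sym (toℕ-class t)))))

    class-toℕ : ∀ (l : Fin r) → class (toℕ l) ≡ l
    class-toℕ l = Fin.toℕ-injective (≡.trans (toℕ-class (toℕ l)) (m<n⇒m%n≡m (Fin.toℕ<n l)))

    classSize : ℕ → Fin r → Carrier
    classSize n l = ∑ {n} λ x → δ (class (toℕ x)) l

    0≤classSize : ∀ n l → 0# ≤ classSize n l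
    0≤classSize n l = ∑-nonneg {n} λ x → 0≤δ (class (toℕ x)) l

    classSize-+r : ∀ n l → classSize (r ℕ.+ n) l ≈ 1# + classSize n l
    classSize-+r n l = trans (∑-↑ r {n} _) (+-cong
      (trans (∑-cong λ i → trans (reflexive (≡.cong (λ t → δ (class t) l) (Fin.toℕ-↑ˡ i n)))
        (trans (reflexive (≡.trans (≡.cong (λ j → δ j l) (class-toℕ i)) (≡.refl {x = δ i l}))) (trans (δ-sym i l) (sym (*-identityʳ _)))))
        (∑-δ l (λ _ → 1#)))
      (∑-cong λ j → reflexive (≡.trans (≡.cong (λ t → δ (class t) l) (Fin.toℕ-↑ʳ r j)) (≡.cong (λ i → δ i l) (class-+r (toℕ j))))))
      where
      δ-sym : ∀ (i j : Fin r) → δ i j ≈ δ j i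
      δ-sym i j with i Fin.≟ j
      ... | yes i≡j = sym (δ-diagonal (≡.sym i≡j))
      ... | no  i≢j = sym (δ-off-diagonal (i≢j ∘ ≡.sym))

    -- Every block of r consecutive vertices meets each class once; the incomplete block costs the
    -- additive r.
    classSize-lower : ∀ n l → fromℕ n ≤ fromℕ r * classSize n l + fromℕ r
    classSize-lower n l = ≡.subst Lower (≡.sym (m≡m%n+[m/n]*n n r)) (by-blocks (n / r))
      where
      open ≤-Reasoning
      Lower : ℕ → Set
      Lower n = fromℕ n ≤ fromℕ r * classSize n l + fromℕ r

      block : ∀ {n} → Lower n → Lower (r ℕ.+ n)
      block {n} n≤ = begin
        fromℕ (r ℕ.+ n)  ≈⟨ fromℕ-+ r n ⟩
        fromℕ r + fromℕ n  ≤⟨ +-monoʳ-≤ _ n≤ ⟩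
        fromℕ r + (fromℕ r * classSize n l + fromℕ r)
          ≈⟨ solve 2 (λ r c → r :+ (r :* c :+ r) := r :* (:1 :+ c) :+ r) refl (fromℕ r) (classSize n l) ⟩
        fromℕ r * (1# + classSize n l) + fromℕ r  ≈⟨ +-congʳ (*-congˡ (classSize-+r n l)) ⟨
        fromℕ r * classSize (r ℕ.+ n) l + fromℕ r  ∎

      by-blocks : ∀ q → Lower (n % r ℕ.+ q ℕ.* r)
      by-blocks zero  = ≡.subst Lower (≡.sym (ℕ.+-identityʳ (n % r)))
        (≤-trans (fromℕ-mono-≤ {n % r} {r} (ℕ.<⇒≤ (m%n<n n r))) (≤-cert (+-comm _ _) (*-nonneg (fromℕ-nonneg r) (0≤classSize (n % r) l))))
      by-blocks (suc q) = ≡.subst Lower shuffle (block {n % r ℕ.+ q ℕ.* r} (by-blocks q))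
        where
        shuffle : r ℕ.+ (n % r ℕ.+ q ℕ.* r) ≡ n % r ℕ.+ (r ℕ.+ q ℕ.* r)
        shuffle = ≡.trans (≡.sym (ℕ.+-assoc r (n % r) _)) (≡.trans (≡.cong (ℕ._+ q ℕ.* r) (ℕ.+-comm r (n % r))) (ℕ.+-assoc (n % r) r _))

    module _ {n : ℕ} (c : Fin n → Fin r) where

      matched : Permutation′ n → Fin n → Carrier
      matched π x = δ (class (toℕ (π ⟨$⟩ʳ x))) (c x)

      mismatched : Permutation′ n → Fin n → Carrier
      mismatched π x = 1# - matched π x

      0≤mismatched : ∀ π x → 0# ≤ mismatched π x
      0≤mismatched π x = ≤⇒0≤- (δ≤1 (class (toℕ (π ⟨$⟩ʳ x))) (c x))

      mismatches : Permutation′ n → Carrier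
      mismatches π = ∑ (mismatched π)

      -- Exchanging the images of i and j matches i and loses nothing at j, which is mismatched
      -- already.
      Swappable : Permutation′ n → Fin n → Fin n → Set
      Swappable π i j = class (toℕ (π ⟨$⟩ʳ j)) ≡ c i × class (toℕ (π ⟨$⟩ʳ i)) ≢ c i × class (toℕ (π ⟨$⟩ʳ j)) ≢ c j

      swap-reduces : ∀ π {i j} → Swappable π i j → mismatches (Perm.transpose i j Perm.∘ₚ π) + 1# ≤ mismatches π
      swap-reduces π {i} {j} (πj≡ci , πi≢ci , πj≢cj) = begin
        mismatches π′ + 1#  ≈⟨ +-congˡ (∑-δ-1 i) ⟨
        mismatches π′ + ∑ (δ i)  ≈⟨ ∑-distrib-+ _ _ ⟨
        ∑ (λ x → mismatched π′ x + δ i x)  ≤⟨ ∑-mono-≤ pointwise ⟩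
        mismatches π  ∎
        where
        open ≤-Reasoning
        π′ : Permutation′ n
        π′ = Perm.transpose i j Perm.∘ₚ π

        pointwise : ∀ x → mismatched π′ x + δ i x ≤ mismatched π x
        pointwise x with x Fin.≟ i
        ... | yes ≡.refl = ≤-reflexive (trans (+-cong (+-congˡ (-‿cong (δ-diagonal πj≡ci))) (δ-diagonal {i = i} ≡.refl))
          (trans (solve 0 (:1 :- :1 :+ :1 := :1 :- :0) refl) (+-congˡ (-‿cong (sym (δ-off-diagonal πi≢ci))))))
        ... | no x≢i with x Fin.≟ j
        ...  | yes ≡.refl = ≤-trans (≤-reflexive (trans (+-congˡ (δ-off-diagonal (x≢i ∘ ≡.sym))) (+-identityʳ _)))
          (≤-trans (≤-cert (solve 1 (λ d → :1 :- :0 := :1 :- d :+ d) refl _) (0≤δ (class (toℕ (π ⟨$⟩ʳ i))) (c x)))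
            (≤-reflexive (+-congˡ (-‿cong (sym (δ-off-diagonal πj≢cj))))))
        ...  | no x≢j = ≤-reflexive (trans (+-congˡ (δ-off-diagonal (x≢i ∘ ≡.sym))) (+-identityʳ _))

      -- Mismatches are real sums, so π is taken with the least natural upper bound on them; a swap
      -- would lower that bound by 1.
      optimal : ∃[ π ] (∀ i j → ¬ Swappable π i j)
      optimal = minimise (archimedean (mismatches Perm.id))
        where
        Bounded : ℕ → Set
        Bounded k = ∃[ π ] mismatches π ≤ fromℕ k

        improve : ∀ π k → mismatches π ≤ fromℕ k → (∀ {k′} → Bounded k′ → k ℕ.≤ k′) → ∀ i j → ¬ Swappable π i j
        improve π zero  M≤0 _ i j swappable = ≤⇒≯ (≤-trans (swap-reduces π swappable) M≤0)
          (≤-<-trans (∑-nonneg (0≤mismatched (Perm.transpose i j Perm.∘ₚ π))) (<-cert refl 0<1))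
        improve π (suc k) M≤ minimal i j swappable = ℕ.1+n≰n (minimal (Perm.transpose i j Perm.∘ₚ π ,
          ≤-trans (≤-reflexive (solve 1 (λ m → m := m :+ :1 :- :1) refl _))
            (≤-trans (+-monoˡ-≤ (- 1#) (≤-trans (swap-reduces π swappable) M≤))
              (≤-reflexive (solve 1 (λ k → :1 :+ k :- :1 := k) refl (fromℕ k))))))

        minimise : ∃[ k ] mismatches Perm.id < fromℕ k → ∃[ π ] (∀ i j → ¬ Swappable π i j)
        minimise (k , M<k) = conclude (least Bounded {k} (Perm.id , <⇒≤ M<k))
          where
          conclude : ∃[ m ] Bounded m × (∀ {k} → Bounded k → m ℕ.≤ k) → ∃[ π ] (∀ i j → ¬ Swappable π i j)
          conclude (m , (π , M≤) , minimal) = π , improve π m M≤ minimal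

      colourSize : Fin r → Carrier
      colourSize l = ∑ λ x → δ (c x) l

      mismatchedIn : Permutation′ n → Fin r → Carrier
      mismatchedIn π l = ∑ λ x → δ (c x) l * mismatched π x

      ∑mismatchedIn : ∀ π → ∑ (mismatchedIn π) ≈ mismatches π
      ∑mismatchedIn π = trans (∑-comm _) (∑-cong λ x → ∑-δ (c x) (λ _ → mismatched π x))

      -- Once a vertex of colour l is mismatched, optimality forces every place of class l to hold a
      -- vertex of colour l. Exactly the surplus of that colour is then mismatched.
      mismatchedIn-≤ : ∀ π → (∀ i j → ¬ Swappable π i j) → ∀ l →
                       mismatchedIn π l ≤ 0# ⊎ mismatchedIn π l ≤ colourSize l - classSize n l
      mismatchedIn-≤ π unswappable l = cases (Fin.any? λ i → (c i Fin.≟ l) ×-dec ¬? (class (toℕ (π ⟨$⟩ʳ i)) Fin.≟ c i))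
        where
        cls : Fin n → Fin r
        cls x = class (toℕ (π ⟨$⟩ʳ x))

        all-matched : ¬ (∃[ i ] c i ≡ l × cls i ≢ c i) → ∀ x → δ (c x) l * mismatched π x ≤ 0#
        all-matched none x with c x Fin.≟ l
        ... | no _  = ≤-reflexive (zeroˡ _)
        ... | yes cx≡l with cls x Fin.≟ c x
        ...  | yes _  = ≤-reflexive (solve 0 (:1 :* (:1 :- :1) := :0) refl)
        ...  | no  πx≢cx = contradiction (x , cx≡l , πx≢cx) none

        all-used : ∀ {i} → c i ≡ l → cls i ≢ c i → ∀ x → δ (c x) l * mismatched π x ≤ δ (c x) l - δ (cls x) l
        all-used {i} ci≡l πi≢ci x with cls x Fin.≟ l
        ... | no _ = ≤-trans (*-monoˡ-≤ (0≤δ (c x) l) (≤-cert (solve 1 (λ d → :1 := :1 :- d :+ d) refl _) (0≤δ (cls x) (c x))))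
          (≤-reflexive (solve 1 (λ d → d :* :1 := d :- :0) refl (δ (c x) l)))
        ... | yes πx≡l with cls x Fin.≟ c x
        ...  | no  πx≢cx = contradiction (≡.trans πx≡l (≡.sym ci≡l) , πi≢ci , πx≢cx) (unswappable i x)
        ...  | yes πx≡cx = ≤-reflexive (trans (solve 1 (λ d → d :* (:1 :- :1) := :1 :- :1) refl (δ (c x) l))
          (+-congʳ (sym (δ-diagonal (≡.trans (≡.sym πx≡cx) πx≡l)))))

        cases : Dec (∃[ i ] c i ≡ l × cls i ≢ c i) → mismatchedIn π l ≤ 0# ⊎ mismatchedIn π l ≤ colourSize l - classSize n l
        cases (no none) = inj₁ (≤-trans (∑-mono-≤ (all-matched none)) (≤-reflexive (trans (∑-const n 0#) (zeroʳ _))))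
        cases (yes (i , ci≡l , πi≢ci)) = inj₂ (≤-trans (∑-mono-≤ (all-used ci≡l πi≢ci))
          (≤-reflexive (trans (∑-distrib-- _ _) (+-congˡ (-‿cong (sym (∑-permute (λ x → δ (class (toℕ x)) l) π)))))))

      ∑colourSize : ∑ colourSize ≈ fromℕ n
      ∑colourSize = trans (∑-comm _) (trans (∑-cong λ x → ∑-δ-1 (c x)) (trans (∑-const n 1#) (*-identityʳ _)))

      sameColour : Carrier
      sameColour = ∑ λ x → ∑ λ y → δ (c x) (c y)

      ∑colourSize² : ∑ (λ l → colourSize l * colourSize l) ≈ sameColour
      ∑colourSize² = begin
        ∑ (λ l → colourSize l * colourSize l)
          ≈⟨ ∑-cong (λ l → ∑∑-* (λ x → δ (c x) l) (λ y → δ (c y) l)) ⟨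
        ∑ (λ l → ∑ λ x → ∑ λ y → δ (c x) l * δ (c y) l)
          ≈⟨ trans (∑-comm _) (∑-cong λ x → ∑-comm _) ⟩
        ∑ (λ x → ∑ λ y → ∑ λ l → δ (c x) l * δ (c y) l)
          ≈⟨ ∑-cong (λ x → ∑-cong λ y → ∑-δ (c x) (δ (c y))) ⟩
        ∑ (λ x → ∑ λ y → δ (c y) (c x))
          ≈⟨ ∑-comm _ ⟩
        sameColour
          ∎
        where open ≈

      deviation : Fin r → Carrier
      deviation l = colourSize l - fromℕ r ⁻¹ * fromℕ n

      -- The variance of the colour classes: it is small as soon as the number of equally coloured
      -- pairs is close to its minimum n²/r.
      ∑deviation² : ∑ (λ l → deviation l * deviation l) ≈ sameColour - fromℕ r ⁻¹ * (fromℕ n * fromℕ n)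
      ∑deviation² = begin
        ∑ (λ l → deviation l * deviation l)
          ≈⟨ ∑-cong (λ l → solve 3 (λ z i n → (z :- i :* n) :* (z :- i :* n) := z :* z :+ (i :* n :* (i :* n) :- :2 :* i :* n :* z)) refl (colourSize l) ι ν) ⟩
        ∑ (λ l → colourSize l * colourSize l + (ι * ν * (ι * ν) - fromℕ 2 * ι * ν * colourSize l))
          ≈⟨ trans (∑-distrib-+ _ _) (+-cong ∑colourSize² (trans (∑-distrib-- _ _)
               (+-cong (∑-const r _) (-‿cong (trans (∑-*ˡ _ _) (*-congˡ ∑colourSize)))))) ⟩
        sameColour + (fromℕ r * (ι * ν * (ι * ν)) - fromℕ 2 * ι * ν * ν)
          ≈⟨ +-congˡ (+-congʳ (trans (solve 3 (λ r i n → r :* (i :* n :* (i :* n)) := r :* i :* (i :* (n :* n))) refl (fromℕ r) ι ν)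
               (trans (*-congʳ (*-⁻¹ (fromℕ-pos s))) (*-identityˡ _)))) ⟩
        sameColour + (ι * (ν * ν) - fromℕ 2 * ι * ν * ν)
          ≈⟨ solve 3 (λ c i n → c :+ (i :* (n :* n) :- :2 :* i :* n :* n) := c :- i :* (n :* n)) refl sameColour ι ν ⟩
        sameColour - ι * (ν * ν)
          ∎
        where
        open ≈
        ι = fromℕ r ⁻¹
        ν = fromℕ n

      -- The inequality 2nz ≤ z²/θ + θn² leaves only ∑ z² to be bounded, which density controls. The
      -- term 2n stems from rounding n/r down.
      mismatchedIn-bound : ∀ π → (∀ i j → ¬ Swappable π i j) → ∀ {θ} → 0# < θ → ∀ l →
        fromℕ 2 * fromℕ n * mismatchedIn π l ≤ θ ⁻¹ * (deviation l * deviation l) + (θ * (fromℕ n * fromℕ n) + fromℕ 2 * fromℕ n)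
      mismatchedIn-bound π unswappable {θ} 0<θ l = cases (mismatchedIn-≤ π unswappable l)
        where
        open ≤-Reasoning
        ι = fromℕ r ⁻¹
        ν = fromℕ n
        z = deviation l
        0≤θ⁻¹ : 0# ≤ θ ⁻¹
        0≤θ⁻¹ = <⇒≤ (⁻¹-pos 0<θ)

        size-difference : colourSize l - classSize n l ≤ z + 1#
        size-difference = ≤-cert
          (solve 4 (λ k m i n → k :- i :* n :+ :1 := k :- m :+ (m :+ :1 :- i :* n)) refl (colourSize l) (classSize n l) ι ν)
          (≤⇒0≤- (begin
            ι * ν  ≤⟨ *-monoˡ-≤ (<⇒≤ (⁻¹-pos (fromℕ-pos s))) (classSize-lower n l) ⟩
            ι * (fromℕ r * classSize n l + fromℕ r)
              ≈⟨ solve 3 (λ i r m → i :* (r :* m :+ r) := r :* i :* (m :+ :1)) refl ι (fromℕ r) (classSize n l) ⟩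
            fromℕ r * ι * (classSize n l + 1#)  ≈⟨ trans (*-congʳ (*-⁻¹ (fromℕ-pos s))) (*-identityˡ _) ⟩
            classSize n l + 1#  ∎))

        0≤2ν : 0# ≤ fromℕ 2 * ν
        0≤2ν = *-nonneg (fromℕ-nonneg 2) (fromℕ-nonneg n)

        2νz≤ : fromℕ 2 * ν * z ≤ θ ⁻¹ * (z * z) + θ * (ν * ν)
        2νz≤ = ≤-cert
          (begin-equality
            θ ⁻¹ * (z * z) + θ * (ν * ν)
              ≈⟨ solve 4 (λ i t z n → i :* (z :* z) :+ t :* (n :* n) := :1 :* (:2 :* n :* z) :+ (i :* (z :* z) :- :1 :* (:2 :* n :* z) :+ :1 :* t :* (n :* n))) refl (θ ⁻¹) θ z ν ⟩
            1# * (fromℕ 2 * ν * z) + (θ ⁻¹ * (z * z) - 1# * (fromℕ 2 * ν * z) + 1# * θ * (ν * ν))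
              ≈⟨ +-cong (sym (*-identityˡ _)) (+-cong (+-congˡ (-‿cong (*-congʳ θ⁻¹θ≈1))) (*-congʳ (*-congʳ θ⁻¹θ≈1))) ⟨
            fromℕ 2 * ν * z + (θ ⁻¹ * (z * z) - θ ⁻¹ * θ * (fromℕ 2 * ν * z) + θ ⁻¹ * θ * θ * (ν * ν))
              ≈⟨ +-congˡ (solve 4 (λ i t z n → i :* (z :* z) :- i :* t :* (:2 :* n :* z) :+ i :* t :* t :* (n :* n) := i :* ((z :- t :* n) :* (z :- t :* n))) refl (θ ⁻¹) θ z ν) ⟩
            fromℕ 2 * ν * z + θ ⁻¹ * ((z - θ * ν) * (z - θ * ν))
              ∎)
          (*-nonneg 0≤θ⁻¹ (square-nonneg (z - θ * ν)))
          where
          θ⁻¹θ≈1 : θ ⁻¹ * θ ≈ 1#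
          θ⁻¹θ≈1 = ⁻¹-inverseˡ (pos⇒≉0 0<θ)

        cases : mismatchedIn π l ≤ 0# ⊎ mismatchedIn π l ≤ colourSize l - classSize n l →
          fromℕ 2 * ν * mismatchedIn π l ≤ θ ⁻¹ * (z * z) + (θ * (ν * ν) + fromℕ 2 * ν)
        cases (inj₁ E≤0) = begin
          fromℕ 2 * ν * mismatchedIn π l  ≤⟨ *-monoˡ-≤ 0≤2ν E≤0 ⟩
          fromℕ 2 * ν * 0#  ≈⟨ zeroʳ _ ⟩
          0#
            ≤⟨ +-nonneg (*-nonneg 0≤θ⁻¹ (square-nonneg z)) (+-nonneg (*-nonneg (<⇒≤ 0<θ) (square-nonneg ν)) 0≤2ν) ⟩
          θ ⁻¹ * (z * z) + (θ * (ν * ν) + fromℕ 2 * ν) ∎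
        cases (inj₂ E≤) = begin
          fromℕ 2 * ν * mismatchedIn π l  ≤⟨ *-monoˡ-≤ 0≤2ν (≤-trans E≤ size-difference) ⟩
          fromℕ 2 * ν * (z + 1#)  ≈⟨ solve 2 (λ n z → n :* (z :+ :1) := n :* z :+ n) refl (fromℕ 2 * ν) z ⟩
          fromℕ 2 * ν * z + fromℕ 2 * ν  ≤⟨ +-monoˡ-≤ _ 2νz≤ ⟩
          θ ⁻¹ * (z * z) + θ * (ν * ν) + fromℕ 2 * ν ≈⟨ +-assoc _ _ _ ⟩
          θ ⁻¹ * (z * z) + (θ * (ν * ν) + fromℕ 2 * ν) ∎

      turánAdj : Fin n → Fin n → Bool
      turánAdj i j = does (Graph.adj? (turán r n) i j)

      𝟙-turánAdj : ∀ i j → 𝟙 (turánAdj i j) ≈ 1# - δ (class (toℕ i)) (class (toℕ j))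
      𝟙-turánAdj i j with class (toℕ i) Fin.≟ class (toℕ j)
      ... | yes i~j = trans (reflexive (≡.cong 𝟙 (dec-false (Graph.adj? (turán r n) i j) λ i≁j →
        i≁j (≡.trans (≡.sym (toℕ-class (toℕ i))) (≡.trans (≡.cong toℕ i~j) (toℕ-class (toℕ j)))))))
        (sym (-‿inverseʳ 1#))
      ... | no  i≁j = trans (reflexive (≡.cong 𝟙 (dec-true (Graph.adj? (turán r n) i j) λ i~j →
        i≁j (Fin.toℕ-injective (≡.trans (toℕ-class (toℕ i)) (≡.trans i~j (≡.sym (toℕ-class (toℕ j)))))))))
        (solve 0 (:1 := :1 :- :0) refl)

      module _ (adj : Fin n → Fin n → Bool) where

        editSum : Permutation′ n → Carrier
        editSum π = ∑ λ x → ∑ λ y → 𝟙 (adj x y xor turánAdj (π ⟨$⟩ʳ x) (π ⟨$⟩ʳ y))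

        -- The indicator that `adj` differs at (x, y) from the complete multipartite graph of c,
        -- written so that its sum involves only `monochromatic`, `sameColour` and `degreeSum`.
        wrong : Fin n → Fin n → Carrier
        wrong x y = fromℕ 2 * (δ (c x) (c y) * 𝟙 (adj x y)) + (1# - δ (c x) (c y) - 𝟙 (adj x y))

        wrong-edge : ∀ d → fromℕ 2 * (d * 1#) + (1# - d - 1#) ≈ d
        wrong-edge = solve 1 (λ d → :2 :* (d :* :1) :+ (:1 :- d :- :1) := d) refl

        wrong-nonedge : ∀ d → fromℕ 2 * (d * 0#) + (1# - d - 0#) ≈ 1# - d
        wrong-nonedge = solve 1 (λ d → :2 :* (d :* :0) :+ (:1 :- d :- :0) := :1 :- d) refl

        0≤wrong : ∀ x y → 0# ≤ wrong x y
        0≤wrong x y with adj x y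
        ... | true  = ≤-trans (0≤δ (c x) (c y)) (≤-reflexive (sym (wrong-edge _)))
        ... | false = ≤-trans (≤⇒0≤- (δ≤1 (c x) (c y))) (≤-reflexive (sym (wrong-nonedge _)))

        xor≤wrong : ∀ x y b → 𝟙 b ≈ 1# - δ (c x) (c y) → 𝟙 (adj x y xor b) ≤ wrong x y
        xor≤wrong x y b b≈ with adj x y
        ... | true  = ≤-reflexive (trans (𝟙-not b) (trans (+-congˡ (-‿cong b≈))
          (trans (solve 1 (λ d → :1 :- (:1 :- d) := d) refl (δ (c x) (c y))) (sym (wrong-edge _)))))
          where
          𝟙-not : ∀ b → 𝟙 (not b) ≈ 1# - 𝟙 b
          𝟙-not true  = sym (-‿inverseʳ 1#)
          𝟙-not false = solve 0 (:1 := :1 :- :0) refl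
        ... | false = ≤-reflexive (trans b≈ (sym (wrong-nonedge _)))

        -- Where both ends are matched, the permuted Turán graph coincides with the multipartite
        -- graph of c; any other pair is charged to a mismatched end.
        edit-≤ : ∀ π x y → 𝟙 (adj x y xor turánAdj (π ⟨$⟩ʳ x) (π ⟨$⟩ʳ y)) ≤ mismatched π x + mismatched π y + wrong x y
        edit-≤ π x y with class (toℕ (π ⟨$⟩ʳ x)) Fin.≟ c x | class (toℕ (π ⟨$⟩ʳ y)) Fin.≟ c y
        ... | no _ | py = ≤-trans (𝟙≤1 (adj x y xor turánAdj (π ⟨$⟩ʳ x) (π ⟨$⟩ʳ y))) (≤-cert (solve 2 (λ b w → :1 :- :0 :+ b :+ w := :1 :+ (b :+ w)) refl _ (wrong x y))
          (+-nonneg (≤⇒0≤- (𝟙≤1 (does py))) (0≤wrong x y)))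
        ... | yes _ | no _ = ≤-trans (𝟙≤1 (adj x y xor turánAdj (π ⟨$⟩ʳ x) (π ⟨$⟩ʳ y))) (≤-cert (solve 1 (λ w → :1 :- :1 :+ (:1 :- :0) :+ w := :1 :+ w) refl (wrong x y)) (0≤wrong x y))
        ... | yes πx≡cx | yes πy≡cy = ≤-trans
          (xor≤wrong x y _ (trans (𝟙-turánAdj (π ⟨$⟩ʳ x) (π ⟨$⟩ʳ y)) (+-congˡ (-‿cong (reflexive (≡.cong₂ δ πx≡cx πy≡cy))))))
          (≤-reflexive (solve 1 (λ w → w := :1 :- :1 :+ (:1 :- :1) :+ w) refl (wrong x y)))

        editSum-≤ : ∀ π → editSum π ≤ fromℕ 2 * fromℕ n * mismatches π +
                    (fromℕ 2 * monochromatic adj c + (fromℕ n * fromℕ n - sameColour - degreeSum adj))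
        editSum-≤ π = begin
          editSum π
            ≤⟨ ∑-mono-≤ (λ x → ∑-mono-≤ λ y → edit-≤ π x y) ⟩
          ∑ (λ x → ∑ λ y → mismatched π x + mismatched π y + wrong x y)
            ≈⟨ trans (∑-cong λ x → ∑-distrib-+ _ _) (∑-distrib-+ _ _) ⟩
          ∑ (λ x → ∑ λ y → mismatched π x + mismatched π y) + ∑ (λ x → ∑ λ y → wrong x y)
            ≈⟨ +-cong mismatches≈ wrong≈ ⟩
          fromℕ 2 * fromℕ n * mismatches π + (fromℕ 2 * monochromatic adj c + (fromℕ n * fromℕ n - sameColour - degreeSum adj))
            ∎
          where
          open ≤-Reasoning
          mismatches≈ : ∑ (λ x → ∑ λ y → mismatched π x + mismatched π y) ≈ fromℕ 2 * fromℕ n * mismatches π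
          mismatches≈ = trans (∑-cong λ x → trans (∑-distrib-+ _ _) (+-congʳ (∑-const n _)))
            (trans (∑-distrib-+ _ _) (trans (+-cong (∑-*ˡ _ _) (∑-const n _))
              (solve 2 (λ n m → n :* m :+ n :* m := :2 :* n :* m) refl (fromℕ n) (mismatches π))))
          n²≈ : ∑ {n} (λ _ → ∑ {n} λ _ → 1#) ≈ fromℕ n * fromℕ n
          n²≈ = trans (∑-const n _) (*-congˡ (trans (∑-const n 1#) (*-identityʳ _)))
          wrong≈ : ∑ (λ x → ∑ λ y → wrong x y) ≈ fromℕ 2 * monochromatic adj c + (fromℕ n * fromℕ n - sameColour - degreeSum adj)
          wrong≈ = trans (∑-cong λ x → trans (∑-distrib-+ _ _) (+-cong (∑-*ˡ _ _)
              (trans (∑-distrib-- _ _) (+-congʳ (∑-distrib-- _ _)))))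
            (trans (∑-distrib-+ _ _) (+-cong (∑-*ˡ _ _) (trans (∑-distrib-- _ _)
              (+-congʳ (trans (∑-distrib-- _ _) (+-congʳ n²≈))))))

        -- Read as an upper bound on `sameColour`, this turns density into small variance of the
        -- colour classes.
        degreeSum-≤ : degreeSum adj ≤ fromℕ n * fromℕ n - sameColour + monochromatic adj c
        degreeSum-≤ = begin
          degreeSum adj
            ≤⟨ ∑-mono-≤ (λ x → ∑-mono-≤ λ y → pointwise x y) ⟩
          ∑ (λ x → ∑ λ y → 1# - δ (c x) (c y) + δ (c x) (c y) * 𝟙 (adj x y))
            ≈⟨ trans (∑-cong λ x → trans (∑-distrib-+ _ _) (+-congʳ (trans (∑-distrib-- _ _) (+-congʳ (∑-const n 1#)))))
                 (trans (∑-distrib-+ _ _) (+-congʳ (trans (∑-distrib-- _ _) (+-congʳ (trans (∑-const n _) (*-congˡ (*-identityʳ _))))))) ⟩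
          fromℕ n * fromℕ n - sameColour + monochromatic adj c
            ∎
          where
          open ≤-Reasoning
          pointwise : ∀ x y → 𝟙 (adj x y) ≤ 1# - δ (c x) (c y) + δ (c x) (c y) * 𝟙 (adj x y)
          pointwise x y with adj x y
          ... | true  = ≤-reflexive (solve 1 (λ d → :1 := :1 :- d :+ d :* :1) refl (δ (c x) (c y)))
          ... | false = ≤-trans (≤⇒0≤- (δ≤1 (c x) (c y))) (≤-reflexive (solve 1 (λ d → :1 :- d := :1 :- d :+ d :* :0) refl (δ (c x) (c y))))

        editSum-bound : ∀ {h θ} → 0# < θ → (1# - fromℕ r ⁻¹ - h) * (fromℕ n * fromℕ n) ≤ degreeSum adj →
          monochromatic adj c ≤ h * (fromℕ n * fromℕ n) → ∀ π → (∀ i j → ¬ Swappable π i j) →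
          editSum π ≤ ((fromℕ 2 * θ ⁻¹ + fromℕ 3) * h + fromℕ r * θ) * (fromℕ n * fromℕ n) + fromℕ 2 * fromℕ r * fromℕ n
        editSum-bound {h} {θ} 0<θ dense mono≤ π unswappable = begin
          editSum π
            ≤⟨ editSum-≤ π ⟩
          fromℕ 2 * ν * mismatches π + (fromℕ 2 * monochromatic adj c + (ν * ν - sameColour - degreeSum adj))
            ≤⟨ +-mono-≤ 2νM≤ rest≤ ⟩
          θ ⁻¹ * (fromℕ 2 * h * (ν * ν)) + fromℕ r * (θ * (ν * ν) + fromℕ 2 * ν) + fromℕ 3 * h * (ν * ν)
            ≈⟨ solve 5 (λ i h n r t → i :* (:2 :* h :* (n :* n)) :+ r :* (t :* (n :* n) :+ :2 :* n) :+ con (+ 3) :* h :* (n :* n) :=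
                 ((:2 :* i :+ con (+ 3)) :* h :+ r :* t) :* (n :* n) :+ :2 :* r :* n) refl (θ ⁻¹) h ν (fromℕ r) θ ⟩
          ((fromℕ 2 * θ ⁻¹ + fromℕ 3) * h + fromℕ r * θ) * (ν * ν) + fromℕ 2 * fromℕ r * ν
            ∎
          where
          open ≤-Reasoning
          ν = fromℕ n
          ι = fromℕ r ⁻¹
          V = ∑ λ l → deviation l * deviation l

          V≤ : V ≤ fromℕ 2 * h * (ν * ν)
          V≤ = ≤-trans (≤-reflexive ∑deviation²) (≤-cert
            (solve 6 (λ q h i s a m → :2 :* h :* q := s :- i :* q :+ ((q :- s :+ m :- a) :+ ((h :* q :- m) :+ (a :- (:1 :- i :- h) :* q))))
              refl (ν * ν) h ι sameColour (degreeSum adj) (monochromatic adj c))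
            (+-nonneg (≤⇒0≤- degreeSum-≤) (+-nonneg (≤⇒0≤- mono≤) (≤⇒0≤- dense))))

          ιn²≤ : ι * (ν * ν) ≤ sameColour
          ιn²≤ = ≤-cert (trans (solve 2 (λ s x → s := x :+ (s :- x)) refl sameColour (ι * (ν * ν))) (+-congˡ (sym ∑deviation²)))
            (∑-nonneg λ l → square-nonneg (deviation l))

          rest≤ : fromℕ 2 * monochromatic adj c + (ν * ν - sameColour - degreeSum adj) ≤ fromℕ 3 * h * (ν * ν)
          rest≤ = ≤-cert
            (solve 6 (λ q h i s a m → con (+ 3) :* h :* q := :2 :* m :+ (q :- s :- a) :+
               (:2 :* (h :* q :- m) :+ ((s :- i :* q) :+ (a :- (:1 :- i :- h) :* q))))
              refl (ν * ν) h ι sameColour (degreeSum adj) (monochromatic adj c))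
            (+-nonneg (*-nonneg (fromℕ-nonneg 2) (≤⇒0≤- mono≤)) (+-nonneg (≤⇒0≤- ιn²≤) (≤⇒0≤- dense)))

          2νM≤ : fromℕ 2 * ν * mismatches π ≤ θ ⁻¹ * (fromℕ 2 * h * (ν * ν)) + fromℕ r * (θ * (ν * ν) + fromℕ 2 * ν)
          2νM≤ = begin
            fromℕ 2 * ν * mismatches π
              ≈⟨ trans (∑-*ˡ _ _) (*-congˡ (∑mismatchedIn π)) ⟨
            ∑ (λ l → fromℕ 2 * ν * mismatchedIn π l)
              ≤⟨ ∑-mono-≤ (mismatchedIn-bound π unswappable 0<θ) ⟩
            ∑ (λ l → θ ⁻¹ * (deviation l * deviation l) + (θ * (ν * ν) + fromℕ 2 * ν))
              ≈⟨ trans (∑-distrib-+ _ _) (+-cong (∑-*ˡ _ _) (∑-const r _)) ⟩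
            θ ⁻¹ * V + fromℕ r * (θ * (ν * ν) + fromℕ 2 * ν)
              ≤⟨ +-monoˡ-≤ _ (*-monoˡ-≤ (<⇒≤ (⁻¹-pos 0<θ)) V≤) ⟩
            θ ⁻¹ * (fromℕ 2 * h * (ν * ν)) + fromℕ r * (θ * (ν * ν) + fromℕ 2 * ν)
              ∎

    Balanceable : Carrier → Carrier → ℕ → Set
    Balanceable ε h n = ∀ (adj : Fin n → Fin n → Bool) (c : Fin n → Fin r) →
      (1# - fromℕ r ⁻¹ - h) * (fromℕ n * fromℕ n) ≤ degreeSum adj → monochromatic adj c ≤ h * (fromℕ n * fromℕ n) →
      ∃[ π ] editSum c adj π ≤ ε * (fromℕ n * fromℕ n)

    -- One half of ε absorbs the rounding term 2 r n once n is large; the other is shared by the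
    -- terms in h and in θ.
    balanceable : ∀ {ε e e′ θ h n} → e + e ≈ ε → e′ + e′ ≈ e → 0# < θ → fromℕ r * θ ≤ e′ →
      (fromℕ 2 * θ ⁻¹ + fromℕ 3) * h ≤ e′ → fromℕ 2 * fromℕ r ≤ e * fromℕ n → Balanceable ε h n
    balanceable {ε} {e} {e′} {θ} {h} {n} 2e≈ε 2e′≈e 0<θ rθ≤e′ Ch≤e′ 2r≤en adj c dense mono≤ = conclude (optimal c)
      where
      open ≤-Reasoning
      ν = fromℕ n
      conclude : ∃[ π ] (∀ i j → ¬ Swappable c π i j) → ∃[ π ] editSum c adj π ≤ ε * (ν * ν)
      conclude (π , unswappable) = π , (begin
        editSum c adj π
          ≤⟨ editSum-bound c adj 0<θ dense mono≤ π unswappable ⟩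
        ((fromℕ 2 * θ ⁻¹ + fromℕ 3) * h + fromℕ r * θ) * (ν * ν) + fromℕ 2 * fromℕ r * ν
          ≤⟨ +-mono-≤ (*-monoʳ-≤ (square-nonneg ν) (+-mono-≤ Ch≤e′ rθ≤e′)) (*-monoʳ-≤ (fromℕ-nonneg n) 2r≤en) ⟩
        (e′ + e′) * (ν * ν) + e * ν * ν
          ≈⟨ +-cong (*-congʳ 2e′≈e) (*-assoc _ _ _) ⟩
        e * (ν * ν) + e * (ν * ν)
          ≈⟨ trans (sym (distribʳ _ _ _)) (*-congʳ 2e≈ε) ⟩
        ε * (ν * ν)
          ∎)

    balancing : ∀ {ε} → 0# < ε → ∃[ h ] 0# < h × ∃[ n₀ ] (∀ {n} → n₀ ℕ.≤ n → Balanceable ε h n)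
    balancing {ε} 0<ε = choose-e (half 0<ε)
      where
      Goal : Set
      Goal = ∃[ h ] 0# < h × ∃[ n₀ ] (∀ {n} → n₀ ℕ.≤ n → Balanceable ε h n)

      choose-e : ∃[ e ] 0# < e × e + e ≈ ε → Goal
      choose-e (e , 0<e , 2e≈ε) = choose-e′ (half 0<e)
        where
        choose-e′ : ∃[ e′ ] 0# < e′ × e′ + e′ ≈ e → Goal
        choose-e′ (e′ , 0<e′ , 2e′≈e) = choose-θ (small (fromℕ-nonneg r) 0<e′)
          where
          choose-θ : ∃[ θ ] 0# < θ × θ ≤ 1# × fromℕ r * θ < e′ → Goal
          choose-θ (θ , 0<θ , _ , rθ<e′) = choose-h
            (small (+-nonneg (*-nonneg (fromℕ-nonneg 2) (<⇒≤ (⁻¹-pos 0<θ))) (fromℕ-nonneg 3)) 0<e′)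
            (archimedean-< (fromℕ 2 * fromℕ r) 0<e)
            where
            choose-h : ∃[ h ] 0# < h × h ≤ 1# × (fromℕ 2 * θ ⁻¹ + fromℕ 3) * h < e′ →
                       ∃[ n₀ ] (∀ {n} → n₀ ℕ.≤ n → fromℕ 2 * fromℕ r < e * fromℕ n) → Goal
            choose-h (h , 0<h , _ , Ch<e′) (n₀ , 2r<en) = h , 0<h , n₀ , λ n₀≤n →
              balanceable 2e≈ε 2e′≈e 0<θ (<⇒≤ rθ<e′) (<⇒≤ Ch<e′) (<⇒≤ (2r<en n₀≤n))

-- Edge lists, embeddings into boxes, and edit distance.

module Graphs (ℝ : CompleteOrderedField) where

  open CompleteOrderedField ℝ hiding (zero)
  open OrderedField ℝ
  open Sums ℝ
  open Cliques ℝ using (allAdj; clique)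
  open Boxes ℝ using (Box)

  open Graph

  sumᴸ : {A : Set} → (A → Carrier) → List A → Carrier
  sumᴸ f = foldr (λ a s → f a + s) 0#

  sumᴸ-filter : ∀ {A : Set} {P : A → Set} (f : A → Carrier) (P? : Unary.Decidable P) xs →
                sumᴸ f (List.filter P? xs) ≈ sumᴸ (λ a → 𝟙 (does (P? a)) * f a) xs
  sumᴸ-filter f P? List.[]  = refl
  sumᴸ-filter f P? (x List.∷ xs) with does (P? x)
  ... | true  = +-cong (sym (*-identityˡ _)) (sumᴸ-filter f P? xs)
  ... | false = trans (sumᴸ-filter f P? xs) (trans (sym (+-identityˡ _)) (+-congʳ (sym (zeroˡ _))))

  sumᴸ-++ : ∀ {A : Set} (f : A → Carrier) xs ys → sumᴸ f (xs List.++ ys) ≈ sumᴸ f xs + sumᴸ f ys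
  sumᴸ-++ f List.[]  ys = sym (+-identityˡ _)
  sumᴸ-++ f (x List.∷ xs) ys = trans (+-congˡ (sumᴸ-++ f xs ys)) (sym (+-assoc _ _ _))

  sumᴸ-map : ∀ {A B : Set} (f : B → Carrier) (g : A → B) xs → sumᴸ f (List.map g xs) ≈ sumᴸ (f ∘ g) xs
  sumᴸ-map f g List.[]  = refl
  sumᴸ-map f g (x List.∷ xs) = +-congˡ (sumᴸ-map f g xs)

  sumᴸ-tabulate : ∀ {A : Set} {n} (f : A → Carrier) (g : Fin n → A) → sumᴸ f (List.tabulate g) ≈ ∑ (f ∘ g)
  sumᴸ-tabulate {n = zero}  f g = reflexive (≡.sym (∑-zero (f ∘ g)))
  sumᴸ-tabulate {n = suc n} f g = trans (+-congˡ (sumᴸ-tabulate f (g ∘ suc))) (reflexive (≡.sym (∑-suc (f ∘ g))))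

  sumᴸ-cartesianProduct : ∀ {A B : Set} (f : A × B → Carrier) xs ys →
    sumᴸ f (cartesianProduct xs ys) ≈ sumᴸ (λ x → sumᴸ (λ y → f (x , y)) ys) xs
  sumᴸ-cartesianProduct f List.[]  ys = refl
  sumᴸ-cartesianProduct f (x List.∷ xs) ys = trans (sumᴸ-++ f (List.map (x ,_) ys) _)
    (+-cong (sumᴸ-map f (x ,_) ys) (sumᴸ-cartesianProduct f xs ys))

  sumᴸ-cong : ∀ {A : Set} {f g : A → Carrier} → (∀ a → f a ≈ g a) → ∀ xs → sumᴸ f xs ≈ sumᴸ g xs
  sumᴸ-cong f≈g List.[]  = refl
  sumᴸ-cong f≈g (x List.∷ xs) = +-cong (f≈g x) (sumᴸ-cong f≈g xs)

  before : ∀ {n} → Fin n → Fin n → Carrier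
  before i j = 𝟙 (does (i Fin.<? j))

  sumᴸ-pairs : ∀ n (f : Fin n × Fin n → Carrier) → sumᴸ f (pairs n) ≈ ∑ λ i → ∑ λ j → before i j * f (i , j)
  sumᴸ-pairs n f = begin
    sumᴸ f (pairs n)
      ≈⟨ sumᴸ-filter f (λ (i , j) → i Fin.<? j) (cartesianProduct (allFin n) (allFin n)) ⟩
    sumᴸ f′ (cartesianProduct (allFin n) (allFin n))
      ≈⟨ sumᴸ-cartesianProduct f′ (allFin n) (allFin n) ⟩
    sumᴸ (λ i → sumᴸ (λ j → f′ (i , j)) (allFin n)) (allFin n)
      ≈⟨ trans (sumᴸ-cong (λ i → sumᴸ-tabulate (λ j → f′ (i , j)) id) (allFin n)) (sumᴸ-tabulate _ id) ⟩
    ∑ (λ i → ∑ λ j → before i j * f (i , j))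
      ∎
    where
    open ≈
    f′ : Fin n × Fin n → Carrier
    f′ (i , j) = before i j * f (i , j)

  length≈sumᴸ : ∀ {A : Set} p (xs : List A) → fromℕ (length (filterᵇ p xs)) ≈ sumᴸ (λ a → 𝟙 (p a)) xs
  length≈sumᴸ p List.[]  = refl
  length≈sumᴸ p (x List.∷ xs) with p x
  ... | true  = +-congˡ (length≈sumᴸ p xs)
  ... | false = trans (length≈sumᴸ p xs) (sym (+-identityˡ _))

  module _ {n : ℕ} (G : Graph n) where

    adjᵇ : Fin n → Fin n → Bool
    adjᵇ i j = does (adj? G i j)

    adjᵇ-sym : ∀ i j → adjᵇ i j ≡ adjᵇ j i
    adjᵇ-sym i j = does-⇔ (mk⇔ (symmetric G) (symmetric G)) (adj? G i j) (adj? G j i)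

    adjᵇ-irrefl : ∀ i → adjᵇ i i ≡ false
    adjᵇ-irrefl i = dec-false (adj? G i i) (irreflexive G ≡.refl)

    adjᵇ⇒Adj : ∀ {i j} → adjᵇ i j ≡ true → Adj G i j
    adjᵇ⇒Adj {i} {j} _ with adj? G i j
    adjᵇ⇒Adj _  | yes i~j = i~j
    adjᵇ⇒Adj () | no  _

    edgeSum≈ : ∀ x → edgeSum ℝ G x ≈ ∑ λ i → ∑ λ j → before i j * (𝟙 (adjᵇ i j) * (x i * x j))
    edgeSum≈ x = trans (sumᴸ-filter (λ (i , j) → x i * x j) (λ (i , j) → adj? G i j) (pairs n))
      (sumᴸ-pairs n (λ (i , j) → 𝟙 (adjᵇ i j) * (x i * x j)))

    -- Exchanging i and j in one of two copies turns the pairs i < j into all ordered pairs; the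
    -- diagonal vanishes by irreflexivity.
    2*edgeSum≈ : ∀ x → fromℕ 2 * edgeSum ℝ G x ≈ ∑ λ i → ∑ λ j → x i * x j * 𝟙 (adjᵇ i j)
    2*edgeSum≈ x = begin
      fromℕ 2 * edgeSum ℝ G x
        ≈⟨ solve 1 (λ e → :2 :* e := e :+ e) refl _ ⟩
      edgeSum ℝ G x + edgeSum ℝ G x
        ≈⟨ +-cong (edgeSum≈ x) (trans (edgeSum≈ x) (∑-comm _)) ⟩
      ∑ (λ i → ∑ λ j → before i j * (𝟙 (adjᵇ i j) * (x i * x j))) + ∑ (λ i → ∑ λ j → before j i * (𝟙 (adjᵇ j i) * (x j * x i)))
        ≈⟨ trans (∑-cong λ i → ∑-distrib-+ _ _) (∑-distrib-+ _ _) ⟨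
      ∑ (λ i → ∑ λ j → before i j * (𝟙 (adjᵇ i j) * (x i * x j)) + before j i * (𝟙 (adjᵇ j i) * (x j * x i)))
        ≈⟨ ∑-cong (λ i → ∑-cong λ j → pointwise i j) ⟩
      ∑ (λ i → ∑ λ j → x i * x j * 𝟙 (adjᵇ i j))
        ∎
      where
      open ≈
      pointwise : ∀ i j → before i j * (𝟙 (adjᵇ i j) * (x i * x j)) + before j i * (𝟙 (adjᵇ j i) * (x j * x i)) ≈ x i * x j * 𝟙 (adjᵇ i j)
      pointwise i j rewrite adjᵇ-sym j i with Fin.<-cmp i j
      ... | tri< i<j _ j≮i rewrite dec-true (i Fin.<? j) i<j | dec-false (j Fin.<? i) j≮i =
        solve 3 (λ x y a → :1 :* (a :* (x :* y)) :+ :0 :* (a :* (y :* x)) := x :* y :* a) refl (x i) (x j) (𝟙 (adjᵇ i j))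
      ... | tri> i≮j _ j<i rewrite dec-false (i Fin.<? j) i≮j | dec-true (j Fin.<? i) j<i =
        solve 3 (λ x y a → :0 :* (a :* (x :* y)) :+ :1 :* (a :* (y :* x)) := x :* y :* a) refl (x i) (x j) (𝟙 (adjᵇ i j))
      ... | tri≈ _ ≡.refl _ rewrite adjᵇ-irrefl i =
        solve 2 (λ x b → b :* (:0 :* (x :* x)) :+ b :* (:0 :* (x :* x)) := x :* x :* :0) refl (x i) (before i i)

    module _ {m r} (F : Graph m) (A : Fin r → Fin m → Fin n) (A-injective : ∀ l → Injective _≡_ _≡_ (A l))
      (A-clique : ∀ (τ : Fin r → Fin m) → clique adjᵇ (Vec.tabulate λ l → A l (τ l)) ≡ true) where

      allAdj-lookup : ∀ {s v} (L : Vec (Fin n) s) → allAdj adjᵇ v L ≡ true → ∀ i → adjᵇ v (Vec.lookup L i) ≡ true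
      allAdj-lookup {v = v} (u ∷ L) all zero  = ∧-conicalˡ (adjᵇ v u) _ all
      allAdj-lookup {v = v} (u ∷ L) all (suc i) = allAdj-lookup L (∧-conicalʳ (adjᵇ v u) _ all) i

      clique-lookup : ∀ {s} (K : Vec (Fin n) s) → clique adjᵇ K ≡ true → ∀ {i j} → i ≢ j →
                      adjᵇ (Vec.lookup K i) (Vec.lookup K j) ≡ true
      clique-lookup (v ∷ K) K-clique {zero}  {zero}  0≢0 = contradiction ≡.refl 0≢0
      clique-lookup (v ∷ K) K-clique {zero}  {suc j} _  = allAdj-lookup K (∧-conicalˡ (allAdj adjᵇ v K) _ K-clique) j
      clique-lookup (v ∷ K) K-clique {suc i} {zero}  _  = ≡.trans (adjᵇ-sym _ v) (allAdj-lookup K (∧-conicalˡ (allAdj adjᵇ v K) _ K-clique) i)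
      clique-lookup (v ∷ K) K-clique {suc i} {suc j} i≢j = clique-lookup K (∧-conicalʳ (allAdj adjᵇ v K) _ K-clique) (i≢j ∘ ≡.cong suc)

      parts-adjacent : ∀ {l l′} → l ≢ l′ → ∀ i j → adjᵇ (A l i) (A l′ j) ≡ true
      parts-adjacent {l} {l′} l≢l′ i j = ≡.subst₂ (λ u v → adjᵇ u v ≡ true)
        (≡.trans (Vec.lookup∘tabulate (λ k → A k (τ k)) l) (≡.cong (A l) τl≡i)) (≡.trans (Vec.lookup∘tabulate (λ k → A k (τ k)) l′) (≡.cong (A l′) τl′≡j))
        (clique-lookup (Vec.tabulate λ k → A k (τ k)) (A-clique τ) l≢l′)
        where
        τ : Fin r → Fin m
        τ k = if does (k Fin.≟ l) then i else j
        τl≡i : τ l ≡ i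
        τl≡i rewrite dec-true (l Fin.≟ l) ≡.refl = ≡.refl
        τl′≡j : τ l′ ≡ j
        τl′≡j rewrite dec-false (l′ Fin.≟ l) (l≢l′ ∘ ≡.sym) = ≡.refl

      -- Each part has as many vertices as F, so vertex i can go to the i-th place of the part of
      -- its colour, whatever the sizes of the colour classes. Images in different parts differ
      -- because they are adjacent.
      box⇒contains : Colourable F r → Contains G F
      box⇒contains (colour , proper) = (λ i → A (colour i) i) , injective ,
        λ {i} {j} i~j → adjᵇ⇒Adj (parts-adjacent (proper i~j) i j)
        where
        injective : Injective _≡_ _≡_ (λ i → A (colour i) i)
        injective {i} {j} Ai≡Aj with colour i Fin.≟ colour j
        ... | yes ci≡cj = A-injective (colour j) (≡.subst (λ l → A l i ≡ A (colour j) j) ci≡cj Ai≡Aj)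
        ... | no  ci≢cj = contradiction (≡.trans (≡.sym (adjᵇ-irrefl _)) (≡.subst (λ v → adjᵇ (A (colour i) i) v ≡ true) (≡.sym Ai≡Aj) (parts-adjacent ci≢cj i j))) λ ()

    relabelled : Graph n → Permutation′ n → Graph n
    relabelled H π = record
      { Adj  = λ i j → Adj H (π ⟨$⟩ʳ i) (π ⟨$⟩ʳ j)
      ; adj?  = λ i j → adj? H (π ⟨$⟩ʳ i) (π ⟨$⟩ʳ j)
      ; symmetric  = symmetric H
      ; irreflexive = λ { ≡.refl → irreflexive H ≡.refl }
      }

    -- Passing from the pairs i < j to all ordered pairs only increases the sum, and an upper bound
    -- suffices.
    edits-≤ : ∀ H → fromℕ (edits G H) ≤ ∑ λ i → ∑ λ j → 𝟙 (adjᵇ i j xor does (adj? H i j))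
    edits-≤ H = ≤-trans (≤-reflexive (trans (length≈sumᴸ differ (pairs n)) (sumᴸ-pairs n (λ e → 𝟙 (differ e)))))
      (∑-mono-≤ λ i → ∑-mono-≤ λ j → ≤-trans (*-monoʳ-≤ (0≤𝟙 (differ (i , j))) (𝟙≤1 (does (i Fin.<? j)))) (≤-reflexive (*-identityˡ _)))
      where
      differ : Fin n × Fin n → Bool
      differ (i , j) = adjᵇ i j xor does (adj? H i j)

    filterᵇ-cong : ∀ {A : Set} {p q : A → Bool} → (∀ a → p a ≡ q a) → ∀ xs → filterᵇ p xs ≡ filterᵇ q xs
    filterᵇ-cong  p≗q List.[]  = ≡.refl
    filterᵇ-cong {q = q} p≗q (x List.∷ xs) rewrite p≗q x with q x
    ... | true  = ≡.cong (x List.∷_) (filterᵇ-cong p≗q xs)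
    ... | false = filterᵇ-cong p≗q xs

    edits-≅ : ∀ {H T} (H≅T : H ≅ T) → edits G H ≡ edits G (relabelled T (proj₁ H≅T))
    edits-≅ {H} {T} (π , iff) = ≡.cong length (filterᵇ-cong
      (λ (i , j) → ≡.cong (adjᵇ i j xor_) (does-⇔ (iff i j) (adj? H i j) (adj? T (π ⟨$⟩ʳ i) (π ⟨$⟩ʳ j)))) (pairs n))

    -- A graph isomorphic to T has the same adjacencies as some `relabelled T π`, so the minimum may
    -- be taken over permutations.
    editDistance-≤ : ∀ T π → ∃[ d ] IsEditDistance G T d × d ℕ.≤ edits G (relabelled T π)
    editDistance-≤ T π = conclude (least Achieved (π , ≡.refl))
      where
      Achieved : ℕ → Set
      Achieved k = ∃[ π ] edits G (relabelled T π) ≡ k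

      conclude : ∃[ d ] Achieved d × (∀ {k} → Achieved k → d ℕ.≤ k) → ∃[ d ] IsEditDistance G T d × d ℕ.≤ edits G (relabelled T π)
      conclude (d , (ρ , edits≡d) , minimal) = d ,
        ((relabelled T ρ , (ρ , λ i j → ⇔-id _) , edits≡d) ,
         λ H H≅T → minimal (proj₁ H≅T , ≡.sym (edits-≅ {H} {T} H≅T))) ,
        minimal (π , ≡.refl)

-- Assembly of the spectral stability theorem.

module SpectralStability (ℝ : CompleteOrderedField) where

  open CompleteOrderedField ℝ hiding (zero)
  open OrderedField ℝ
  open Powers ℝ
  open Sums ℝ
  open Cliques ℝ using (clique)
  open Stability ℝ using (degreeSum; cliqueCount; monochromatic; Stable; stability)
  open Boxes ℝ using (Box; Boxes; boxes)
  open Weights ℝ using (Concentration; concentration; 2*⁻¹≤1)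
  open RealPowers ℝ using (0≤∣∣; *≤∣∣*∣∣; 0≤^ℝ; x≤x^ℝ)
  open Rescaling ℝ using (Rescaled; Rescalable; rescale)
  open Balancing ℝ using (module Classes)
  open Graphs ℝ

  -- More cliques would yield a box of cliques with |F| vertices in each part, and every
  -- s-colourable F embeds in it.
  few-cliques : ∀ {m} (F : Graph m) {s c n} → Colourable F s → Boxes s m c n →
                (G : Graph n) → ¬ Contains G F → cliqueCount (adjᵇ G) s ≤ c * fromℕ n ^ s
  few-cliques {m} F {s} {c} {n} colourable boxes G F-free = ≮⇒≥ λ many →
    contains (boxes (clique (adjᵇ G)) (<⇒≤ many))
    where
    contains : ¬ Box m (clique (adjᵇ G))
    contains (A , A-injective , A-clique) = F-free (box⇒contains G F A A-injective A-clique colourable)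

  module _ {p : Carrier} (1<p : 1# < p) where

    exponent : Carrier
    exponent = fromℕ 2 - fromℕ 2 * p ⁻¹

    ∣x∣≤1 : ∀ {n} (x : Fin n → Carrier) → ∑ (λ i → ∣ x i ∣ ^ℝ p) ≈ 1# → ∀ i → ∣ x i ∣ ≤ 1#
    ∣x∣≤1 x ∑≈1 i = ≮⇒≥ λ 1<∣x∣ → <.irrefl refl (begin-strict
      1#  <⟨ 1<∣x∣ ⟩
      ∣ x i ∣  ≤⟨ x≤x^ℝ (<⇒≤ 1<∣x∣) (<⇒≤ 1<p) ⟩
      ∣ x i ∣ ^ℝ p  ≤⟨ term≤∑ {f = λ i → ∣ x i ∣ ^ℝ p} (λ i → 0≤^ℝ (≤-trans 0≤1 (<⇒≤ 1<p))) i ⟩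
      ∑ (λ i → ∣ x i ∣ ^ℝ p)  ≈⟨ ∑≈1 ⟩
      1#  ∎)
      where open ≤-Reasoning

    -- The factor 1 + δ lost in rescaling is absorbed by doubling δ, since (1 + δ)(1 - ι - 2δ) ≤ 1 -
    -- ι - δ. Passing to absolute values can only raise the form.
    rescaled-form : ∀ {k n δ ι} (G : Graph n) (x : Fin n → Carrier) (r : Rescaled p k δ n (λ i → ∣ x i ∣)) →
      0# < δ → 0# ≤ ι → 0# ≤ 1# - ι - δ →
      (1# - ι - δ) * fromℕ n ^ℝ exponent ≤ fromℕ 2 * edgeSum ℝ G x →
      (1# - ι - fromℕ 2 * δ) * (fromℕ n * fromℕ n) ≤
      ∑ λ i → ∑ λ j → proj₁ (proj₂ r) i ^ k * proj₁ (proj₂ r) j ^ k * 𝟙 (adjᵇ G i j)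
    rescaled-form {k} {n} {δ} {ι} G x (μ , v , _ , v^k≈ , _ , n²≤) 0<δ 0≤ι 0≤β-δ dense =
      *-cancelˡ-≤ (+-pos-nonneg 0<1 (<⇒≤ 0<δ)) (begin
        (1# + δ) * ((1# - ι - fromℕ 2 * δ) * (ν * ν))
          ≤⟨ ≤-cert (solve 3 (λ i d q → (:1 :- i :- d) :* q := (:1 :+ d) :* ((:1 :- i :- :2 :* d) :* q) :+ d :* (i :+ :2 :* d) :* q) refl ι δ (ν * ν))
               (*-nonneg (*-nonneg (<⇒≤ 0<δ) (+-nonneg 0≤ι (*-nonneg (fromℕ-nonneg 2) (<⇒≤ 0<δ)))) (square-nonneg ν)) ⟩
        (1# - ι - δ) * (ν * ν)
          ≤⟨ *-monoˡ-≤ 0≤β-δ n²≤ ⟩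
        (1# - ι - δ) * ((1# + δ) * (μ * μ * ν ^ℝ exponent))
          ≈⟨ solve 4 (λ b d m e → b :* (d :* (m :* e)) := d :* (m :* (b :* e))) refl (1# - ι - δ) (1# + δ) (μ * μ) (ν ^ℝ exponent) ⟩
        (1# + δ) * (μ * μ * ((1# - ι - δ) * ν ^ℝ exponent))
          ≤⟨ *-monoˡ-≤ (+-nonneg 0≤1 (<⇒≤ 0<δ)) (*-monoˡ-≤ (square-nonneg μ) (≤-trans dense edgeSum≤)) ⟩
        (1# + δ) * (μ * μ * ∑ (λ i → ∑ λ j → ∣ x i ∣ * ∣ x j ∣ * 𝟙 (adjᵇ G i j)))
          ≈⟨ *-congˡ scale ⟩
        (1# + δ) * ∑ (λ i → ∑ λ j → v i ^ k * v j ^ k * 𝟙 (adjᵇ G i j))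
          ∎)
      where
      open ≤-Reasoning
      ν = fromℕ n

      edgeSum≤ : fromℕ 2 * edgeSum ℝ G x ≤ ∑ λ i → ∑ λ j → ∣ x i ∣ * ∣ x j ∣ * 𝟙 (adjᵇ G i j)
      edgeSum≤ = ≤-trans (≤-reflexive (2*edgeSum≈ G x))
        (∑-mono-≤ λ i → ∑-mono-≤ λ j → *-monoʳ-≤ (0≤𝟙 (adjᵇ G i j)) (*≤∣∣*∣∣ (x i) (x j)))

      scale : μ * μ * ∑ (λ i → ∑ λ j → ∣ x i ∣ * ∣ x j ∣ * 𝟙 (adjᵇ G i j)) ≈ ∑ (λ i → ∑ λ j → v i ^ k * v j ^ k * 𝟙 (adjᵇ G i j))
      scale = trans (sym (trans (∑-cong λ i → ∑-*ˡ (μ * μ) _) (∑-*ˡ (μ * μ) _))) (∑-cong λ i → ∑-cong λ j →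
        trans (solve 4 (λ m x y a → m :* m :* (x :* y :* a) := (m :* x) :* (m :* y) :* a) refl μ ∣ x i ∣ ∣ x j ∣ (𝟙 (adjᵇ G i j)))
          (*-congʳ (sym (*-cong (v^k≈ i) (v^k≈ j)))))

  weaken : ∀ {ι a b q y} → 0# ≤ q → a ≤ b → (1# - ι - a) * q ≤ y → (1# - ι - b) * q ≤ y
  weaken {ι} {a} {b} {q} 0≤q a≤b = ≤-trans (*-monoʳ-≤ 0≤q
    (≤-cert (solve 3 (λ i a b → :1 :- i :- a := :1 :- i :- b :+ (b :- a)) refl ι a b) (≤⇒0≤- a≤b)))

  module _ {m} (F : Graph m) (R : ℕ) (colourable : Colourable F (suc (suc (suc R)))) {p : Carrier} (1<p : 1# < p)
    {ε : Carrier} (0<ε : 0# < ε) where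

    private
      r : ℕ
      r = suc (suc R)
      ι : Carrier
      ι = fromℕ r ⁻¹

    open Classes (suc R)

    Conclusion : ∀ {n} → Graph n → Set₁
    Conclusion {n} G = ∃[ d ] IsEditDistance G (turán r n) d × fromℕ d ≤ ε * fromℕ n ^ 2

    -- The tolerances hB, hS and hC belong to balancing, stability and concentration, and hE is the
    -- clique density. Concentration returns the edge deficit e, which must suit both stability and
    -- balancing.
    near-turán : ∀ {k n} (G : Graph n) → ¬ Contains G F → 1# ≤ fromℕ n → ∀ {δ e hB hS hC hE} →
      0# < δ → fromℕ 2 * δ ≤ 1# → fromℕ 2 * δ ≤ hC → e ≤ hB → e ≤ hS → hE ≤ hS → hE ≤ hC →
      Boxes (suc r) m hE n →
      Concentration k R e hC →
      Stable (suc R) hB hS →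
      Balanceable ε hB n →
      (x : Fin n → Carrier) → Rescaled p k δ n (λ i → ∣ x i ∣) →
      (1# - ι - δ) * fromℕ n ^ℝ exponent 1<p ≤ fromℕ 2 * edgeSum ℝ G x →
      Conclusion G
    near-turán {k} {n} G F-free 1≤n {δ} {e} {hB} {hS} {hC} {hE} 0<δ 2δ≤1 2δ≤hC e≤hB e≤hS hE≤hS hE≤hC
      boxes concentrated stable balanced x rescaled@(μ , v , 0≤v , _ , ∑v≤n , _) dense =
      colour (stable (adjᵇ G) (adjᵇ-sym G) 0<n (weaken {ι} 0≤n² e≤hS dense-e) (few hE≤hS))
      where
      0<n : 0# < fromℕ n
      0<n = <-≤-trans 0<1 1≤n

      0≤n² : 0# ≤ fromℕ n * fromℕ n
      0≤n² = square-nonneg (fromℕ n)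

      few : ∀ {h} → hE ≤ h → cliqueCount (adjᵇ G) (suc r) ≤ h * fromℕ n ^ suc r
      few hE≤h = ≤-trans (few-cliques F colourable boxes G F-free) (*-monoʳ-≤ (^-nonneg (suc r) (fromℕ-nonneg n)) hE≤h)

      0≤ι : 0# ≤ ι
      0≤ι = <⇒≤ (⁻¹-pos (fromℕ-pos (suc R)))

      0≤β-δ : 0# ≤ 1# - ι - δ
      0≤β-δ = *-cancelˡ-≤ (fromℕ-pos 1) (≤-cert
        (solve 2 (λ i d → :2 :* (:1 :- i :- d) := :2 :* :0 :+ ((:1 :- :2 :* i) :+ (:1 :- :2 :* d))) refl ι δ)
        (+-nonneg (≤⇒0≤- (2*⁻¹≤1 R)) (≤⇒0≤- 2δ≤1)))

      dense-e : (1# - ι - e) * (fromℕ n * fromℕ n) ≤ degreeSum (adjᵇ G)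
      dense-e = concentrated (adjᵇ G) (adjᵇ-sym G) 0<n v 0≤v ∑v≤n
        (weaken {ι} 0≤n² 2δ≤hC (rescaled-form 1<p {k} {n} {δ} {ι} G x rescaled 0<δ 0≤ι 0≤β-δ dense)) (few hE≤hC)

      permute : ∀ c → ∃[ π ] editSum c (adjᵇ G) π ≤ ε * (fromℕ n * fromℕ n) → Conclusion G
      permute c (π , edits≤) = distance (editDistance-≤ G (turán r n) π)
        where
        distance : ∃[ d ] IsEditDistance G (turán r n) d × d ℕ.≤ edits G (relabelled G (turán r n) π) → Conclusion G
        distance (d , isEditDistance , d≤edits) = d , isEditDistance , (begin
          fromℕ d  ≤⟨ fromℕ-mono-≤ d≤edits ⟩
          fromℕ (edits G (relabelled G (turán r n) π))  ≤⟨ edits-≤ G (relabelled G (turán r n) π) ⟩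
          editSum c (adjᵇ G) π  ≤⟨ edits≤ ⟩
          ε * (fromℕ n * fromℕ n)  ≈⟨ *-congˡ (*-congˡ (*-identityʳ _)) ⟨
          ε * fromℕ n ^ 2  ∎)
          where open ≤-Reasoning

      colour : ∃[ c ] monochromatic {r = r} (adjᵇ G) c ≤ hB * (fromℕ n * fromℕ n) → Conclusion G
      colour (c , mono≤) = permute c (balanced (adjᵇ G) c (weaken {ι} 0≤n² e≤hB dense-e) mono≤)

    Goal : Set₁
    Goal = ∃[ δ ] 0# < δ × ∃[ n₀ ] (∀ n → n₀ ℕ.≤ n → (G : Graph n) → ¬ Contains G F →
      ∀ λᵖ → IsSpectralRadius ℝ p G λᵖ → (1# - ι - δ) * fromℕ n ^ℝ exponent 1<p ≤ λᵖ → Conclusion G)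

    spectral-stability : Goal
    spectral-stability = choose-k (rescale 1<p) (balancing 0<ε)
      where
      choose-k : ∃[ k ] Rescalable p k →
        ∃[ h ] 0# < h × ∃[ n₀ ] (∀ {n} → n₀ ℕ.≤ n → Balanceable ε h n) → Goal
      choose-k (k , rescaled) (hB , 0<hB , nB , balanced) = choose-hS (stability (suc R) 0<hB)
        where
        choose-hS : ∃[ h ] 0# < h × Stable (suc R) hB h → Goal
        choose-hS (hS , 0<hS , stable) = choose-e (min-pos 0<hB 0<hS)
          where
          choose-e : ∃[ e ] 0# < e × e ≤ hB × e ≤ hS → Goal
          choose-e (e , 0<e , e≤hB , e≤hS) = choose-hC (concentration k R 0<e)
            where
            choose-hC : ∃[ h ] 0# < h × Concentration k R e h → Goal
            choose-hC (hC , 0<hC , concentrated) = choose-hE (min-pos 0<hS 0<hC)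
              where
              choose-hE : ∃[ h ] 0# < h × h ≤ hS × h ≤ hC → Goal
              choose-hE (hE , 0<hE , hE≤hS , hE≤hC) =
                choose-δ (boxes (suc r) m 0<hE) (small₂ (fromℕ-nonneg 2) 0<1 (fromℕ-nonneg 2) 0<hC)
                where
                choose-δ : ∃[ n₀ ] (∀ {n} → n₀ ℕ.≤ n → Boxes (suc r) m hE n) →
                  ∃[ δ ] 0# < δ × fromℕ 2 * δ < 1# × fromℕ 2 * δ < hC → Goal
                choose-δ (nE , boxes) (δ , 0<δ , 2δ<1 , 2δ<hC) = δ , 0<δ , n₀ , main
                  where
                  -- The successor guarantees n ≥ 1, as the rescaling by roots of n demands.
                  n₀ = suc (nB ℕ.⊔ nE)
                  main : ∀ n → n₀ ℕ.≤ n → (G : Graph n) → ¬ Contains G F →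
                    ∀ λᵖ → IsSpectralRadius ℝ p G λᵖ → (1# - ι - δ) * fromℕ n ^ℝ exponent 1<p ≤ λᵖ → Conclusion G
                  main n n₀≤n G F-free λᵖ ((x , ∑≈1 , λ≈) , _) dense =
                    near-turán {k} G F-free 1≤n 0<δ (<⇒≤ 2δ<1) (<⇒≤ 2δ<hC) e≤hB e≤hS hE≤hS hE≤hC
                      (boxes (ℕ.≤-trans (ℕ.m≤n⊔m nB nE) (ℕ.<⇒≤ n₀≤n))) concentrated stable
                      (balanced (ℕ.≤-trans (ℕ.m≤m⊔n nB nE) (ℕ.<⇒≤ n₀≤n))) x
                      (rescaled 0<δ 1≤n (λ i → ∣ x i ∣) (λ i → 0≤∣∣ (x i)) (∣x∣≤1 1<p x ∑≈1′) (≤-reflexive ∑≈1′))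
                      (≤-trans dense (≤-reflexive λ≈))
                    where
                    1≤n : 1# ≤ fromℕ n
                    1≤n = ≤-trans (≤-reflexive (sym (+-identityʳ 1#))) (fromℕ-mono-≤ {1} {n} (ℕ.≤-trans (s≤s z≤n) n₀≤n))
                    ∑≈1′ : ∑ (λ i → ∣ x i ∣ ^ℝ p) ≈ 1#
                    ∑≈1′ = trans (reflexive (∑≡sum _)) ∑≈1

theorem3p11 : (ℝ : CompleteOrderedField) →
    let open CompleteOrderedField ℝ in
    ∀ {m} (F : Graph m) (r : ℕ) .{{_ : NonZero r}} →
    HasChromaticNumber F (suc r) → 3 ℕ.≤ suc r →
    ∀ (p : Carrier) → 1# < p →
    ∀ (ε : Carrier) → 0# < ε →
    ∃[ δ ] 0# < δ × ∃[ n₀ ] (∀ n → n₀ ℕ.≤ n →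
    (G : Graph n) → ¬ Contains G F →
    ∀ λᵖ → IsSpectralRadius ℝ p G λᵖ →
    (1# - fromℕ r ⁻¹ - δ) * fromℕ n ^ℝ (fromℕ 2 - fromℕ 2 * p ⁻¹) ≤ λᵖ →
    ∃[ d ] IsEditDistance G (turán r n) d × fromℕ d ≤ ε * fromℕ n ^ 2)
theorem3p11 ℝ F 0 _ (s≤s ()) _ _ _ _
theorem3p11 ℝ F 1 _ (s≤s (s≤s ())) _ _ _ _
theorem3p11 ℝ F (suc (suc R)) (colourable , _) _ p 1<p ε 0<ε =
  SpectralStability.spectral-stability ℝ F R colourable 1<p 0<ε
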